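{- In the formal power series ring $\mathbb{Z}[t][[u]]$, \[ \sum_{n=0}^\infty P_{F_n}(t) u^{n}=1+\frac{2 u}{1-u+\sqrt{(u-1)^2-4 tu^2}}, \] where the square root is the power series in $u$ with constant term $1$.
   Context: For a matroid $M$ let $L(M)$ be its lattice of flats, $\mathrm{rk}\, M$ its rank, $\chi_M(t)$ its characteristic polynomial; for a flat $F$, $M_F$ is the localization (restriction to $F$) and $M^F$ the contraction at $F$. The Kazhdan–Lusztig polynomial is the unique assignment of $P_M(t)\in\mathbb{Z}[t]$ to each loopless matroid $M$ with: $P_M=1$ if $\mathrm{rk}\, M=0$; $\deg P_M<\frac12\mathrm{rk}\, M$ if $\mathrm{rk}\, M>0$; $t^{\mathrm{rk}\, M}P_M(t^{ -1})=\sum_{F\in L(M)}\chi_{M_F}(t)P_{M^F}(t)$. For a graph $G$, $P_G=P_{M(G)}$. The fan graph $F_n$ ($n\ge1$) has vertices $0,1,\dots,n$, edges $\{i,i+1\}$ ($1\le i<n$) and $\{0,i\}$ ($1\le i\le n$); $F_0$ is the single-vertex graph (so $P_{F_0}=1$). -}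

module Defs where

open import Data.Bool using (Bool; true; false; if_then_else_; not; _∧_; _∨_)
open import Data.Nat using (ℕ; zero; suc; _∸_; _≤_; _<_; _≡ᵇ_; _≤ᵇ_; _<ᵇ_) renaming (_+_ to _+ℕ_; _*_ to _*ℕ_)
open import Data.Integer using (ℤ; +_; -_; _+_; _-_; _*_)
open import Data.Fin using (Fin; zero; suc; toℕ; inject₁)
open import Data.Fin.Subset using (Subset; _⊆_; _∈_; _∪_; _∩_; _─_; ∁; ⁅_⁆; ∣_∣; ⊤; inside; outside)
open import Data.List using (List; []; _∷_; [_]; map; _++_; foldr; length; upTo; allFin)
open import Data.Bool.ListAction using (all; any)
open import Data.Vec using (Vec; lookup; tabulate)
open import Data.Product using (Σ; _×_; _,_; ∃)
open import Relation.Binary.PropositionalEquality using (_≡_)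

sumℤ : List ℤ → ℤ
sumℤ = foldr _+_ (+ 0)

allSubsets : (N : ℕ) → List (Subset N)
allSubsets zero    = [ Data.Vec.[] ]
allSubsets (suc N) = map (inside Data.Vec.∷_) (allSubsets N)
                  ++ map (outside Data.Vec.∷_) (allSubsets N)

_∈ᵇ_ : {n : ℕ} → Fin n → Subset n → Bool
x ∈ᵇ X = lookup X x

_⊆ᵇ_ : {n : ℕ} → Subset n → Subset n → Bool
_⊆ᵇ_ {n} X Y = all (λ x → not (x ∈ᵇ X) ∨ (x ∈ᵇ Y)) (allFin n)

sign : ℕ → ℤ
sign zero    = + 1
sign (suc k) = - sign k

δ₀ : ℕ → ℤ
δ₀ zero    = + 1
δ₀ (suc _) = + 0

-- Polynomials in ℤ[t], represented by coefficient functions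
-- (p k = coefficient of t^k), equality = coefficientwise equality.

Coeffs : Set
Coeffs = ℕ → ℤ

IsPoly : Coeffs → Set
IsPoly p = ∃ λ d → ∀ k → d ≤ k → p k ≡ + 0

0ₚ : Coeffs
0ₚ _ = + 0

_+ₚ_ : Coeffs → Coeffs → Coeffs
(p +ₚ q) k = p k + q k

_*ₚ_ : Coeffs → Coeffs → Coeffs
(p *ₚ q) k = sumℤ (map (λ i → p i * q (k ∸ i)) (upTo (suc k)))

sumₚ : {A : Set} → List A → (A → Coeffs) → Coeffs
sumₚ xs f = foldr (λ x acc → f x +ₚ acc) 0ₚ xs

-- t^r p(t^{-1})   (meaningful when deg p ≤ r)
rev : ℕ → Coeffs → Coeffs
rev r p k = if k ≤ᵇ r then p (r ∸ k) else + 0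

-- Matroids, given by a rank function.  The ground set is E ⊆ Fin N;
-- rk is only meaningful on subsets of E.

record MatroidData : Set where
  constructor mkM
  field
    N  : ℕ
    E  : Subset N
    rk : Subset N → ℕ
open MatroidData public

record IsMatroid (M : MatroidData) : Set where
  field
    R1 : ∀ X → X ⊆ E M → rk M X ≤ ∣ X ∣
    R2 : ∀ X Y → X ⊆ Y → Y ⊆ E M → rk M X ≤ rk M Y
    R3 : ∀ X Y → X ⊆ E M → Y ⊆ E M →
         rk M (X ∪ Y) Data.Nat.+ rk M (X ∩ Y) ≤ rk M X Data.Nat.+ rk M Y

Loopless : MatroidData → Set
Loopless M = ∀ e → e ∈ E M → rk M ⁅ e ⁆ ≡ 1

rank : MatroidData → ℕ
rank M = rk M (E M)

isFlat : (M : MatroidData) → Subset (N M) → Bool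
isFlat M F = (F ⊆ᵇ E M) ∧
  all (λ e → if (e ∈ᵇ E M) ∧ not (e ∈ᵇ F)
             then rk M F <ᵇ rk M (F ∪ ⁅ e ⁆) else true) (allFin (N M))

loc : (M : MatroidData) → Subset (N M) → MatroidData
loc M F = mkM (N M) F (rk M)

con : (M : MatroidData) → Subset (N M) → MatroidData
con M F = mkM (N M) (E M ─ F) (λ X → rk M (X ∪ F) ∸ rk M F)

χ : MatroidData → Coeffs
χ M = sumₚ (allSubsets (N M)) λ X →
  if X ⊆ᵇ E M
  then (λ k → if (rank M ∸ rk M X) ≡ᵇ k then sign ∣ X ∣ else + 0)
  else 0ₚ

-- P is (on loopless matroids) the Kazhdan–Lusztig polynomial assignment:
--  P_M = 1 if rk M = 0;  deg P_M < rk M / 2 if rk M > 0;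
--  t^{rk M} P_M(t^{-1}) = Σ_{F ∈ L(M)} χ_{M_F}(t) P_{M^F}(t).
IsKL : (MatroidData → Coeffs) → Set
IsKL P = ∀ M → IsMatroid M → Loopless M →
    (rank M ≡ 0 → ∀ k → P M k ≡ δ₀ k)
  × (0 < rank M → ∀ k → rank M ≤ 2 *ℕ k → P M k ≡ + 0)
  × (∀ k → rev (rank M) (P M) k
           ≡ sumₚ (allSubsets (N M))
               (λ F → if isFlat M F then χ (loc M F) *ₚ P (con M F) else 0ₚ) k)

record Graph : Set where
  constructor mkG
  field
    V     : ℕ
    edges : List (Fin V × Fin V)
open Graph public

_==_ : {n : ℕ} → Fin n → Fin n → Bool
a == b = toℕ a ≡ᵇ toℕ b

step : (G : Graph) → Subset (length (edges G)) → Subset (V G) → Subset (V G)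
step G X R = tabulate λ w → (w ∈ᵇ R) ∨
  any (λ e → (e ∈ᵇ X) ∧ edgeHit (Data.List.lookup (edges G) e) w)
      (allFin (length (edges G)))
  where
  edgeHit : Fin (V G) × Fin (V G) → Fin (V G) → Bool
  edgeHit (a , b) w = ((a ∈ᵇ R) ∧ (w == b)) ∨ ((b ∈ᵇ R) ∧ (w == a))

iter : {A : Set} → ℕ → (A → A) → A → A
iter zero    f a = a
iter (suc n) f a = f (iter n f a)

reach : (G : Graph) → Subset (length (edges G)) → Fin (V G) → Subset (V G)
reach G X v = iter (V G) (step G X) ⁅ v ⁆

-- number of connected components of (V, X): count the vertices that are
-- the smallest vertex of their component
components : (G : Graph) → Subset (length (edges G)) → ℕ
components G X = Data.List.length
  (Data.List.filterᵇ (λ v → all (λ w → not ((toℕ w <ᵇ toℕ v) ∧ (w ∈ᵇ reach G X v)))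
                                (allFin (V G)))
                     (allFin (V G)))

cycleMatroid : Graph → MatroidData
cycleMatroid G = mkM (length (edges G)) ⊤ (λ X → V G ∸ components G X)

fanEdges : (n : ℕ) → List (Fin (suc n) × Fin (suc n))
fanEdges zero    = []
fanEdges (suc m) =
  map (λ i → (zero , suc i)) (allFin (suc m))
  ++ map (λ j → (suc (inject₁ j) , suc (suc j))) (allFin m)

fan : ℕ → Graph
fan n = mkG (suc n) (fanEdges n)

-- Formal power series in u over ℤ[t]:  A n k = coefficient of u^n t^k.

Ser : Set
Ser = ℕ → Coeffs

IsPolySer : Ser → Set
IsPolySer A = ∀ n → IsPoly (A n)

_≈ₛ_ : Ser → Ser → Set
A ≈ₛ B = ∀ n k → A n k ≡ B n k

_+ₛ_ : Ser → Ser → Ser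
(A +ₛ B) n k = A n k + B n k

_-ₛ_ : Ser → Ser → Ser
(A -ₛ B) n k = A n k - B n k

_*ₛ_ : Ser → Ser → Ser
(A *ₛ B) n = sumₚ (upTo (suc n)) (λ i → A i *ₚ B (n ∸ i))

infixl 6 _+ₛ_ _-ₛ_
infixl 7 _*ₛ_
infix 4 _≈ₛ_

constₛ : ℤ → Ser
constₛ c n k = if (n ≡ᵇ 0) ∧ (k ≡ᵇ 0) then c else + 0

1ₛ : Ser
1ₛ = constₛ (+ 1)

uₛ : Ser
uₛ n k = if (n ≡ᵇ 1) ∧ (k ≡ᵇ 0) then + 1 else + 0

tₛ : Ser
tₛ n k = if (n ≡ᵇ 0) ∧ (k ≡ᵇ 1) then + 1 else + 0

discr : Ser
discr = (uₛ -ₛ 1ₛ) *ₛ (uₛ -ₛ 1ₛ) -ₛ constₛ (+ 4) *ₛ tₛ *ₛ uₛ *ₛ uₛ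

IsSqrtDiscr : Ser → Set
IsSqrtDiscr S = IsPolySer S × (∀ k → S 0 k ≡ δ₀ k) × (S *ₛ S ≈ₛ discr)

fanGF : (MatroidData → Coeffs) → Ser
fanGF P n = P (cycleMatroid (fan n))

-- "A = 1 + 2u / (1 − u + S)": A − 1 is the quotient of 2u by 1 − u + S
-- in the integral domain ℤ[t][[u]], i.e. (A − 1)(1 − u + S) = 2u.
IsFanRHS : Ser → Ser → Set
IsFanRHS S A = (A -ₛ 1ₛ) *ₛ (1ₛ -ₛ uₛ +ₛ S) ≈ₛ constₛ (+ 2) *ₛ uₛ

{-# OPTIONS --safe #-}

-- The Kazhdan–Lusztig polynomials of the contractions M^F of a matroid M are the
-- only family f_F of polynomials of small degree with f_E = 1 that satisfies the
-- recursion on all intervals of the lattice of flats, so it is enough to guess f.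
-- A flat F of the fan connects some of the vertices 1,…,n to 0 and cuts the
-- remaining runs of consecutive vertices into intervals; the guess is the product
-- over the runs of the Motzkin polynomials m_{k-1}, k being the number of intervals
-- of the run, where m = 1 + u m + t u² m² for the generating function m.
-- The sum over the flats above F of χ times f is computed by reading the fan from
-- left to right (a transfer matrix).  It factors over the runs of F, and the factor
-- of a run is the reversed polynomial t^k m_{k-1}(1/t), because the binomial
-- transform of m with parameter t - 1 is the generating function of the reversed
-- Motzkin polynomials.

module Submission where

-- Formal power series over a commutative ring.

open import Level using (0ℓ)
open import Algebra.Bundles using (CommutativeRing)
open import Data.Nat using (ℕ)
open import Data.Product using (Σ; _×_)
open import Algebra.Solver.Ring.AlmostCommutativeRing using (fromCommutativeRing; _-Raw-AlmostCommutative⟶_)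

-- Origin of the guess: up to parallel edges, the contraction of a fan at a flat is a union of
-- smaller fans glued at 0, one for each run, with the intervals as vertices. A polynomial that
-- depends only on the lattice of flats and is multiplicative on direct sums must then be such a
-- product. The quadratic equation of m is what the claimed formula becomes when `A - 1 = u m` is
-- inserted and the square root is eliminated. Origin of the binomial transform: inside a run, a
-- larger flat either merges the current interval with the next one, which contributes t - 1, or
-- separates them, which lengthens its own current run from j to j + 1. The state therefore contains
-- the unbounded number j, and k letters produce the sum of C(k,i) (t-1)^(k-i) m_(j+i). Solving for
-- all j at once reduces the infinite transfer matrix to two sequences, `coneSum` and `pathSum 0`,
-- with closed forms in the reversed Motzkin series.

module PowerSeries (R : CommutativeRing 0ℓ 0ℓ) where

  open import Data.Nat using (ℕ; zero; suc; _<_; z≤n; s≤s)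
  open import Data.Nat.Properties using (≤-refl; m≤n⇒m≤1+n)
  open import Data.Product using (_,_)
  open CommutativeRing R
  open import Algebra.Properties.Ring ring using (-0#≈0#)
  open import Relation.Binary.Reasoning.Setoid setoid
  open import Algebra.Properties.CommutativeSemigroup +-commutativeSemigroup using (interchange; x∙yz≈y∙xz)

  Series : Set
  Series = ℕ → Carrier

  infix 4 _≋_
  _≋_ : Series → Series → Set
  f ≋ g = ∀ n → f n ≈ g n

  shift : Series → Series
  shift f n = f (suc n)

  infixl 6 _⊞_
  _⊞_ : Series → Series → Series
  (f ⊞ g) n = f n + g n

  ⊟_ : Series → Series
  (⊟ f) n = - f n

  const : Carrier → Series
  const a zero    = a
  const a (suc _) = 0#

  𝟘 : Series
  𝟘 _ = 0#

  infixl 7 _⊛_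
  -- Structural recursion on the head of the first factor avoids finite sums and index subtraction.
  _⊛_ : Series → Series → Series
  (f ⊛ g) zero    = f 0 * g 0
  (f ⊛ g) (suc n) = f 0 * g (suc n) + (shift f ⊛ g) n

  ⊛-cong : ∀ {f f′ g g′} → f ≋ f′ → g ≋ g′ → f ⊛ g ≋ f′ ⊛ g′
  ⊛-cong p q zero    = *-cong (p 0) (q 0)
  ⊛-cong p q (suc n) =
    +-cong (*-cong (p 0) (q (suc n))) (⊛-cong (λ i → p (suc i)) q n)

  ⊛-zeroˡ : ∀ f g → f ≋ 𝟘 → f ⊛ g ≋ 𝟘
  ⊛-zeroˡ f g p zero    = trans (*-congʳ (p 0)) (zeroˡ _)
  ⊛-zeroˡ f g p (suc n) = trans (+-cong (trans (*-congʳ (p 0)) (zeroˡ _))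
    (⊛-zeroˡ (shift f) g (λ i → p (suc i)) n)) (+-identityˡ 0#)

  const-⊛ : ∀ a g n → (const a ⊛ g) n ≈ a * g n
  const-⊛ a g zero    = refl
  const-⊛ a g (suc n) =
    trans (+-congˡ (⊛-zeroˡ _ g (λ _ → refl) n)) (+-identityʳ _)

  ⊛-distribʳ : ∀ h f g → (f ⊞ g) ⊛ h ≋ (f ⊛ h) ⊞ (g ⊛ h)
  ⊛-distribʳ h f g zero    = distribʳ _ _ _
  ⊛-distribʳ h f g (suc n) = trans
    (+-cong (distribʳ _ _ _) (⊛-distribʳ h (shift f) (shift g) n))
    (interchange _ _ _ _)

  scale-⊛ : ∀ a f g n → ((λ i → a * f i) ⊛ g) n ≈ a * (f ⊛ g) n
  scale-⊛ a f g zero    = *-assoc _ _ _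
  scale-⊛ a f g (suc n) = trans
    (+-cong (*-assoc _ _ _) (scale-⊛ a (shift f) g n))
    (sym (distribˡ _ _ _))

  -- The mirror image of the defining recursion, peeling the second factor; comparing the two gives
  -- commutativity.
  ⊛-unfoldʳ : ∀ f g n → (f ⊛ g) (suc n) ≈ f (suc n) * g 0 + (f ⊛ shift g) n
  ⊛-unfoldʳ f g zero    = +-comm _ _
  ⊛-unfoldʳ f g (suc n) = trans (+-congˡ (⊛-unfoldʳ (shift f) g n))
    (x∙yz≈y∙xz _ _ _)

  ⊛-comm : ∀ f g → f ⊛ g ≋ g ⊛ f
  ⊛-comm f g zero    = *-comm _ _
  ⊛-comm f g (suc n) = trans
    (+-cong (*-comm _ _) (⊛-comm (shift f) g n))
    (sym (⊛-unfoldʳ g f n))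

  ⊛-assoc : ∀ f g h → (f ⊛ g) ⊛ h ≋ f ⊛ (g ⊛ h)
  ⊛-assoc f g h zero    = *-assoc _ _ _
  ⊛-assoc f g h (suc n) = begin
    f 0 * g 0 * h (suc n) + (((λ i → f 0 * g (suc i)) ⊞ (shift f ⊛ g)) ⊛ h) n
      ≈⟨ +-cong (*-assoc _ _ _) (⊛-distribʳ h _ _ n) ⟩
    f 0 * (g 0 * h (suc n)) + (((λ i → f 0 * g (suc i)) ⊛ h) n + ((shift f ⊛ g) ⊛ h) n)
      ≈⟨ +-congˡ (+-cong (scale-⊛ _ _ _ n) (⊛-assoc (shift f) g h n)) ⟩
    f 0 * (g 0 * h (suc n)) + (f 0 * (shift g ⊛ h) n + (shift f ⊛ (g ⊛ h)) n)
      ≈⟨ +-assoc _ _ _ ⟨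
    f 0 * (g 0 * h (suc n)) + f 0 * (shift g ⊛ h) n + (shift f ⊛ (g ⊛ h)) n
      ≈⟨ +-congʳ (sym (distribˡ _ _ _)) ⟩
    f 0 * (g 0 * h (suc n) + (shift g ⊛ h) n) + (shift f ⊛ (g ⊛ h)) n ∎

  ⊛-identityˡ : ∀ f → const 1# ⊛ f ≋ f
  ⊛-identityˡ f n = trans (const-⊛ 1# f n) (*-identityˡ _)

  up : Series → Series
  up f zero    = 0#
  up f (suc n) = f n

  up-cong : ∀ {f g} → f ≋ g → up f ≋ up g
  up-cong p zero    = refl
  up-cong p (suc n) = p n

  -- One step of `binom` and of `quot` has the shape `a * f + g`; linearity in this form pushes such
  -- a step through a convolution.
  up-linear : ∀ a f g n → up (λ i → a * f i + g i) n ≈ a * up f n + up g n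
  up-linear a f g zero    = sym (trans (+-congʳ (zeroʳ a)) (+-identityˡ 0#))
  up-linear a f g (suc n) = refl

  ⊛-headˡ : ∀ f g n → (f ⊛ g) n ≈ f 0 * g n + up (shift f ⊛ g) n
  ⊛-headˡ f g zero    = sym (+-identityʳ _)
  ⊛-headˡ f g (suc n) = refl

  ⊛-headʳ : ∀ f g n → (f ⊛ g) n ≈ f n * g 0 + up (f ⊛ shift g) n
  ⊛-headʳ f g zero    = sym (+-identityʳ _)
  ⊛-headʳ f g (suc n) = ⊛-unfoldʳ f g n

  ⊛-linearˡ : ∀ a f g h n → ((λ i → a * f i + g i) ⊛ h) n ≈ a * (f ⊛ h) n + (g ⊛ h) n
  ⊛-linearˡ a f g h n = trans (⊛-distribʳ h _ g n) (+-congʳ (scale-⊛ a f h n))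

  ⊛-linearʳ : ∀ a f g h n → (h ⊛ (λ i → a * f i + g i)) n ≈ a * (h ⊛ f) n + (h ⊛ g) n
  ⊛-linearʳ a f g h n = trans (⊛-comm h _ n) (trans (⊛-linearˡ a f g h n)
    (+-cong (*-congˡ (⊛-comm f h n)) (⊛-comm g h n)))

  _≋[_]_ : Series → ℕ → Series → Set
  f ≋[ n ] g = ∀ i → i < n → f i ≈ g i

  ⊛-local : ∀ n {f f′ g g′} → f ≋[ suc n ] f′ → g ≋[ suc n ] g′ → (f ⊛ g) n ≈ (f′ ⊛ g′) n
  ⊛-local zero    p q = *-cong (p 0 (s≤s z≤n)) (q 0 (s≤s z≤n))
  ⊛-local (suc n) p q = +-cong (*-cong (p 0 (s≤s z≤n)) (q (suc n) ≤-refl))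
    (⊛-local n (λ i i<n → p (suc i) (s≤s i<n)) (λ i i<n → q i (m≤n⇒m≤1+n i<n)))

  -- The extra factor u makes the dependence strict: only coefficients below n enter. This gain
  -- drives the fixed point for m and the induction for `coneSum`.
  up-⊛-local : ∀ n {f f′ g g′} → f ≋[ n ] f′ → g ≋[ n ] g′ → up (f ⊛ g) n ≈ up (f′ ⊛ g′) n
  up-⊛-local zero    p q = refl
  up-⊛-local (suc n) p q = ⊛-local n p q

  commutativeRing : CommutativeRing 0ℓ 0ℓ
  commutativeRing = record
    { Carrier = Series ; _≈_ = _≋_ ; _+_ = _⊞_ ; _*_ = _⊛_ ; -_ = ⊟_
    ; 0# = 𝟘 ; 1# = const 1#
    ; isCommutativeRing = record
      { isRing = record
        { +-isAbelianGroup = record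
          { isGroup = record
            { isMonoid = record
              { isSemigroup = record
                { isMagma = record
                  { isEquivalence = record
                    { refl  = λ _ → refl
                    ; sym   = λ p n → sym (p n)
                    ; trans = λ p q n → trans (p n) (q n) }
                  ; ∙-cong = λ p q n → +-cong (p n) (q n) }
                ; assoc = λ f g h n → +-assoc _ _ _ }
              ; identity = (λ f n → +-identityˡ _) , (λ f n → +-identityʳ _) }
            ; inverse = (λ f n → -‿inverseˡ _) , (λ f n → -‿inverseʳ _)
            ; ⁻¹-cong = λ p n → -‿cong (p n) }
          ; comm = λ f g n → +-comm _ _ }
        ; *-cong = ⊛-cong
        ; *-assoc = ⊛-assoc
        ; *-identity = ⊛-identityˡ
                     , (λ f n → trans (⊛-comm f (const 1#) n) (⊛-identityˡ f n))
        ; distrib = (λ f g h n → trans (⊛-comm f (g ⊞ h) n)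
                       (trans (⊛-distribʳ f g h n)
                         (+-cong (⊛-comm g f n) (⊛-comm h f n))))
                  , ⊛-distribʳ }
      ; *-comm = ⊛-comm } }

  const-+ : ∀ a b → const (a + b) ≋ const a ⊞ const b
  const-+ a b zero    = refl
  const-+ a b (suc n) = sym (+-identityˡ 0#)

  const-* : ∀ a b → const (a * b) ≋ const a ⊛ const b
  const-* a b zero    = refl
  const-* a b (suc n) = sym (trans (const-⊛ a (const b) (suc n)) (zeroʳ a))

  const-neg : ∀ a → const (- a) ≋ ⊟ const a
  const-neg a zero    = refl
  const-neg a (suc n) = sym -0#≈0#

  const-0 : const 0# ≋ 𝟘
  const-0 zero    = refl
  const-0 (suc n) = refl

  const-cong : ∀ {a b} → a ≈ b → const a ≋ const b
  const-cong p zero    = p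
  const-cong p (suc n) = refl

-- The series rings in t and in t, u, and ring normalisation with integer coefficients.

open import Data.Integer using (ℤ)
import Data.Integer.Properties as ℤₚ

ℤ-ring : CommutativeRing 0ℓ 0ℓ
ℤ-ring = ℤₚ.+-*-commutativeRing

module Poly = PowerSeries ℤ-ring
module Bivariate = PowerSeries Poly.commutativeRing

open import Relation.Nullary.Decidable using (dec⇒maybe)
open import Relation.Binary.PropositionalEquality as ≡ using (_≡_)
import Data.Maybe as Maybe
import Algebra.Solver.Ring

-- Normalisation compares coefficients by a decision procedure, which exists for integers but not
-- for series; hence a homomorphism from the integers.
ℤ⟶_ : CommutativeRing 0ℓ 0ℓ → Set
ℤ⟶ R = CommutativeRing.rawRing ℤ-ring -Raw-AlmostCommutative⟶ fromCommutativeRing R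

module ℤ-Solver (R : CommutativeRing 0ℓ 0ℓ) (φ : ℤ⟶ R) where
  open CommutativeRing R
  open _-Raw-AlmostCommutative⟶_ φ

  -- Replacing the images of 0 and 1 makes con (+ 0) and con (+ 1) mean
  -- 0# and 1# on the nose.
  ⟦_⟧⁰¹ : ℤ → Carrier
  ⟦ ℤ.pos 0 ⟧⁰¹ = 0#
  ⟦ ℤ.pos 1 ⟧⁰¹ = 1#
  ⟦ z       ⟧⁰¹ = ⟦ z ⟧

  ⟦⟧⁰¹≈ : ∀ z → ⟦ z ⟧⁰¹ ≈ ⟦ z ⟧
  ⟦⟧⁰¹≈ (ℤ.pos 0)             = sym 0-homo
  ⟦⟧⁰¹≈ (ℤ.pos 1)             = sym 1-homo
  ⟦⟧⁰¹≈ (ℤ.pos (ℕ.suc (ℕ.suc n))) = refl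
  ⟦⟧⁰¹≈ (ℤ.negsuc n)          = refl

  φ⁰¹ : ℤ⟶ R
  φ⁰¹ = record
    { ⟦_⟧ = ⟦_⟧⁰¹
    ; +-homo = λ a b → trans (⟦⟧⁰¹≈ _) (trans (+-homo a b) (sym (+-cong (⟦⟧⁰¹≈ a) (⟦⟧⁰¹≈ b))))
    ; *-homo = λ a b → trans (⟦⟧⁰¹≈ _) (trans (*-homo a b) (sym (*-cong (⟦⟧⁰¹≈ a) (⟦⟧⁰¹≈ b))))
    ; -‿homo = λ a → trans (⟦⟧⁰¹≈ _) (trans (-‿homo a) (sym (-‿cong (⟦⟧⁰¹≈ a))))
    ; 0-homo = refl
    ; 1-homo = refl }

  open Algebra.Solver.Ring _ _ φ⁰¹
    (λ a b → Maybe.map (λ p → reflexive (≡.cong ⟦_⟧⁰¹ p)) (dec⇒maybe (a ℤₚ.≟ b))) public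

  :0 :1 : ∀ {n} → Polynomial n
  :0 = con (ℤ.pos 0)
  :1 = con (ℤ.pos 1)

ℤ⟶Poly : ℤ⟶ Poly.commutativeRing
ℤ⟶Poly = record
  { ⟦_⟧ = Poly.const ; +-homo = Poly.const-+ ; *-homo = Poly.const-*
  ; -‿homo = Poly.const-neg ; 0-homo = Poly.const-0 ; 1-homo = λ _ → ≡.refl }

ℤ⟶Bivariate : ℤ⟶ Bivariate.commutativeRing
ℤ⟶Bivariate = record
  { ⟦_⟧ = λ a → B.const (P.const a)
  ; +-homo = λ a b → R.trans (B.const-cong (P.const-+ a b)) (B.const-+ _ _)
  ; *-homo = λ a b → R.trans (B.const-cong (P.const-* a b)) (B.const-* _ _)
  ; -‿homo = λ a → R.trans (B.const-cong (P.const-neg a)) (B.const-neg _)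
  ; 0-homo = R.trans (B.const-cong P.const-0) B.const-0
  ; 1-homo = R.refl }
  where
  module B = Bivariate
  module P = Poly
  module R = CommutativeRing Bivariate.commutativeRing

-- Motzkin polynomials, their binomial transform and their reversal.

module Motzkin (R : CommutativeRing 0ℓ 0ℓ) (φ : ℤ⟶ R) (t : CommutativeRing.Carrier R) where

  open import Data.Nat using (ℕ; zero; suc; _<_; s≤s)
  open import Data.Nat.Properties using (≤-refl; m≤n⇒m<n∨m≡n; ≤-trans; n≤1+n)
  open import Data.Sum using (inj₁; inj₂)
  open import Data.Integer using (+_)
  import Relation.Binary.PropositionalEquality as ≡
  open CommutativeRing R
  open PowerSeries R
  open ℤ-Solver R φ
  open import Relation.Binary.Reasoning.Setoid setoid

  -- m = 1 + u m + t u² m², solved as the fixed point of a contraction: the n-th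
  -- coefficient is stable after n + 1 iterations.
  motzkinStep : Series → Series
  motzkinStep f zero    = 1#
  motzkinStep f (suc n) = f n + t * up (f ⊛ f) n

  approx : ℕ → Series
  approx zero    = 𝟘
  approx (suc k) = motzkinStep (approx k)

  motzkin : Series
  motzkin n = approx (suc n) n

  motzkinStep-contracts : ∀ n {f g} → f ≋[ n ] g → motzkinStep f ≋[ suc n ] motzkinStep g
  motzkinStep-contracts n p zero    _ = refl
  motzkinStep-contracts (suc n) p (suc i) (s≤s i<n) =
    +-cong (p i i<n) (*-congˡ (up-⊛-local i below below))
    where
    below = λ j j<i → p j (≤-trans j<i (≤-trans (n≤1+n i) i<n))

  approx-stable : ∀ k → approx k ≋[ k ] approx (suc k)
  approx-stable zero    _ ()
  approx-stable (suc k) = motzkinStep-contracts k (approx-stable k)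

  approx-motzkin : ∀ k → approx k ≋[ k ] motzkin
  approx-motzkin (suc k) i (s≤s i≤k) with m≤n⇒m<n∨m≡n i≤k
  ... | inj₂ ≡.refl = refl
  ... | inj₁ i<k = trans (sym (approx-stable k i i<k)) (approx-motzkin k i i<k)

  motzkin-suc : ∀ n → motzkin (suc n) ≈ motzkin n + t * up (motzkin ⊛ motzkin) n
  motzkin-suc n = motzkinStep-contracts (suc n) (approx-motzkin (suc n)) (suc n) ≤-refl

  t-1 : Carrier
  t-1 = t - 1#

  -- Row j is the binomial transform, with parameter t - 1, of m shifted by j.
  binom : ℕ → Series
  binom j zero    = motzkin j
  binom j (suc n) = t-1 * binom j n + binom (suc j) n

  -- In m_(j+k+1) = m_(j+k) + t Σ m_a m_b, where a + b = j + k - 1, the products with a < j make up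
  -- the first convolution and the others the second. In the induction, raising j releases
  -- `motzkin j * binom 0 n` from the first convolution, and this is the missing head of the second.
  binom-suc : ∀ n j → binom (suc j) n ≈
    binom j n + t * up (motzkin ⊛ (λ i → binom i n)) j + t * up (binom 0 ⊛ binom j) n
  binom-suc zero    j = trans (motzkin-suc j) (solve 2 (λ x t → x := x :+ t :* :0) refl _ _)
  binom-suc (suc n) j = begin
    t-1 * binom (suc j) n + binom (suc (suc j)) n
      ≈⟨ +-cong (*-congˡ (binom-suc n j)) (binom-suc n (suc j)) ⟩
    t-1 * (binom j n + t * X + t * W) + (binom (suc j) n + t * (motzkin ⊛ col) j + t * W₁)
      ≈⟨ +-congˡ (+-congʳ (+-congˡ (*-congˡ (⊛-headʳ motzkin col j)))) ⟩
    t-1 * (binom j n + t * X + t * W) + (binom (suc j) n + t * (motzkin j * binom 0 n + Y) + t * W₁)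
      ≈⟨ solve 10 (λ t c b b₁ X Y W W₁ m b₀ →
           c :* (b :+ t :* X :+ t :* W) :+ (b₁ :+ t :* (m :* b₀ :+ Y) :+ t :* W₁) :=
           c :* b :+ b₁ :+ t :* (c :* X :+ Y) :+ t :* (b₀ :* m :+ (c :* W :+ W₁)))
           refl t t-1 _ _ X Y W W₁ _ _ ⟩
    binom j (suc n) + t * (t-1 * X + Y) + t * (binom 0 n * motzkin j + (t-1 * W + W₁))
      ≈⟨ +-cong (+-congˡ (*-congˡ (up-linear t-1 _ _ j))) (*-congˡ (+-congˡ (up-linear t-1 _ _ n))) ⟨
    _ ≈⟨ +-cong (+-congˡ (*-congˡ (up-cong (⊛-linearʳ t-1 col (shift col) motzkin) j)))
                (*-congˡ (+-congˡ (up-cong (⊛-linearʳ t-1 (binom j) (binom (suc j)) (binom 0)) n))) ⟨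
    _ ≈⟨ +-congˡ (*-congˡ (⊛-headʳ (binom 0) (binom j) n)) ⟨
    binom j (suc n) + t * up (motzkin ⊛ (λ i → binom i (suc n))) j + t * (binom 0 ⊛ binom j) n ∎
    where
    col = λ i → binom i n
    X = up (motzkin ⊛ col) j
    Y = up (motzkin ⊛ shift col) j
    W = up (binom 0 ⊛ binom j) n
    W₁ = up (binom 0 ⊛ binom (suc j)) n

  -- tⁿ mₙ(1/t), by motzkin-reverse below: the binomial transform of m satisfies the
  -- quadratic equation of the reversed polynomials.
  reversed : Series
  reversed = binom 0

  -- For j = 0 the first convolution in `binom-suc` is empty. The result N = 1 + t u N + t u² N² is
  -- the equation of m with u replaced by t u and t by 1/t.
  reversed-suc : ∀ n → reversed (suc n) ≈ t * reversed n + t * up (reversed ⊛ reversed) n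
  reversed-suc n = trans (+-congˡ (binom-suc n 0))
    (solve 3 (λ t r W → (t :- :1) :* r :+ (r :+ t :* :0 :+ t :* W) := t :* r :+ t :* W)
      refl t _ _)

  -- The value at 0 allows every spoke to close a run, even an empty one.
  fanPoly : ℕ → Carrier
  fanPoly zero    = 1#
  fanPoly (suc k) = motzkin k

  -- Contributions of a run of k intervals to the sum over the flats above a given
  -- one: coneSum if the flat connects the first interval to 0, pathSum j if it does
  -- not and the current run of the larger flat already has j intervals.
  mutual
    coneSum : ℕ → Carrier
    coneSum zero          = 1#
    coneSum (suc zero)    = t-1
    coneSum (suc (suc k)) = (t-1 - 1#) * coneSum (suc k) + t-1 * pathSum 0 (suc k)

    pathSum : ℕ → ℕ → Carrier
    pathSum j zero    = 0#
    pathSum j (suc k) = t-1 * pathSum j k + pathSum (suc j) k + fanPoly (suc j) * coneSum k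

  -- `pathSum` obeys a linear recursion with the source `motzkin j * coneSum k`. The homogeneous
  -- part is the recursion of `binom`, so each source is propagated by `binom`; the source at k = 0
  -- gives the first summand, as `coneSum 0` is 1.
  pathSum-suc : ∀ n j → pathSum j (suc n) ≈ binom j n + up (binom j ⊛ shift coneSum) n
  pathSum-suc zero    j = solve 2 (λ c m → c :* :0 :+ :0 :+ m :* :1 := m :+ :0) refl _ _
  pathSum-suc (suc n) j = begin
    t-1 * pathSum j (suc n) + pathSum (suc j) (suc n) + motzkin j * coneSum (suc n)
      ≈⟨ +-congʳ (+-cong (*-congˡ (pathSum-suc n j)) (pathSum-suc n (suc j))) ⟩
    t-1 * (binom j n + W) + (binom (suc j) n + W₁) + motzkin j * coneSum (suc n)
      ≈⟨ solve 6 (λ c b b₁ W W₁ mb → c :* (b :+ W) :+ (b₁ :+ W₁) :+ mb :=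
            c :* b :+ b₁ :+ (mb :+ (c :* W :+ W₁))) refl _ _ _ _ _ _ ⟩
    binom j (suc n) + (motzkin j * coneSum (suc n) + (t-1 * W + W₁))
      ≈⟨ +-congˡ (+-congˡ (trans (up-cong (⊛-linearˡ t-1 (binom j) (binom (suc j)) β) n) (up-linear t-1 _ _ n))) ⟨
    binom j (suc n) + (motzkin j * coneSum (suc n) + up (shift (binom j) ⊛ β) n)
      ≈⟨ +-congˡ (⊛-headˡ (binom j) β n) ⟨
    binom j (suc n) + (binom j ⊛ β) n ∎
    where
    β = shift coneSum
    W = up (binom j ⊛ β) n
    W₁ = up (binom (suc j) ⊛ β) n

  -- N / (1 + uN), where N is the generating function of reversed.
  quot : Series
  quot zero    = 1#
  quot (suc n) = t * reversed n + - quot n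

  -- Dividing N = 1 + t u N (1 + u N) by 1 + u N gives Q = 1 - u Q + t u N for Q = N / (1 + u N),
  -- which is the recursion of `quot`.
  quot-eq : ∀ n → quot n + up (reversed ⊛ quot) n ≈ reversed n
  quot-eq zero    = +-identityʳ _
  quot-eq (suc n) = begin
    t * reversed n + - quot n + (reversed ⊛ quot) n
      ≈⟨ +-congˡ (⊛-headʳ reversed quot n) ⟩
    t * reversed n + - quot n + (reversed n * 1# + up (reversed ⊛ shift quot) n)
      ≈⟨ +-congˡ (+-congˡ (trans (up-cong (⊛-linearʳ t reversed (⊟ quot) reversed) n) (up-linear t _ _ n))) ⟩
    t * reversed n + - quot n + (reversed n * 1# + (t * up (reversed ⊛ reversed) n + up (reversed ⊛ (⊟ quot)) n))
      ≈⟨ +-congˡ (+-congˡ (+-congˡ neg)) ⟩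
    t * reversed n + - quot n + (reversed n * 1# + (t * up (reversed ⊛ reversed) n + - up (reversed ⊛ quot) n))
      ≈⟨ solve 5 (λ t r q W V → t :* r :+ :- q :+ (r :* :1 :+ (t :* W :+ :- V)) :=
            t :* r :+ t :* W :+ (r :- (q :+ V))) refl _ _ _ _ _ ⟩
    t * reversed n + t * up (reversed ⊛ reversed) n + (reversed n - (quot n + up (reversed ⊛ quot) n))
      ≈⟨ +-congˡ (+-congˡ (-‿cong (quot-eq n))) ⟩
    t * reversed n + t * up (reversed ⊛ reversed) n + (reversed n - reversed n)
      ≈⟨ +-cong (sym (reversed-suc n)) (-‿inverseʳ _) ⟩
    reversed (suc n) + 0#
      ≈⟨ +-identityʳ _ ⟩
    reversed (suc n) ∎
    where
    open import Algebra.Properties.Ring (CommutativeRing.ring commutativeRing) using (-‿distribʳ-*)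
    open import Algebra.Properties.Ring ring using (-0#≈0#)
    up-neg : ∀ f n → up (⊟ f) n ≈ - up f n
    up-neg f zero    = sym -0#≈0#
    up-neg f (suc n) = refl
    neg : up (reversed ⊛ (⊟ quot)) n ≈ - up (reversed ⊛ quot) n
    neg = trans (up-cong (λ i → sym (-‿distribʳ-* reversed quot i)) n) (up-neg _ n)

  mutual
    -- `coneSum` at i + 2 calls for `pathSum 0` at i + 1, and the latter, by `pathSum-suc`, for
    -- `coneSum` up to i only; so the two closed forms are proved together. The bound n is the
    -- measure of the recursion.
    coneSum-suc : ∀ n → shift coneSum ≋[ suc n ] (λ i → t-1 * quot i)
    coneSum-suc n zero _ = sym (*-identityʳ _)
    coneSum-suc (suc n) (suc i) (s≤s i<n) = begin
      (t-1 - 1#) * coneSum (suc i) + t-1 * pathSum 0 (suc i)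
        ≈⟨ +-cong (*-congˡ (coneSum-suc n i i<n)) (*-congˡ (pathSum₀ n i i<n)) ⟩
      (t-1 - 1#) * (t-1 * quot i) + t-1 * (t * reversed i - t-1 * quot i)
        ≈⟨ solve 3 (λ t q r → let c = t :- :1 in
             (c :- :1) :* (c :* q) :+ c :* (t :* r :- c :* q) := c :* (t :* r :+ :- q)) refl t _ _ ⟩
      t-1 * quot (suc i) ∎

    pathSum₀ : ∀ n i → i < suc n → pathSum 0 (suc i) ≈ t * reversed i - t-1 * quot i
    pathSum₀ n i i<n = begin
      pathSum 0 (suc i)
        ≈⟨ pathSum-suc i 0 ⟩
      reversed i + up (reversed ⊛ shift coneSum) i
        ≈⟨ +-congˡ (up-⊛-local i (λ _ _ → refl) (below n i i<n)) ⟩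
      reversed i + up (reversed ⊛ (λ k → t-1 * quot k)) i
        ≈⟨ +-congˡ (up-cong (λ k → trans (⊛-comm reversed _ k) (trans (scale-⊛ t-1 quot reversed k) (*-congˡ (⊛-comm quot reversed k)))) i) ⟩
      reversed i + up (λ k → t-1 * (reversed ⊛ quot) k) i
        ≈⟨ +-congˡ (up-scale i) ⟩
      reversed i + t-1 * up (reversed ⊛ quot) i
        -- The convolution V is written as (q + V) - q so that `quot-eq` evaluates the bracket.
        ≈⟨ solve 4 (λ t r q V → r :+ (t :- :1) :* V := r :+ (t :- :1) :* ((q :+ V) :- q)) refl t _ (quot i) _ ⟩
      reversed i + t-1 * ((quot i + up (reversed ⊛ quot) i) - quot i)
        ≈⟨ +-congˡ (*-congˡ (+-congʳ (quot-eq i))) ⟩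
      reversed i + t-1 * (reversed i - quot i)
        ≈⟨ solve 3 (λ t r q → let c = t :- :1 in r :+ c :* (r :- q) := t :* r :- c :* q) refl t _ _ ⟩
      t * reversed i - t-1 * quot i ∎
      where
      up-scale : ∀ i → up (λ k → t-1 * (reversed ⊛ quot) k) i ≈ t-1 * up (reversed ⊛ quot) i
      up-scale zero    = sym (zeroʳ _)
      up-scale (suc i) = refl
      below : ∀ n i → i < suc n → shift coneSum ≋[ i ] (λ k → t-1 * quot k)
      below (suc n) i i<n k k<i = coneSum-suc n k (≤-trans k<i (s≤s⁻¹ i<n))
        where open import Data.Nat using (s≤s⁻¹)
      below zero zero _ k ()
      below zero (suc i) (s≤s ())

  -- The polynomial t^k p(1/t) for p = `fanPoly k`. The additional t is due to the rank of a run of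
  -- k + 1 intervals, which is k + 1, while `reversed k` reverses in degree k.
  fanPolyRev : ℕ → Carrier
  fanPolyRev zero    = 1#
  fanPolyRev (suc k) = t * reversed k

  -- The term (t - 1) Q cancels between the two closed forms. A larger flat leaves the first
  -- interval loose or joins it to 0, and both cases together give the reversed polynomial of the
  -- run.
  pathSum+coneSum : ∀ k → pathSum 0 k + coneSum k ≈ fanPolyRev k
  pathSum+coneSum zero    = +-identityˡ 1#
  pathSum+coneSum (suc k) = trans
    (+-cong (pathSum₀ k k ≤-refl) (coneSum-suc k k ≤-refl))
    (solve 2 (λ x y → x :- y :+ y := x) refl _ _)

-- Corank and closedness in the fan, letter by letter.

-- A set of edges of the fan F_{m+1} is a word (s , p): s marks the spokes
-- {0,i}, p the path edges {i,i+1}.  The path edges cut the vertices 1,…,m+1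
-- into intervals.
module FanWords where

  open import Data.Nat using (ℕ; zero; suc; _≤_; _<_; z≤n; s≤s; _+_; _≤ᵇ_)
  open import Data.Nat.Properties
  open import Data.Nat.Solver using (module +-*-Solver)
  open import Data.Bool using (Bool; true; false; not; _∧_; _∨_; T)
  open import Data.Bool.Properties using (∨-identityʳ; ∨-zeroʳ; T-∧)
  open import Data.Fin using (Fin; zero; suc)
  open import Data.Fin.Subset using (Subset; _∪_; _∩_; ⁅_⁆; ∣_∣; ⊤; ⊥)
  open import Data.Fin.Subset.Properties using (∪-identityʳ)
  open import Data.Vec using (Vec; []; _∷_; lookup)
  open import Data.Product using (∃; _×_; _,_; proj₁; proj₂)
  open import Data.Sum using (_⊎_; inj₁; inj₂)
  open import Data.Unit using (tt)
  open import Function using (Equivalence)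
  open import Relation.Binary.PropositionalEquality

  forallᵇ : ∀ n → (Vec Bool n → Bool) → Bool
  forallᵇ zero    f = f []
  forallᵇ (suc n) f = forallᵇ n (λ v → f (true ∷ v)) ∧ forallᵇ n (λ v → f (false ∷ v))

  -- Proof by truth table: for a concrete `f` the hypothesis evaluates and `tt` proves it. The
  -- Boolean inequalities between single letters are settled in this way.
  check : ∀ n f → T (forallᵇ n f) → ∀ v → T (f v)
  check zero    f h []          = h
  check (suc n) f h (true ∷ v)  = check n (λ v → f (true ∷ v)) (proj₁ (Equivalence.to T-∧ h)) v
  check (suc n) f h (false ∷ v) = check n (λ v → f (false ∷ v)) (proj₂ (Equivalence.to (T-∧ {forallᵇ n (λ v → f (true ∷ v))}) h)) v

  infixr 4 _⇒_
  _⇒_ : Bool → Bool → Bool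
  true  ⇒ b = b
  false ⇒ _ = true

  ⇒-elim : ∀ {a b} → T (a ⇒ b) → T a → T b
  ⇒-elim {true} h _ = h

  β : Bool → ℕ
  β true  = 1
  β false = 0

  β≤1 : ∀ b → β b ≤ 1
  β≤1 true  = s≤s z≤n
  β≤1 false = z≤n

  ∧-trueʳ : ∀ a {b} → a ∧ b ≡ true → b ≡ true
  ∧-trueʳ true h = h

  -- The number of intervals without a spoke, the first one being discounted
  -- if c holds, i.e. if it is already connected to 0 from the left.
  cork : ∀ {m} → Bool → Subset (suc m) → Subset m → ℕ
  cork c (x ∷ s)  (q ∷ p) = β (not q ∧ not (c ∨ x)) + cork (q ∧ (c ∨ x)) s p
  cork c (x ∷ []) []      = β (not (c ∨ x))

  cork-≤ : ∀ {m} c (s : Subset (suc m)) p → cork c s p ≤ suc m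
  cork-≤ c (x ∷ []) []      = β≤1 (not (c ∨ x))
  cork-≤ c (x ∷ s) (q ∷ p) = +-mono-≤ (β≤1 (not q ∧ not (c ∨ x))) (cork-≤ _ s p)

  cork-⊤ : ∀ m c → cork {m} c ⊤ ⊤ ≡ 0
  cork-⊤ zero    true  = refl
  cork-⊤ zero    false = refl
  cork-⊤ (suc m) true  = cork-⊤ m true
  cork-⊤ (suc m) false = cork-⊤ m true

  -- The larger set is given as a union, which keeps the induction letterwise. The states satisfy c
  -- ⇒ d because the larger set may be joined to 0 where the smaller one is not.
  cork-antitone : ∀ {m} c d (s s′ : Subset (suc m)) p p′ → T (c ⇒ d) → cork d (s ∪ s′) (p ∪ p′) ≤ cork c s p
  cork-antitone c d (x ∷ []) (x′ ∷ []) [] [] h = ≤ᵇ⇒≤ _ _ (⇒-elim (check 4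
    (λ { (c ∷ d ∷ x ∷ x′ ∷ []) → (c ⇒ d) ⇒ (β (not (d ∨ (x ∨ x′))) ≤ᵇ β (not (c ∨ x))) }) tt (c ∷ d ∷ x ∷ x′ ∷ [])) h)
  cork-antitone c d (x ∷ s) (x′ ∷ s′) (q ∷ p) (q′ ∷ p′) h = +-mono-≤
    (≤ᵇ⇒≤ _ _ (⇒-elim (check 6
      (λ { (c ∷ d ∷ x ∷ x′ ∷ q ∷ q′ ∷ []) → (c ⇒ d) ⇒
          (β (not (q ∨ q′) ∧ not (d ∨ (x ∨ x′))) ≤ᵇ β (not q ∧ not (c ∨ x))) }) tt (c ∷ d ∷ x ∷ x′ ∷ q ∷ q′ ∷ [])) h))
    (cork-antitone _ _ s s′ p p′ (⇒-elim (check 6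
      (λ { (c ∷ d ∷ x ∷ x′ ∷ q ∷ q′ ∷ []) → (c ⇒ d) ⇒
          (q ∧ (c ∨ x) ⇒ (q ∨ q′) ∧ (d ∨ (x ∨ x′))) }) tt (c ∷ d ∷ x ∷ x′ ∷ q ∷ q′ ∷ [])) h))

  count-∷ : ∀ {n} x (s : Subset n) → ∣ x ∷ s ∣ ≡ β x + ∣ s ∣
  count-∷ true  s = refl
  count-∷ false s = refl

  -- Each vertex uses up a spokeless interval or an edge. A first interval joined from the left is
  -- paid for by an edge outside the word, hence the summand `β c`.
  cork+size : ∀ {m} c (s : Subset (suc m)) p → suc m ≤ β c + cork c s p + (∣ s ∣ + ∣ p ∣)
  cork+size c (x ∷ []) [] rewrite count-∷ x [] = ≤ᵇ⇒≤ _ _ (check 2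
    (λ { (c ∷ x ∷ []) → 1 ≤ᵇ β c + β (not (c ∨ x)) + (β x + 0 + 0) }) tt (c ∷ x ∷ []))
  cork+size {suc m} c (x ∷ s) (q ∷ p) rewrite count-∷ x s | count-∷ q p = begin
    suc (suc m)
      ≤⟨ +-monoʳ-≤ 1 (cork+size (q ∧ (c ∨ x)) s p) ⟩
    1 + (β (q ∧ (c ∨ x)) + K + (∣ s ∣ + ∣ p ∣))
      ≡⟨ solve 4 (λ a k s p → con 1 :+ (a :+ k :+ (s :+ p)) := (con 1 :+ a) :+ (k :+ (s :+ p))) refl (β (q ∧ (c ∨ x))) K (∣ s ∣) (∣ p ∣) ⟩
    (1 + β (q ∧ (c ∨ x))) + (K + (∣ s ∣ + ∣ p ∣))
      ≤⟨ +-monoˡ-≤ (K + (∣ s ∣ + ∣ p ∣)) (≤ᵇ⇒≤ (1 + β (q ∧ (c ∨ x))) (β c + β (not q ∧ not (c ∨ x)) + (β x + β q)) (check 3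
          (λ { (c ∷ x ∷ q ∷ []) → 1 + β (q ∧ (c ∨ x)) ≤ᵇ β c + β (not q ∧ not (c ∨ x)) + (β x + β q) }) tt (c ∷ x ∷ q ∷ []))) ⟩
    (β c + β (not q ∧ not (c ∨ x)) + (β x + β q)) + (K + (∣ s ∣ + ∣ p ∣))
      ≡⟨ solve 7 (λ c e x q k s p → (c :+ e :+ (x :+ q)) :+ (k :+ (s :+ p)) := c :+ (e :+ k) :+ ((x :+ s) :+ (q :+ p)))
           refl (β c) (β (not q ∧ not (c ∨ x))) (β x) (β q) K (∣ s ∣) (∣ p ∣) ⟩
    β c + (β (not q ∧ not (c ∨ x)) + K) + ((β x + ∣ s ∣) + (β q + ∣ p ∣)) ∎
    where
    open ≤-Reasoning
    open +-*-Solver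
    K = cork (q ∧ (c ∨ x)) s p

  -- The states c, d, a, b belong to two sets, their union and their intersection;
  -- the last summand pays for a union that is joined to 0 when neither set is.
  cork-supermodular : ∀ {m} c d a b (s s′ : Subset (suc m)) p p′ → T (((b ⇒ c) ∧ (b ⇒ d)) ∧ ((c ⇒ a) ∧ (d ⇒ a))) →
    cork c s p + cork d s′ p′ ≤ cork a (s ∪ s′) (p ∪ p′) + cork b (s ∩ s′) (p ∩ p′) + β (a ∧ not c ∧ not d)
  cork-supermodular c d a b (x ∷ []) (y ∷ []) [] [] h = ≤ᵇ⇒≤ _ _ (⇒-elim (check 6
    (λ { (c ∷ d ∷ a ∷ b ∷ x ∷ y ∷ []) → (((b ⇒ c) ∧ (b ⇒ d)) ∧ ((c ⇒ a) ∧ (d ⇒ a))) ⇒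
       (β (not (c ∨ x)) + β (not (d ∨ y)) ≤ᵇ β (not (a ∨ (x ∨ y))) + β (not (b ∨ (x ∧ y))) + β (a ∧ not c ∧ not d)) })
    tt (c ∷ d ∷ a ∷ b ∷ x ∷ y ∷ [])) h)
  cork-supermodular c d a b (x ∷ s) (y ∷ s′) (q ∷ p) (r ∷ p′) h = begin
    (e c x q + cork c′ s p) + (e d y r + cork d′ s′ p′)
      ≡⟨ solve 4 (λ x y z w → (x :+ y) :+ (z :+ w) := (y :+ w) :+ (x :+ z)) refl (e c x q) (cork c′ s p) (e d y r) (cork d′ s′ p′) ⟩
    (cork c′ s p + cork d′ s′ p′) + (e c x q + e d y r)
      ≤⟨ +-monoˡ-≤ _ (cork-supermodular c′ d′ a′ b′ s s′ p p′ states) ⟩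
    (A + B + β (a′ ∧ not c′ ∧ not d′)) + (e c x q + e d y r)
      ≡⟨ solve 5 (λ a b z x y → (a :+ b :+ z) :+ (x :+ y) := (a :+ b) :+ (x :+ y :+ z)) refl A B (β (a′ ∧ not c′ ∧ not d′)) (e c x q) (e d y r) ⟩
    (A + B) + (e c x q + e d y r + β (a′ ∧ not c′ ∧ not d′))
      ≤⟨ +-monoʳ-≤ (A + B) local ⟩
    (A + B) + (e a (x ∨ y) (q ∨ r) + e b (x ∧ y) (q ∧ r) + β (a ∧ not c ∧ not d))
      ≡⟨ solve 5 (λ a b x y z → (a :+ b) :+ (x :+ y :+ z) := (x :+ a) :+ (y :+ b) :+ z) refl A B (e a (x ∨ y) (q ∨ r)) (e b (x ∧ y) (q ∧ r)) (β (a ∧ not c ∧ not d)) ⟩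
    (e a (x ∨ y) (q ∨ r) + A) + (e b (x ∧ y) (q ∧ r) + B) + β (a ∧ not c ∧ not d) ∎
    where
    open ≤-Reasoning
    open +-*-Solver
    e : Bool → Bool → Bool → ℕ
    e c x q = β (not q ∧ not (c ∨ x))
    c′ = q ∧ (c ∨ x)
    d′ = r ∧ (d ∨ y)
    a′ = (q ∨ r) ∧ (a ∨ (x ∨ y))
    b′ = (q ∧ r) ∧ (b ∨ (x ∧ y))
    A = cork a′ (s ∪ s′) (p ∪ p′)
    B = cork b′ (s ∩ s′) (p ∩ p′)
    states : T (((b′ ⇒ c′) ∧ (b′ ⇒ d′)) ∧ ((c′ ⇒ a′) ∧ (d′ ⇒ a′)))
    states = ⇒-elim (check 8 (λ { (c ∷ d ∷ a ∷ b ∷ x ∷ y ∷ q ∷ r ∷ []) →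
      (((b ⇒ c) ∧ (b ⇒ d)) ∧ ((c ⇒ a) ∧ (d ⇒ a))) ⇒
      ((((q ∧ r) ∧ (b ∨ (x ∧ y)) ⇒ q ∧ (c ∨ x)) ∧ ((q ∧ r) ∧ (b ∨ (x ∧ y)) ⇒ r ∧ (d ∨ y)))
       ∧ ((q ∧ (c ∨ x) ⇒ (q ∨ r) ∧ (a ∨ (x ∨ y))) ∧ (r ∧ (d ∨ y) ⇒ (q ∨ r) ∧ (a ∨ (x ∨ y))))) }) tt
      (c ∷ d ∷ a ∷ b ∷ x ∷ y ∷ q ∷ r ∷ [])) h
    local : e c x q + e d y r + β (a′ ∧ not c′ ∧ not d′) ≤ e a (x ∨ y) (q ∨ r) + e b (x ∧ y) (q ∧ r) + β (a ∧ not c ∧ not d)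
    local = ≤ᵇ⇒≤ _ _ (⇒-elim (check 8 (λ { (c ∷ d ∷ a ∷ b ∷ x ∷ y ∷ q ∷ r ∷ []) →
      (((b ⇒ c) ∧ (b ⇒ d)) ∧ ((c ⇒ a) ∧ (d ⇒ a))) ⇒
      (β (not q ∧ not (c ∨ x)) + β (not r ∧ not (d ∨ y)) + β (((q ∨ r) ∧ (a ∨ (x ∨ y))) ∧ not (q ∧ (c ∨ x)) ∧ not (r ∧ (d ∨ y)))
       ≤ᵇ β (not (q ∨ r) ∧ not (a ∨ (x ∨ y))) + β (not (q ∧ r) ∧ not (b ∨ (x ∧ y))) + β (a ∧ not c ∧ not d)) }) tt
      (c ∷ d ∷ a ∷ b ∷ x ∷ y ∷ q ∷ r ∷ [])) h)

  -- The edges of the triangle on 0, i, i + 1 are x, q, y; a flat never contains exactly two of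
  -- them. Every longer cycle of a fan has a chord, so the triangles suffice.
  compatible : Bool → Bool → Bool → Bool
  compatible true  q y = (q ∧ y) ∨ (not q ∧ not y)
  compatible false q y = not q ∨ not y

  flatᵇ : ∀ {m} → Subset (suc m) → Subset m → Bool
  flatᵇ (x ∷ [])    []      = true
  flatᵇ (x ∷ y ∷ s) (q ∷ p) = compatible x q y ∧ flatᵇ (y ∷ s) p

  head : ∀ {m} → Subset (suc m) → Bool
  head (x ∷ _) = x

  cork-joined : ∀ {m} (s : Subset (suc m)) p → head s ≡ true → cork true s p ≡ cork false s p
  cork-joined (true ∷ []) []      _ = refl
  cork-joined (true ∷ s)  (q ∷ p) _ = refl

  cork-absorb : ∀ {m} (s : Subset m) p → cork true (true ∷ s) p ≡ cork true (false ∷ s) p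
  cork-absorb []      []      = refl
  cork-absorb (_ ∷ _) (_ ∷ _) = refl

  -- If the first vertex of a flat has no spoke, the triangles keep spokes away from its whole
  -- interval, so joining it to 0 removes exactly one spokeless interval.
  cork-loose : ∀ {m} (s : Subset (suc m)) p → flatᵇ s p ≡ true → head s ≡ false → cork false s p ≡ suc (cork true s p)
  cork-loose (false ∷ [])        []          _ _ = refl
  cork-loose (false ∷ y ∷ s)     (false ∷ p) _ _ = refl
  cork-loose (false ∷ false ∷ s) (true ∷ p)  h _ = cork-loose (false ∷ s) p h refl

  -- The condition on c is the triangle condition across the left border of the word. With it, a
  -- missing spoke always belongs to an interval that is not joined to 0.
  closed-spoke : ∀ {m} c (s : Subset (suc m)) p → flatᵇ s p ≡ true → (c ≡ true → head s ≡ true) →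
    ∀ i → lookup s i ≡ false → cork c (s ∪ ⁅ i ⁆) p < cork c s p
  closed-spoke true (false ∷ _) p h hc with hc refl
  ... | ()
  closed-spoke false (false ∷ []) [] h hc zero _ = s≤s z≤n
  closed-spoke false (false ∷ y ∷ s) (false ∷ p) h hc zero _ rewrite ∨-identityʳ y | ∪-identityʳ s = ≤-refl
  closed-spoke false (false ∷ false ∷ s) (true ∷ p) h hc zero _ rewrite ∪-identityʳ s =
    ≤-reflexive (sym (cork-loose (false ∷ s) p h refl))
  closed-spoke c (true ∷ true ∷ s) (true ∷ p) h hc (suc i) eq rewrite ∨-zeroʳ c = closed-spoke true (true ∷ s) p h (λ _ → refl) i eq
  closed-spoke c (true ∷ y ∷ s) (false ∷ p) h hc (suc i) eq rewrite ∨-zeroʳ c = closed-spoke false (y ∷ s) p (∧-trueʳ _ h) (λ ()) i eq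
  closed-spoke false (false ∷ false ∷ s) (true ∷ p) h hc (suc i) eq = closed-spoke false (false ∷ s) p h (λ ()) i eq
  closed-spoke false (false ∷ y ∷ s) (false ∷ p) h hc (suc i) eq = s≤s (closed-spoke false (y ∷ s) p h (λ ()) i eq)

  -- A missing path edge of a flat separates two intervals that are not both joined to 0, so merging
  -- them loses one spokeless interval.
  closed-path : ∀ {m} c (s : Subset (suc m)) p → flatᵇ s p ≡ true → (c ≡ true → head s ≡ true) →
    ∀ i → lookup p i ≡ false → cork c s (p ∪ ⁅ i ⁆) < cork c s p
  closed-path true (false ∷ _) p h hc with hc refl
  ... | ()
  closed-path c (true ∷ false ∷ s) (false ∷ p) h hc zero _ rewrite ∪-identityʳ p with c
  ... | true  = ≤-reflexive (sym (cork-loose (false ∷ s) p h refl))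
  ... | false = ≤-reflexive (sym (cork-loose (false ∷ s) p h refl))
  closed-path false (false ∷ y ∷ s) (false ∷ p) h hc zero _ rewrite ∪-identityʳ p = ≤-refl
  closed-path c (true ∷ true ∷ s) (true ∷ p) h hc (suc i) eq with c
  ... | true  = closed-path true (true ∷ s) p h (λ _ → refl) i eq
  ... | false = closed-path true (true ∷ s) p h (λ _ → refl) i eq
  closed-path c (true ∷ false ∷ s) (false ∷ p) h hc (suc i) eq with c
  ... | true  = closed-path false (false ∷ s) p h (λ ()) i eq
  ... | false = closed-path false (false ∷ s) p h (λ ()) i eq
  closed-path false (false ∷ false ∷ s) (true ∷ p) h hc (suc i) eq = closed-path false (false ∷ s) p h (λ ()) i eq
  closed-path false (false ∷ y ∷ s) (false ∷ p) h hc (suc i) eq = s≤s (closed-path false (y ∷ s) p h (λ ()) i eq)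

  Redundant : ∀ {m} → Bool → Subset (suc m) → Subset m → Set
  Redundant c s p =
      (∃ λ i → lookup s i ≡ false × cork c (s ∪ ⁅ i ⁆) p ≡ cork c s p)
    ⊎ (∃ λ i → lookup p i ≡ false × cork c s (p ∪ ⁅ i ⁆) ≡ cork c s p)

  -- The witness is the third edge of the first triangle that contains exactly two: it closes a
  -- cycle and leaves the corank unchanged.
  not-closed : ∀ {m} c (s : Subset (suc m)) p → flatᵇ s p ≡ false → Redundant c s p
  not-closed c (x ∷ []) [] ()
  not-closed c (x ∷ y ∷ s) (q ∷ p) h with compatible x q y in eq
  ... | true with not-closed (q ∧ (c ∨ x)) (y ∷ s) p h
  ...   | inj₁ (i , i∉ , e) = inj₁ (suc i , i∉ , subst (λ x′ → cork c (x′ ∷ ((y ∷ s) ∪ ⁅ i ⁆)) (q ∷ p) ≡ cork c (x ∷ y ∷ s) (q ∷ p))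
                                (sym (∨-identityʳ x)) (cong (β (not q ∧ not (c ∨ x)) +_) e))
  ...   | inj₂ (i , i∉ , e) = inj₂ (suc i , i∉ , subst (λ q′ → cork c (x ∷ y ∷ s) (q′ ∷ (p ∪ ⁅ i ⁆)) ≡ cork c (x ∷ y ∷ s) (q ∷ p))
                                (sym (∨-identityʳ q)) (cong (β (not q ∧ not (c ∨ x)) +_) e))
  not-closed c (true ∷ false ∷ s) (true ∷ p) h | false = inj₁ (suc zero , refl , lemma c)
    where
    lemma : ∀ c → cork c (true ∷ true ∷ (s ∪ ⊥)) (true ∷ p) ≡ cork c (true ∷ false ∷ s) (true ∷ p)
    lemma true  rewrite ∪-identityʳ s = cork-absorb s p
    lemma false rewrite ∪-identityʳ s = cork-absorb s p
  not-closed c (true ∷ true ∷ s) (false ∷ p) h | false = inj₂ (zero , refl , lemma c)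
    where
    lemma : ∀ c → cork c (true ∷ true ∷ s) (true ∷ (p ∪ ⊥)) ≡ cork c (true ∷ true ∷ s) (false ∷ p)
    lemma true  rewrite ∪-identityʳ p = cork-joined (true ∷ s) p refl
    lemma false rewrite ∪-identityʳ p = cork-joined (true ∷ s) p refl
  not-closed c (false ∷ true ∷ s) (true ∷ p) h | false = inj₁ (zero , refl , lemma c)
    where
    lemma : ∀ c → cork c (true ∷ true ∷ (s ∪ ⊥)) (true ∷ p) ≡ cork c (false ∷ true ∷ s) (true ∷ p)
    lemma true  rewrite ∪-identityʳ s = refl
    lemma false rewrite ∪-identityʳ s = cork-joined (true ∷ s) p refl

-- The transfer matrix for the sum over the flats above a given flat.

module Transfer (R : CommutativeRing 0ℓ 0ℓ) (φ : ℤ⟶ R) (t : CommutativeRing.Carrier R) where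

  open import Data.Nat using (ℕ; zero; suc) renaming (_+_ to _+ℕ_)
  import Data.Nat.Properties as ℕₚ
  open import Data.Bool using (Bool; true; false; not; _∧_; _∨_; if_then_else_)
  open import Data.Bool.Properties using (∧-identityʳ)
  open import Data.Fin.Subset using (Subset; _∪_)
  open import Data.Vec using ([]; _∷_)
  open import Data.Product using (∃; _,_)
  open import Data.Integer using (+_)
  import Relation.Binary.PropositionalEquality as ≡
  open ≡ using (_≡_)
  open CommutativeRing R
  open FanWords
  open Motzkin R φ t
  open ℤ-Solver R φ
  open import Relation.Binary.Reasoning.Setoid setoid

  ∑ : ∀ m → (Subset (suc m) → Subset m → Carrier) → Carrier
  ∑ zero    h = h (true ∷ []) [] + h (false ∷ []) []
  ∑ (suc m) h =
      (∑ m (λ s p → h (true ∷ s) (true ∷ p)) + ∑ m (λ s p → h (true ∷ s) (false ∷ p)))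
    + (∑ m (λ s p → h (false ∷ s) (true ∷ p)) + ∑ m (λ s p → h (false ∷ s) (false ∷ p)))

  ∑-cong : ∀ m {f g} → (∀ s p → f s p ≈ g s p) → ∑ m f ≈ ∑ m g
  ∑-cong zero    h = +-cong (h _ _) (h _ _)
  ∑-cong (suc m) h = +-cong
    (+-cong (∑-cong m (λ s p → h _ _)) (∑-cong m (λ s p → h _ _)))
    (+-cong (∑-cong m (λ s p → h _ _)) (∑-cong m (λ s p → h _ _)))

  ∑-linear : ∀ m a f g → ∑ m (λ s p → a * f s p + g s p) ≈ a * ∑ m f + ∑ m g
  ∑-linear zero    a f g = solve 5 (λ a x y z w → (a :* x :+ z) :+ (a :* y :+ w) := a :* (x :+ y) :+ (z :+ w)) refl _ _ _ _ _
  ∑-linear (suc m) a f g = trans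
    (+-cong (+-cong (∑-linear m a _ _) (∑-linear m a _ _)) (+-cong (∑-linear m a _ _) (∑-linear m a _ _)))
    (solve 9 (λ a x y z w x′ y′ z′ w′ →
        ((a :* x :+ x′) :+ (a :* y :+ y′)) :+ ((a :* z :+ z′) :+ (a :* w :+ w′)) :=
        a :* ((x :+ y) :+ (z :+ w)) :+ ((x′ :+ y′) :+ (z′ :+ w′))) refl _ _ _ _ _ _ _ _ _)

  ∑-0 : ∀ m → ∑ m (λ _ _ → 0#) ≈ 0#
  ∑-0 m = begin
    ∑ m (λ _ _ → 0#)                        ≈⟨ ∑-cong m (λ _ _ → solve 0 (:0 := :- :1 :* :0 :+ :0) refl) ⟩
    ∑ m (λ _ _ → - 1# * 0# + 0#)            ≈⟨ ∑-linear m (- 1#) (λ _ _ → 0#) (λ _ _ → 0#) ⟩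
    - 1# * ∑ m (λ _ _ → 0#) + ∑ m (λ _ _ → 0#) ≈⟨ solve 1 (λ x → :- :1 :* x :+ x := :0) refl _ ⟩
    0# ∎

  -- One letter of the sum over X ⊆ H with the sign (-1)^|X|.
  signed : Bool → (Bool → Carrier) → Carrier
  signed false g = g false
  signed true  g = g false - g true

  τ : Bool → Carrier
  τ true  = t
  τ false = 1#

  -- Σ (-1)^|X| t^(cork (X ∪ F) - cork (H ∪ F)) over the subsets X of H; the
  -- states c and g are those of X ∪ F and of H ∪ F.
  charSum : ∀ {m} → Bool → Bool → Subset (suc m) → Subset m → Subset (suc m) → Subset m → Carrier
  charSum c g (f ∷ fs) (a ∷ fp) (h ∷ hs) (b ∷ hp) = signed h λ x → signed b λ y →
    τ ((not (y ∨ a) ∧ not (c ∨ (x ∨ f))) ∧ not (not (b ∨ a) ∧ not (g ∨ (h ∨ f))))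
    * charSum ((y ∨ a) ∧ (c ∨ (x ∨ f))) ((b ∨ a) ∧ (g ∨ (h ∨ f))) fs fp hs hp
  charSum c g (f ∷ []) [] (h ∷ []) [] = signed h λ x →
    τ (not (c ∨ (x ∨ f)) ∧ not (not (g ∨ (h ∨ f))))

  -- The product of the fan polynomials of the maximal runs of intervals not
  -- connected to 0; j intervals of the current run have been read.
  fanProduct : ∀ {m} → ℕ → Subset (suc m) → Subset m → Carrier
  fanProduct j (true ∷ s)   (q ∷ p)     = fanPoly j * fanProduct 0 s p
  fanProduct j (false ∷ s)  (true ∷ p)  = fanProduct j s p
  fanProduct j (false ∷ s)  (false ∷ p) = fanProduct (suc j) s p
  fanProduct j (true ∷ [])  []          = fanPoly j
  fanProduct j (false ∷ []) []          = fanPoly (suc j)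

  -- What the letters already read demand of the next spoke of a flat.
  data State : Set where
    free loose joined : State

  allows : State → Bool → Bool
  allows free   _ = true
  allows loose  x = not x
  allows joined x = x

  next : Bool → Bool → State
  next true  true  = joined
  next true  false = loose
  next false true  = loose
  next false false = free

  isJoined : State → Bool
  isJoined joined = true
  isJoined _      = false

  admits : ∀ {m} → State → Subset (suc m) → Subset m → Bool
  admits σ (x ∷ s)  (q ∷ p) = allows σ x ∧ admits (next x q) s p
  admits σ (x ∷ []) []      = allows σ x

  flatᵇ≡admits : ∀ {m} (s : Subset (suc m)) p → flatᵇ s p ≡ admits free s p
  flatᵇ≡admits (x ∷ [])    []      = ≡.refl
  flatᵇ≡admits (x ∷ y ∷ s) (q ∷ p) = ≡.trans
    (≡.cong₂ _∧_ (compatible≡ x q y) (flatᵇ≡admits (y ∷ s) p)) (≡.sym (admits-head (next x q) y s p))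
    where
    compatible≡ : ∀ x q y → compatible x q y ≡ allows (next x q) y
    compatible≡ true  true  true  = ≡.refl
    compatible≡ true  true  false = ≡.refl
    compatible≡ true  false y     = ≡.refl
    compatible≡ false true  y     = ≡.refl
    compatible≡ false false y     = ≡.refl
    admits-head : ∀ {m} σ y (s : Subset m) p → admits σ (y ∷ s) p ≡ allows σ y ∧ admits free (y ∷ s) p
    admits-head σ y []      []      = ≡.sym (∧-identityʳ (allows σ y))
    admits-head σ y (_ ∷ _) (_ ∷ _) = ≡.refl

  -- The flats of the contraction at `F`: sets `H` disjoint from `F` whose union with `F` is closed.
  valid : ∀ {m} → State → Subset (suc m) → Subset m → Subset (suc m) → Subset m → Bool
  valid σ (f ∷ fs) (a ∷ fp) (h ∷ hs) (b ∷ hp) =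
    (not (h ∧ f) ∧ not (b ∧ a)) ∧ (allows σ (h ∨ f) ∧ valid (next (h ∨ f) (b ∨ a)) fs fp hs hp)
  valid σ (f ∷ []) [] (h ∷ []) [] = not (h ∧ f) ∧ allows σ (h ∨ f)

  -- One state serves both purposes: in a flat, a vertex joined to 0 from the left has its own
  -- spoke, so the state g of `H ∪ F` in `charSum` is `isJoined σ`.
  term : ∀ {m} → State → Bool → ℕ → Subset (suc m) → Subset m → Subset (suc m) → Subset m → Carrier
  term σ c j fs fp hs hp = if valid σ fs fp hs hp
    then charSum c (isJoined σ) fs fp hs hp * fanProduct j (hs ∪ fs) (hp ∪ fp) else 0#

  flatSum : ∀ {m} → State → Bool → ℕ → Subset (suc m) → Subset m → Carrier
  flatSum {m} σ c j fs fp = ∑ m (term σ c j fs fp)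

  -- One row of the transfer matrix: once the letter of `H` is fixed, summing over the letter of `X`
  -- leaves α₁ and α₀ times the two states of `X ∪ F`, and `fanProduct` leaves γ.
  combine : ∀ {m} σ j (fs : Subset (suc m)) fp α₁ α₀ γ {C G : Subset (suc m) → Subset m → Carrier} →
    (∀ hs hp → C hs hp ≈ α₁ * charSum true (isJoined σ) fs fp hs hp + α₀ * charSum false (isJoined σ) fs fp hs hp) →
    (∀ hs hp → G hs hp ≈ γ * fanProduct j (hs ∪ fs) (hp ∪ fp)) →
    ∑ m (λ hs hp → if valid σ fs fp hs hp then C hs hp * G hs hp else 0#)
      ≈ γ * (α₁ * flatSum σ true j fs fp + α₀ * flatSum σ false j fs fp)
  combine {m} σ j fs fp α₁ α₀ γ {C} {G} hC hG = begin
    ∑ m (λ hs hp → if valid σ fs fp hs hp then C hs hp * G hs hp else 0#)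
      ≈⟨ ∑-cong m pointwise ⟩
    ∑ m (λ hs hp → (γ * α₁) * term σ true j fs fp hs hp + ((γ * α₀) * term σ false j fs fp hs hp + 0#))
      ≈⟨ ∑-linear m (γ * α₁) _ _ ⟩
    (γ * α₁) * flatSum σ true j fs fp + ∑ m (λ hs hp → (γ * α₀) * term σ false j fs fp hs hp + 0#)
      ≈⟨ +-congˡ (∑-linear m (γ * α₀) _ _) ⟩
    (γ * α₁) * flatSum σ true j fs fp + ((γ * α₀) * flatSum σ false j fs fp + ∑ m (λ _ _ → 0#))
      ≈⟨ +-congˡ (+-congˡ (∑-0 m)) ⟩
    (γ * α₁) * flatSum σ true j fs fp + ((γ * α₀) * flatSum σ false j fs fp + 0#)
      ≈⟨ solve 5 (λ g a b x y → (g :* a) :* x :+ ((g :* b) :* y :+ :0) := g :* (a :* x :+ b :* y)) refl _ _ _ _ _ ⟩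
    γ * (α₁ * flatSum σ true j fs fp + α₀ * flatSum σ false j fs fp) ∎
    where
    pointwise : ∀ hs hp → (if valid σ fs fp hs hp then C hs hp * G hs hp else 0#) ≈
      (γ * α₁) * term σ true j fs fp hs hp + ((γ * α₀) * term σ false j fs fp hs hp + 0#)
    pointwise hs hp with valid σ fs fp hs hp
    ... | true  = trans (*-cong (hC hs hp) (hG hs hp))
      (solve 6 (λ g a b x y z → (a :* x :+ b :* y) :* (g :* z) := (g :* a) :* (x :* z) :+ ((g :* b) :* (y :* z) :+ :0)) refl _ _ _ _ _ _)
    ... | false = solve 2 (λ x y → :0 := x :* :0 :+ (y :* :0 :+ :0)) refl _ _

  -- A spoke in the first letter of `H ∪ F` closes a run of length j and absorbs the previous value
  -- of g, so the word can be read from `joined` with run length 0; without a spoke it is read from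
  -- `loose`.
  flatSum-free : ∀ {m} j (fs : Subset (suc m)) fp →
    flatSum free false j fs fp ≈ fanPoly j * flatSum joined false 0 fs fp + flatSum loose false j fs fp
  flatSum-free {m} j fs fp = trans (∑-cong m (pointwise fs fp)) (∑-linear m _ _ _)
    where
    if-*-0 : ∀ b x y → (if b then x * y else 0#) ≈ fanPoly j * 0# + (if b then x * y else 0#)
    if-*-0 b x y = solve 2 (λ p z → z := p :* :0 :+ z) refl _ _
    if-swap : ∀ b x y z → (if b then x * (y * z) else 0#) ≈ y * (if b then x * (1# * z) else 0#) + 0#
    if-swap true  = solve 3 (λ x y z → x :* (y :* z) := y :* (x :* (:1 :* z)) :+ :0) refl
    if-swap false x y z = solve 1 (λ y → :0 := y :* :0 :+ :0) refl _
    none : 0# ≈ fanPoly j * 0# + 0#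
    none = solve 1 (λ y → :0 := y :* :0 :+ :0) refl _
    pointwise : ∀ {m} (fs : Subset (suc m)) fp hs hp →
      term free false j fs fp hs hp ≈ fanPoly j * term joined false 0 fs fp hs hp + term loose false j fs fp hs hp
    pointwise (true ∷ [])  [] (true ∷ [])  [] = none
    pointwise (true ∷ [])  [] (false ∷ []) [] = solve 2 (λ x y → x :* y := y :* (x :* :1) :+ :0) refl _ _
    pointwise (false ∷ []) [] (true ∷ [])  [] = solve 2 (λ x y → x :* y := y :* (x :* :1) :+ :0) refl _ _
    pointwise (false ∷ []) [] (false ∷ []) [] = solve 2 (λ p z → z := p :* :0 :+ z) refl _ _
    pointwise (true ∷ fs)  (a ∷ fp) (true ∷ hs)  (b ∷ hp) = none
    pointwise (true ∷ fs)  (true ∷ fp) (false ∷ hs) (true ∷ hp) = none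
    pointwise (true ∷ fs)  (true ∷ fp) (false ∷ hs) (false ∷ hp) = if-swap (valid joined fs fp hs hp) _ _ _
    pointwise (true ∷ fs)  (false ∷ fp) (false ∷ hs) (true ∷ hp) = if-swap (valid joined fs fp hs hp) _ _ _
    pointwise (true ∷ fs)  (false ∷ fp) (false ∷ hs) (false ∷ hp) = if-swap (valid loose fs fp hs hp) _ _ _
    pointwise (false ∷ fs) (true ∷ fp) (true ∷ hs) (true ∷ hp) = none
    pointwise (false ∷ fs) (true ∷ fp) (true ∷ hs) (false ∷ hp) = if-swap (valid joined fs fp hs hp) _ _ _
    pointwise (false ∷ fs) (false ∷ fp) (true ∷ hs) (true ∷ hp) = if-swap (valid joined fs fp hs hp) _ _ _
    pointwise (false ∷ fs) (false ∷ fp) (true ∷ hs) (false ∷ hp) = if-swap (valid loose fs fp hs hp) _ _ _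
    pointwise (false ∷ fs) (true ∷ fp) (false ∷ hs) (true ∷ hp) = none
    pointwise (false ∷ fs) (true ∷ fp) (false ∷ hs) (false ∷ hp) = if-*-0 (valid loose fs fp hs hp) _ _
    pointwise (false ∷ fs) (false ∷ fp) (false ∷ hs) (true ∷ hp) = if-*-0 (valid loose fs fp hs hp) _ _
    pointwise (false ∷ fs) (false ∷ fp) (false ∷ hs) (false ∷ hp) = if-*-0 (valid free fs fp hs hp) _ _

  -- An interval is counted at its right end. In a flat, linked vertices agree on having a spoke, so
  -- the count then starts with the interval of the first vertex.
  firstRun : ∀ {m} → Subset (suc m) → Subset m → ℕ
  firstRun (true ∷ s)   (q ∷ p)     = 0
  firstRun (false ∷ s)  (true ∷ p)  = firstRun s p
  firstRun (false ∷ s)  (false ∷ p) = suc (firstRun s p)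
  firstRun (true ∷ [])  []          = 0
  firstRun (false ∷ []) []          = 1

  -- The product of g over the lengths of the runs after the first one.
  laterRuns : ∀ {m} → (ℕ → Carrier) → Subset (suc m) → Subset m → Carrier
  laterRuns g (true ∷ s)  (q ∷ p) = g (firstRun s p) * laterRuns g s p
  laterRuns g (false ∷ s) (q ∷ p) = laterRuns g s p
  laterRuns g (x ∷ [])    []      = 1#

  fanProduct≈ : ∀ {m} j (s : Subset (suc m)) p → fanProduct j s p ≈ fanPoly (j +ℕ firstRun s p) * laterRuns fanPoly s p
  fanProduct≈ j (true ∷ s) (q ∷ p) = *-cong (reflexive (≡.cong fanPoly (≡.sym (ℕₚ.+-identityʳ j)))) (fanProduct≈ 0 s p)
  fanProduct≈ j (false ∷ s) (true ∷ p) = fanProduct≈ j s p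
  fanProduct≈ j (false ∷ s) (false ∷ p) = trans (fanProduct≈ (suc j) s p)
    (*-congʳ (reflexive (≡.cong fanPoly (≡.sym (ℕₚ.+-suc j _)))))
  fanProduct≈ j (true ∷ []) [] = trans (sym (*-identityʳ _)) (*-congʳ (reflexive (≡.cong fanPoly (≡.sym (ℕₚ.+-identityʳ j)))))
  fanProduct≈ j (false ∷ []) [] = trans (sym (*-identityʳ _)) (*-congʳ (reflexive (≡.cong fanPoly (≡.sym (ℕₚ.+-comm j 1)))))

  firstRun-pos : ∀ {m} (s : Subset (suc m)) p → flatᵇ s p ≡ true → head s ≡ false → ∃ λ k → firstRun s p ≡ suc k
  firstRun-pos (false ∷ [])        []          _ _ = 0 , ≡.refl
  firstRun-pos (false ∷ y ∷ s)     (false ∷ p) _ _ = _ , ≡.refl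
  firstRun-pos (false ∷ false ∷ s) (true ∷ p)  h _ = firstRun-pos (false ∷ s) p h ≡.refl

  firstRun-0 : ∀ {m} (s : Subset (suc m)) p → head s ≡ true → firstRun s p ≡ 0
  firstRun-0 (true ∷ [])    []      _ = ≡.refl
  firstRun-0 (true ∷ _ ∷ _) (_ ∷ _) _ = ≡.refl

  onlyZero : ℕ → Carrier
  onlyZero zero    = 1#
  onlyZero (suc _) = 0#

  -- The entries on which the induction along the word closes. The state c of `X ∪ F` is true only
  -- where `H ∪ F` is joined, so `loose` occurs with c false alone.
  record Evaluation {m} (fs : Subset (suc m)) (fp : Subset m) : Set where
    field
      loose-sum  : ∀ j → flatSum loose false j fs fp ≈ pathSum j (firstRun fs fp) * laterRuns fanPolyRev fs fp
      joined-sum : flatSum joined false 0 fs fp ≈ coneSum (firstRun fs fp) * laterRuns fanPolyRev fs fp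
      linked-sum : flatSum joined true 0 fs fp ≈ onlyZero (firstRun fs fp) * laterRuns fanPolyRev fs fp
  open Evaluation

  module _ {m} (fs : Subset (suc m)) (fp : Subset m) where

    private
      1-id : ∀ {G : Subset (suc m) → Subset m → Carrier} hs hp → G hs hp ≈ 1# * G hs hp
      1-id _ _ = sym (*-identityˡ _)

      only₀ : ∀ {C₁ C₀ : Subset (suc m) → Subset m → Carrier} hs hp → 1# * C₀ hs hp ≈ 0# * C₁ hs hp + 1# * C₀ hs hp
      only₀ _ _ = solve 2 (λ x y → :1 :* y := :0 :* x :+ :1 :* y) refl _ _
      weighted₀ : ∀ {C₁ C₀ : Subset (suc m) → Subset m → Carrier} hs hp → t * C₀ hs hp - 1# * C₀ hs hp ≈ 0# * C₁ hs hp + t-1 * C₀ hs hp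
      weighted₀ _ _ = solve 3 (λ t x y → t :* y :- :1 :* y := :0 :* x :+ (t :- :1) :* y) refl t _ _
      differ : ∀ {C₁ C₀ : Subset (suc m) → Subset m → Carrier} hs hp → 1# * C₀ hs hp - 1# * C₁ hs hp ≈ - 1# * C₁ hs hp + 1# * C₀ hs hp
      differ _ _ = solve 2 (λ x y → :1 :* y :- :1 :* x := :- :1 :* x :+ :1 :* y) refl _ _

    loose-contracted : ∀ j → flatSum loose false j (false ∷ fs) (true ∷ fp) ≈ flatSum loose false j fs fp
    loose-contracted j = trans
      (+-cong (+-cong (∑-0 m) (∑-0 m)) (+-cong (∑-0 m)
        (combine loose j fs fp 0# 1# 1# only₀ 1-id)))
      (solve 2 (λ x y → (:0 :+ :0) :+ (:0 :+ :1 :* (:0 :* x :+ :1 :* y)) := y) refl _ _)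

    loose-uncontracted : ∀ j → flatSum loose false j (false ∷ fs) (false ∷ fp) ≈
      t-1 * flatSum loose false j fs fp + flatSum free false (suc j) fs fp
    loose-uncontracted j = trans
      (+-cong (+-cong (∑-0 m) (∑-0 m)) (+-cong
        (combine loose j fs fp 0# t-1 1# weighted₀ 1-id)
        (combine free (suc j) fs fp 0# 1# 1# only₀ 1-id)))
      (solve 5 (λ c x y z w → (:0 :+ :0) :+ (:1 :* (:0 :* x :+ c :* y) :+ :1 :* (:0 :* z :+ :1 :* w)) := c :* y :+ w) refl t-1 _ _ _ _)

    private
      all-0 : (∑ m (λ _ _ → 0#) + ∑ m (λ _ _ → 0#)) + (∑ m (λ _ _ → 0#) + ∑ m (λ _ _ → 0#)) ≈ 0#
      all-0 = trans (+-cong (+-cong (∑-0 m) (∑-0 m)) (+-cong (∑-0 m) (∑-0 m)))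
        (solve 0 ((:0 :+ :0) :+ (:0 :+ :0) := :0) refl)

    loose-spoke : ∀ j a → flatSum loose false j (true ∷ fs) (a ∷ fp) ≈ 0#
    loose-spoke j true = all-0
    loose-spoke j false = all-0

    joined-contracted : flatSum joined false 0 (false ∷ fs) (true ∷ fp) ≈ flatSum joined false 0 fs fp - flatSum joined true 0 fs fp
    joined-contracted = trans
      (+-cong (+-cong (∑-0 m)
        (combine joined 0 fs fp (- 1#) 1# 1# differ (λ _ _ → refl)))
        (+-cong (∑-0 m) (∑-0 m)))
      (solve 2 (λ x y → (:0 :+ :1 :* (:- :1 :* x :+ :1 :* y)) :+ (:0 :+ :0) := y :- x) refl _ _)

    -- With the path edge in `H`, the four choices of `X` in this letter give t, -1, -1 and, for
    -- both edges, +1 with `X` joined: hence t - 2 and the linked sum. Without it, the two choices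
    -- for the spoke give t - 1.
    joined-uncontracted : flatSum joined false 0 (false ∷ fs) (false ∷ fp) ≈
      (t-1 - 1#) * flatSum joined false 0 fs fp + flatSum joined true 0 fs fp + t-1 * flatSum loose false 0 fs fp
    joined-uncontracted = trans
      (+-cong (+-cong
        (combine joined 0 fs fp 1# (t-1 - 1#) 1# (λ hs hp → solve 3 (λ t x y →
            (t :* y :- :1 :* y) :- (:1 :* y :- :1 :* x) := :1 :* x :+ (t :- :1 :- :1) :* y) refl t _ _) (λ _ _ → refl))
        (combine loose 0 fs fp 0# t-1 1# weighted₀ (λ _ _ → refl)))
        (+-cong (∑-0 m) (∑-0 m)))
      (solve 5 (λ c x y z w → (:1 :* (:1 :* x :+ (c :- :1) :* y) :+ :1 :* (:0 :* z :+ c :* w)) :+ (:0 :+ :0)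
         := (c :- :1) :* y :+ x :+ c :* w) refl t-1 _ _ _ _)

    -- The first spoke lies in `H`, and with c true its vertex is already joined in `X ∪ F`; putting
    -- the spoke into `X` changes only the sign, so the terms cancel in pairs.
    linked-vanish : ∀ a → flatSum joined true 0 (false ∷ fs) (a ∷ fp) ≈ 0#
    linked-vanish true = trans
      (+-cong (+-cong (∑-0 m)
        (combine joined 0 fs fp 0# 0# 1# (λ hs hp → solve 2 (λ x y → :1 :* x :- :1 :* x := :0 :* x :+ :0 :* y) refl _ _) (λ _ _ → refl)))
        (+-cong (∑-0 m) (∑-0 m)))
      (solve 2 (λ x y → (:0 :+ :1 :* (:0 :* x :+ :0 :* y)) :+ (:0 :+ :0) := :0) refl _ _)
    linked-vanish false = trans
      (+-cong (+-cong
        (combine joined 0 fs fp 0# 0# 1# (λ hs hp → solve 2 (λ x y →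
            (:1 :* y :- :1 :* x) :- (:1 :* y :- :1 :* x) := :0 :* x :+ :0 :* y) refl _ _) (λ _ _ → refl))
        (combine loose 0 fs fp 0# 0# 1# (λ hs hp → solve 2 (λ x y → :1 :* y :- :1 :* y := :0 :* x :+ :0 :* y) refl _ _) (λ _ _ → refl)))
        (+-cong (∑-0 m) (∑-0 m)))
      (solve 4 (λ x y z w → (:1 :* (:0 :* x :+ :0 :* y) :+ :1 :* (:0 :* z :+ :0 :* w)) :+ (:0 :+ :0) := :0) refl _ _ _ _)

    spoke-contracted : ∀ c → flatSum joined c 0 (true ∷ fs) (true ∷ fp) ≈ flatSum joined true 0 fs fp
    spoke-contracted c = trans
      (+-cong (+-cong (∑-0 m) (∑-0 m)) (+-cong (∑-0 m)
        (combine joined 0 fs fp 1# 0# 1# (pointwise c) (λ _ _ → refl))))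
      (solve 2 (λ x y → (:0 :+ :0) :+ (:0 :+ :1 :* (:1 :* x :+ :0 :* y)) := x) refl _ _)
      where
      pointwise : ∀ c hs hp → charSum c true (true ∷ fs) (true ∷ fp) (false ∷ hs) (false ∷ hp) ≈
        1# * charSum true true fs fp hs hp + 0# * charSum false true fs fp hs hp
      pointwise true  hs hp = solve 2 (λ x y → :1 :* x := :1 :* x :+ :0 :* y) refl _ _
      pointwise false hs hp = solve 2 (λ x y → :1 :* x := :1 :* x :+ :0 :* y) refl _ _

    spoke-uncontracted : ∀ c → flatSum joined c 0 (true ∷ fs) (false ∷ fp) ≈
      flatSum joined false 0 fs fp - flatSum joined true 0 fs fp + flatSum loose false 0 fs fp
    spoke-uncontracted c = trans
      (+-cong (+-cong (∑-0 m) (∑-0 m)) (+-cong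
        (combine joined 0 fs fp (- 1#) 1# 1# (pointwise c) (λ _ _ → refl))
        (combine loose 0 fs fp 0# 1# 1# (pointwise′ c) (λ _ _ → refl))))
      (solve 4 (λ x y z w → (:0 :+ :0) :+ (:1 :* (:- :1 :* x :+ :1 :* y) :+ :1 :* (:0 :* z :+ :1 :* w)) := y :- x :+ w) refl _ _ _ _)
      where
      pointwise : ∀ c hs hp → charSum c true (true ∷ fs) (false ∷ fp) (false ∷ hs) (true ∷ hp) ≈
        - 1# * charSum true true fs fp hs hp + 1# * charSum false true fs fp hs hp
      pointwise true = differ
      pointwise false = differ
      pointwise′ : ∀ c hs hp → charSum c true (true ∷ fs) (false ∷ fp) (false ∷ hs) (false ∷ hp) ≈
        0# * charSum true false fs fp hs hp + 1# * charSum false false fs fp hs hp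
      pointwise′ true = only₀
      pointwise′ false = only₀

  free-sum : ∀ {m} (fs : Subset (suc m)) fp → Evaluation fs fp → ∀ j → flatSum free false j fs fp ≈
    (pathSum j (firstRun fs fp) + fanPoly j * coneSum (firstRun fs fp)) * laterRuns fanPolyRev fs fp
  free-sum fs fp ev j = begin
    flatSum free false j fs fp ≈⟨ flatSum-free j fs fp ⟩
    fanPoly j * flatSum joined false 0 fs fp + flatSum loose false j fs fp
      ≈⟨ +-cong (*-congˡ (joined-sum ev)) (loose-sum ev j) ⟩
    _ ≈⟨ solve 4 (λ f c u p → f :* (c :* u) :+ p :* u := (p :+ f :* c) :* u) refl _ _ _ _ ⟩
    _ ∎

  evaluate : ∀ {m} (fs : Subset (suc m)) fp → flatᵇ fs fp ≡ true → Evaluation fs fp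
  evaluate (false ∷ []) [] _ = record
    { loose-sum  = λ j → solve 2 (λ c f → :0 :+ :1 :* f := (c :* :0 :+ :0 :+ f :* :1) :* :1) refl t-1 _
    ; joined-sum = solve 1 (λ t → (t :- :1) :* :1 :+ :0 := (t :- :1) :* :1) refl t
    ; linked-sum = solve 0 ((:1 :- :1) :* :1 :+ :0 := :0 :* :1) refl }
  evaluate (true ∷ []) [] _ = record
    { loose-sum  = λ j → solve 0 (:0 :+ :0 := :0 :* :1) refl
    ; joined-sum = solve 0 (:0 :+ :1 :* :1 := :1 :* :1) refl
    ; linked-sum = solve 0 (:0 :+ :1 :* :1 := :1 :* :1) refl }
  evaluate (false ∷ false ∷ fs) (true ∷ fp) h with evaluate (false ∷ fs) fp h | firstRun-pos (false ∷ fs) fp h ≡.refl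
  ... | ev | k , eq = record
    { loose-sum  = λ j → trans (loose-contracted (false ∷ fs) fp j) (loose-sum ev j)
    ; joined-sum = begin
        flatSum joined false 0 (false ∷ false ∷ fs) (true ∷ fp) ≈⟨ joined-contracted (false ∷ fs) fp ⟩
        flatSum joined false 0 (false ∷ fs) fp - flatSum joined true 0 (false ∷ fs) fp
          ≈⟨ +-cong (joined-sum ev) (-‿cong (trans (linked-sum ev) (*-congʳ (reflexive (≡.cong onlyZero eq))))) ⟩
        _ ≈⟨ solve 2 (λ x u → x :- :0 :* u := x) refl _ _ ⟩
        _ ∎
    ; linked-sum = trans (linked-vanish (false ∷ fs) fp true) (trans (sym (zeroˡ _)) (*-congʳ (reflexive (≡.cong onlyZero (≡.sym eq))))) }
  evaluate (false ∷ y ∷ fs) (false ∷ fp) h with evaluate (y ∷ fs) fp h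
  ... | ev = record
    { loose-sum  = λ j → begin
        flatSum loose false j (false ∷ y ∷ fs) (false ∷ fp) ≈⟨ loose-uncontracted (y ∷ fs) fp j ⟩
        t-1 * flatSum loose false j (y ∷ fs) fp + flatSum free false (suc j) (y ∷ fs) fp
          ≈⟨ +-cong (*-congˡ (loose-sum ev j)) (free-sum (y ∷ fs) fp ev (suc j)) ⟩
        _ ≈⟨ solve 5 (λ c p u q r → c :* (p :* u) :+ (q :+ r) :* u := (c :* p :+ q :+ r) :* u) refl _ _ _ _ _ ⟩
        _ ∎
    ; joined-sum = begin
        flatSum joined false 0 (false ∷ y ∷ fs) (false ∷ fp) ≈⟨ joined-uncontracted (y ∷ fs) fp ⟩
        _ ≈⟨ +-cong (+-cong (*-congˡ (joined-sum ev)) (linked-sum ev)) (*-congˡ (loose-sum ev 0)) ⟩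
        _ ≈⟨ cone-step (firstRun (y ∷ fs) fp) _ ⟩
        _ ∎
    ; linked-sum = trans (linked-vanish (y ∷ fs) fp false) (sym (zeroˡ _)) }
    where
    -- If the next run is empty, the linked sum turns t - 2 into the special value t - 1 of
    -- `coneSum 1`; otherwise it vanishes.
    cone-step : ∀ k u → (t-1 - 1#) * (coneSum k * u) + onlyZero k * u + t-1 * (pathSum 0 k * u) ≈ coneSum (suc k) * u
    cone-step zero    u = solve 2 (λ c u → (c :- :1) :* (:1 :* u) :+ :1 :* u :+ c :* (:0 :* u) := c :* u) refl t-1 u
    cone-step (suc k) u = solve 4 (λ c b u p → (c :- :1) :* (b :* u) :+ :0 :* u :+ c :* (p :* u) := ((c :- :1) :* b :+ c :* p) :* u) refl t-1 _ u _
  evaluate (true ∷ true ∷ fs) (true ∷ fp) h with evaluate (true ∷ fs) fp h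
  ... | ev = record
    { loose-sum  = λ j → trans (loose-spoke (true ∷ fs) fp j true) (sym (zeroˡ _))
    ; joined-sum = both false
    ; linked-sum = both true }
    where
    both : ∀ c → flatSum joined c 0 (true ∷ true ∷ fs) (true ∷ fp) ≈ 1# * laterRuns fanPolyRev (true ∷ true ∷ fs) (true ∷ fp)
    both c = begin
      flatSum joined c 0 (true ∷ true ∷ fs) (true ∷ fp)  ≈⟨ spoke-contracted (true ∷ fs) fp c ⟩
      flatSum joined true 0 (true ∷ fs) fp               ≈⟨ linked-sum ev ⟩
      onlyZero (firstRun (true ∷ fs) fp) * u             ≈⟨ *-congʳ (reflexive (≡.cong onlyZero (firstRun-0 (true ∷ fs) fp ≡.refl))) ⟩
      1# * u                                             ≈⟨ *-congˡ (trans (sym (*-identityˡ u)) (*-congʳ (reflexive (≡.cong fanPolyRev (≡.sym (firstRun-0 (true ∷ fs) fp ≡.refl)))))) ⟩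
      1# * (fanPolyRev (firstRun (true ∷ fs) fp) * u)    ∎
      where u = laterRuns fanPolyRev (true ∷ fs) fp
  evaluate (true ∷ false ∷ fs) (false ∷ fp) h with evaluate (false ∷ fs) fp h | firstRun-pos (false ∷ fs) fp h ≡.refl
  ... | ev | k , eq = record
    { loose-sum  = λ j → trans (loose-spoke (false ∷ fs) fp j false) (sym (zeroˡ _))
    ; joined-sum = both false
    ; linked-sum = both true }
    where
    both : ∀ c → flatSum joined c 0 (true ∷ false ∷ fs) (false ∷ fp) ≈ 1# * laterRuns fanPolyRev (true ∷ false ∷ fs) (false ∷ fp)
    both c = begin
      flatSum joined c 0 (true ∷ false ∷ fs) (false ∷ fp)  ≈⟨ spoke-uncontracted (false ∷ fs) fp c ⟩
      flatSum joined false 0 (false ∷ fs) fp - flatSum joined true 0 (false ∷ fs) fp + flatSum loose false 0 (false ∷ fs) fp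
        ≈⟨ +-cong (+-cong (joined-sum ev) (-‿cong (trans (linked-sum ev) (*-congʳ (reflexive (≡.cong onlyZero eq)))))) (loose-sum ev 0) ⟩
      -- After the vertex joined to 0, the first interval of the run may be joined or loose in the
      -- larger flat; the total of both is the factor of the whole run.
      coneSum r * u - 0# * u + pathSum 0 r * u
        ≈⟨ solve 3 (λ b p u → b :* u :- :0 :* u :+ p :* u := :1 :* ((p :+ b) :* u)) refl _ _ _ ⟩
      1# * ((pathSum 0 r + coneSum r) * u)                 ≈⟨ *-congˡ (*-congʳ (pathSum+coneSum r)) ⟩
      1# * (fanPolyRev r * u)                              ∎
      where
      u = laterRuns fanPolyRev (false ∷ fs) fp
      r = firstRun (false ∷ fs) fp

  flatSum-total : ∀ {m} (fs : Subset (suc m)) fp → flatᵇ fs fp ≡ true →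
    flatSum free false 0 fs fp ≈ fanPolyRev (firstRun fs fp) * laterRuns fanPolyRev fs fp
  flatSum-total fs fp h = trans (free-sum fs fp (evaluate fs fp h) 0)
    (*-congʳ (trans (+-congˡ (*-identityˡ _)) (pathSum+coneSum (firstRun fs fp))))

-- The characteristic polynomial as a sum over words.

module CharacteristicSum (R : CommutativeRing 0ℓ 0ℓ) (φ : ℤ⟶ R) (t : CommutativeRing.Carrier R) where

  open import Data.Nat using (ℕ; zero; suc; _≤_; _∸_) renaming (_+_ to _+ℕ_)
  import Data.Nat.Properties as ℕₚ
  open import Algebra.Properties.CommutativeSemigroup ℕₚ.+-commutativeSemigroup using () renaming (interchange to +ℕ-interchange)
  open import Data.Bool using (Bool; true; false; not; _∧_; _∨_; if_then_else_; T)
  open import Data.Bool.Properties using (T-∧; T-≡)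
  open import Data.Fin.Subset using (Subset; _∪_; ∣_∣)
  open import Data.Vec using ([]; _∷_)
  open import Data.Product using (proj₁; proj₂)
  open import Data.Unit using (tt)
  open import Data.Integer using (+_)
  open import Function using (Equivalence)
  import Relation.Binary.PropositionalEquality as ≡
  open ≡ using (_≡_)
  open CommutativeRing R
  open FanWords
  open Transfer R φ t
  open ℤ-Solver R φ
  open import Relation.Binary.Reasoning.Setoid setoid

  sgn : ℕ → Carrier
  sgn zero    = 1#
  sgn (suc k) = - sgn k

  pow : ℕ → Carrier
  pow zero    = 1#
  pow (suc e) = t * pow e

  sgn-+ : ∀ a b → sgn (a +ℕ b) ≈ sgn a * sgn b
  sgn-+ zero    b = sym (*-identityˡ _)
  sgn-+ (suc a) b = trans (-‿cong (sgn-+ a b)) (solve 2 (λ x y → :- (x :* y) := (:- x) :* y) refl _ _)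

  pow-+ : ∀ a b → pow (a +ℕ b) ≈ pow a * pow b
  pow-+ zero    b = sym (*-identityˡ _)
  pow-+ (suc a) b = trans (*-congˡ (pow-+ a b)) (sym (*-assoc _ _ _))

  τ≈pow : ∀ a b → T (b ⇒ a) → τ (a ∧ not b) ≈ pow (β a ∸ β b)
  τ≈pow true  true  _ = refl
  τ≈pow true  false _ = sym (*-identityʳ t)
  τ≈pow false false _ = refl

  subᵇ : ∀ {n} → Subset n → Subset n → Bool
  subᵇ []      []      = true
  subᵇ (x ∷ X) (y ∷ Y) = (x ⇒ y) ∧ subᵇ X Y

  -- Turns an inclusion into the union that `cork-antitone` expects.
  sub-∪ : ∀ {n} (X H F : Subset n) → T (subᵇ X H) → (X ∪ F) ∪ (H ∪ F) ≡ H ∪ F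
  sub-∪ []          []      []      _ = ≡.refl
  sub-∪ (x ∷ X) (h ∷ H) (f ∷ F) s = ≡.cong₂ _∷_ (bit x h f (proj₁ (Equivalence.to T-∧ s)))
      (sub-∪ X H F (proj₂ (Equivalence.to (T-∧ {x ⇒ h}) s)))
    where
    bit : ∀ x h f → T (x ⇒ h) → (x ∨ f) ∨ (h ∨ f) ≡ h ∨ f
    bit true  true  f     _ = ≡.refl
    bit false true  true  _ = ≡.refl
    bit false true  false _ = ≡.refl
    bit false false true  _ = ≡.refl
    bit false false false _ = ≡.refl

  charTerm : ∀ {m} → Bool → Bool → Subset (suc m) → Subset m → Subset (suc m) → Subset m → Subset (suc m) → Subset m → Carrier
  charTerm c g fs fp hs hp xs xp = if subᵇ xs hs ∧ subᵇ xp hp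
    then sgn (∣ xs ∣ +ℕ ∣ xp ∣) * pow (cork c (xs ∪ fs) (xp ∪ fp) ∸ cork g (hs ∪ fs) (hp ∪ fp)) else 0#

  ∸-+-split : ∀ {a b c d} → b ≤ a → d ≤ c → (a +ℕ c) ∸ (b +ℕ d) ≡ (a ∸ b) +ℕ (c ∸ d)
  ∸-+-split {a} {b} {c} {d} b≤a d≤c = ≡.trans
    (≡.cong₂ (λ a c → (a +ℕ c) ∸ (b +ℕ d)) (≡.sym (ℕₚ.m∸n+n≡m b≤a)) (≡.sym (ℕₚ.m∸n+n≡m d≤c)))
    (≡.trans (≡.cong (_∸ (b +ℕ d)) (+ℕ-interchange (a ∸ b) b (c ∸ d) d)) (ℕₚ.m+n∸n≡m ((a ∸ b) +ℕ (c ∸ d)) (b +ℕ d)))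

  β-mono : ∀ a b → T (b ⇒ a) → β b ≤ β a
  β-mono true  true  _ = ℕₚ.≤-refl
  β-mono true  false _ = Data.Nat.z≤n
  β-mono false false _ = Data.Nat.z≤n

  letter : Bool → Bool → (Bool → Bool → Carrier) → Bool → Bool → Carrier
  letter h b V x y = if (x ⇒ h) ∧ (y ⇒ b) then sgn (β x +ℕ β y) * V x y else 0#

  signed-expand : ∀ h b V → signed h (λ x → signed b (V x)) ≈
    (letter h b V true true + letter h b V true false) + (letter h b V false true + letter h b V false false)
  signed-expand true true V = solve 4 (λ w x y z → (z :- y) :- (x :- w) :=
    ((:- (:- :1)) :* w :+ (:- :1) :* x) :+ ((:- :1) :* y :+ :1 :* z)) refl _ _ _ _
  signed-expand true false V = solve 2 (λ x z → z :- x :=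
    (:0 :+ (:- :1) :* x) :+ (:0 :+ :1 :* z)) refl _ _
  signed-expand false true V = solve 2 (λ y z → z :- y :=
    (:0 :+ :0) :+ ((:- :1) :* y :+ :1 :* z)) refl _ _
  signed-expand false false V = solve 1 (λ z → z := (:0 :+ :0) :+ (:0 :+ :1 :* z)) refl _

  -- The exponent is a truncated difference, yet it adds up letter by letter: X ⊆ H and c ⇒ g make
  -- both the part of the letter and that of the remaining word genuine differences.
  charSum≈∑ : ∀ {m} c g (fs : Subset (suc m)) fp hs hp → T (c ⇒ g) →
    charSum c g fs fp hs hp ≈ ∑ m (charTerm c g fs fp hs hp)
  charSum≈∑ c g (f ∷ []) [] (h ∷ []) [] c⇒g = trans (signed₁ h _) (+-cong (one true) (one false))
    where
    value : Bool → Carrier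
    value x = τ (not (c ∨ (x ∨ f)) ∧ not (not (g ∨ (h ∨ f))))
    signed₁ : ∀ h V → signed h V ≈ (if (true ⇒ h) ∧ true then sgn 1 * V true else 0#) + (if (false ⇒ h) ∧ true then sgn 0 * V false else 0#)
    signed₁ true  V = solve 2 (λ x z → z :- x := (:- :1) :* x :+ :1 :* z) refl _ _
    signed₁ false V = solve 1 (λ z → z := :0 :+ :1 :* z) refl _
    one : ∀ x → (if (x ⇒ h) ∧ true then sgn (β x) * value x else 0#) ≈ charTerm c g (f ∷ []) [] (h ∷ []) [] (x ∷ []) []
    one x with x ⇒ h in eq
    ... | false = refl
    ... | true  = *-cong (reflexive (≡.cong sgn (≡.sym (≡.trans (ℕₚ.+-identityʳ _) (≡.trans (count-∷ x []) (ℕₚ.+-identityʳ _))))))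
      (τ≈pow (not (c ∨ (x ∨ f))) (not (g ∨ (h ∨ f))) (⇒-elim (⇒-elim (check 5
        (λ { (c ∷ g ∷ f ∷ x ∷ h ∷ []) → (c ⇒ g) ⇒ (x ⇒ h) ⇒ (not (g ∨ (h ∨ f)) ⇒ not (c ∨ (x ∨ f))) }) tt (c ∷ g ∷ f ∷ x ∷ h ∷ [])) c⇒g)
        (Equivalence.from T-≡ eq)))
  charSum≈∑ {suc m} c g (f ∷ fs) (a ∷ fp) (h ∷ hs) (b ∷ hp) c⇒g = trans (signed-expand h b value)
    (+-cong (+-cong (one true true) (one true false)) (+-cong (one false true) (one false false)))
    where
    looseX : Bool → Bool → Bool
    looseX x y = not (y ∨ a) ∧ not (c ∨ (x ∨ f))
    looseH : Bool
    looseH = not (b ∨ a) ∧ not (g ∨ (h ∨ f))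
    c′ : Bool → Bool → Bool
    c′ x y = (y ∨ a) ∧ (c ∨ (x ∨ f))
    g′ : Bool
    g′ = (b ∨ a) ∧ (g ∨ (h ∨ f))
    value : Bool → Bool → Carrier
    value x y = τ (looseX x y ∧ not looseH) * charSum (c′ x y) g′ fs fp hs hp
    module _ (x y : Bool) (x⇒h : T (x ⇒ h)) (y⇒b : T (y ⇒ b)) where
      loose⇒ : T (looseH ⇒ looseX x y)
      loose⇒ = ⇒-elim (⇒-elim (⇒-elim (check 8
        (λ { (c ∷ g ∷ f ∷ a ∷ x ∷ y ∷ h ∷ b ∷ []) → (c ⇒ g) ⇒ (x ⇒ h) ⇒ (y ⇒ b) ⇒
             ((not (b ∨ a) ∧ not (g ∨ (h ∨ f))) ⇒ (not (y ∨ a) ∧ not (c ∨ (x ∨ f)))) }) tt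
        (c ∷ g ∷ f ∷ a ∷ x ∷ y ∷ h ∷ b ∷ [])) c⇒g) x⇒h) y⇒b
      state⇒ : T (c′ x y ⇒ g′)
      state⇒ = ⇒-elim (⇒-elim (⇒-elim (check 8
        (λ { (c ∷ g ∷ f ∷ a ∷ x ∷ y ∷ h ∷ b ∷ []) → (c ⇒ g) ⇒ (x ⇒ h) ⇒ (y ⇒ b) ⇒
             (((y ∨ a) ∧ (c ∨ (x ∨ f))) ⇒ ((b ∨ a) ∧ (g ∨ (h ∨ f)))) }) tt
        (c ∷ g ∷ f ∷ a ∷ x ∷ y ∷ h ∷ b ∷ [])) c⇒g) x⇒h) y⇒b
      tail : Subset (suc m) → Subset m → Carrier
      tail = charTerm (c′ x y) g′ fs fp hs hp
      coeff : Carrier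
      coeff = sgn (β x +ℕ β y) * τ (looseX x y ∧ not looseH)
      size : ∀ xs xp → ∣ x ∷ xs ∣ +ℕ ∣ y ∷ xp ∣ ≡ (β x +ℕ β y) +ℕ (∣ xs ∣ +ℕ ∣ xp ∣)
      size xs xp = ≡.trans (≡.cong₂ _+ℕ_ (count-∷ x xs) (count-∷ y xp)) (+ℕ-interchange (β x) (∣ xs ∣) (β y) (∣ xp ∣))
      split : ∀ xs xp → (if subᵇ xs hs ∧ subᵇ xp hp
        then sgn (∣ x ∷ xs ∣ +ℕ ∣ y ∷ xp ∣) * pow ((β (looseX x y) +ℕ cork (c′ x y) (xs ∪ fs) (xp ∪ fp)) ∸ (β looseH +ℕ cork g′ (hs ∪ fs) (hp ∪ fp)))
        else 0#) ≈ coeff * tail xs xp + 0#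
      split xs xp with subᵇ xs hs in e₁ | subᵇ xp hp in e₂
      ... | false | _     = solve 1 (λ c → :0 := c :* :0 :+ :0) refl _
      ... | true  | false = solve 1 (λ c → :0 := c :* :0 :+ :0) refl _
      ... | true  | true  = begin
        sgn (∣ x ∷ xs ∣ +ℕ ∣ y ∷ xp ∣) * pow ((β (looseX x y) +ℕ A) ∸ (β looseH +ℕ B))
          ≈⟨ *-cong (trans (reflexive (≡.cong sgn (size xs xp))) (sgn-+ (β x +ℕ β y) _))
                    (trans (reflexive (≡.cong pow (∸-+-split (β-mono (looseX x y) looseH loose⇒) B≤A))) (pow-+ (β (looseX x y) ∸ β looseH) (A ∸ B))) ⟩
        (sgn (β x +ℕ β y) * sgn (∣ xs ∣ +ℕ ∣ xp ∣)) * (pow (β (looseX x y) ∸ β looseH) * pow (A ∸ B))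
          ≈⟨ *-congˡ (*-congʳ (sym (τ≈pow (looseX x y) looseH loose⇒))) ⟩
        (sgn (β x +ℕ β y) * sgn (∣ xs ∣ +ℕ ∣ xp ∣)) * (τ (looseX x y ∧ not looseH) * pow (A ∸ B))
          ≈⟨ solve 4 (λ a b c d → (a :* b) :* (c :* d) := (a :* c) :* (b :* d) :+ :0) refl _ _ _ _ ⟩
        coeff * (sgn (∣ xs ∣ +ℕ ∣ xp ∣) * pow (A ∸ B)) + 0# ∎
        where
        A = cork (c′ x y) (xs ∪ fs) (xp ∪ fp)
        B = cork g′ (hs ∪ fs) (hp ∪ fp)
        B≤A : B ≤ A
        B≤A = ≡.subst₂ (λ s p → cork g′ s p ≤ A) (sub-∪ xs hs fs (Equivalence.from T-≡ e₁)) (sub-∪ xp hp fp (Equivalence.from T-≡ e₂))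
          (cork-antitone (c′ x y) g′ (xs ∪ fs) (hs ∪ fs) (xp ∪ fp) (hp ∪ fp) state⇒)
      whole : sgn (β x +ℕ β y) * value x y ≈ ∑ m (λ xs xp → if subᵇ xs hs ∧ subᵇ xp hp
        then sgn (∣ x ∷ xs ∣ +ℕ ∣ y ∷ xp ∣) * pow ((β (looseX x y) +ℕ cork (c′ x y) (xs ∪ fs) (xp ∪ fp)) ∸ (β looseH +ℕ cork g′ (hs ∪ fs) (hp ∪ fp)))
        else 0#)
      whole = begin
        sgn (β x +ℕ β y) * (τ (looseX x y ∧ not looseH) * charSum (c′ x y) g′ fs fp hs hp)
          ≈⟨ *-assoc _ _ _ ⟨
        coeff * charSum (c′ x y) g′ fs fp hs hp
          ≈⟨ *-congˡ (charSum≈∑ (c′ x y) g′ fs fp hs hp state⇒) ⟩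
        coeff * ∑ m tail
          ≈⟨ trans (+-congˡ (∑-0 m)) (+-identityʳ _) ⟨
        coeff * ∑ m tail + ∑ m (λ _ _ → 0#)
          ≈⟨ ∑-linear m coeff tail (λ _ _ → 0#) ⟨
        ∑ m (λ xs xp → coeff * tail xs xp + 0#)
          ≈⟨ ∑-cong m split ⟨
        _ ∎
    one : ∀ x y → letter h b value x y ≈ ∑ m (λ xs xp → charTerm c g (f ∷ fs) (a ∷ fp) (h ∷ hs) (b ∷ hp) (x ∷ xs) (y ∷ xp))
    one x y with x ⇒ h in e₁ | y ⇒ b in e₂
    ... | false | _     = sym (∑-0 m)
    ... | true  | true  = whole x y (Equivalence.from T-≡ e₁) (Equivalence.from T-≡ e₂)
    ... | true  | false = trans (sym (∑-0 m)) (∑-cong m (λ xs xp → sym (if-∧-false (subᵇ xs hs) _)))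
      where
      if-∧-false : ∀ b z → (if b ∧ false then z else 0#) ≈ 0#
      if-∧-false true  z = refl
      if-∧-false false z = refl

-- Reversal of polynomials and degree bounds.

open import Defs

module Reversal where

  open import Data.Nat using (ℕ; zero; suc; _≤_; _<_; z≤n; s≤s; _∸_; _≤ᵇ_) renaming (_+_ to _+ℕ_; _*_ to _*ℕ_)
  open import Data.Nat.Properties as ℕₚ using (≤-refl; ≤-trans; suc-injective; +-suc)
  open import Data.Integer using (ℤ; +_)
  import Data.Integer as ℤ
  import Data.Integer.Properties as ℤₚ
  open import Data.Bool using (true; false; T)
  open import Data.Unit using (tt)
  open import Data.Empty using (⊥-elim)
  open import Data.Sum using (_⊎_; inj₁; inj₂)
  open import Relation.Nullary using (yes; no)
  open import Relation.Binary.PropositionalEquality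
  open Poly
  private module P = CommutativeRing Poly.commutativeRing
  private module B = Bivariate

  t : Series
  t = up (const (+ 1))

  t-⊛ : ∀ f → t ⊛ f ≋ up f
  t-⊛ f zero    = refl
  t-⊛ f (suc n) = trans (ℤₚ.+-identityˡ _) (⊛-identityˡ f n)

  ⊛-vanish : ∀ k f g → (∀ i j → i +ℕ j ≡ k → f i ≡ + 0 ⊎ g j ≡ + 0) → (f ⊛ g) k ≡ + 0
  ⊛-vanish k f g h with mul0 (h 0 k refl)
    where
    mul0 : ∀ {a b} → a ≡ + 0 ⊎ b ≡ + 0 → a ℤ.* b ≡ + 0
    mul0 (inj₁ refl) = refl
    mul0 {a} (inj₂ refl) = ℤₚ.*-zeroʳ a
  ⊛-vanish zero    f g h | eq = eq
  ⊛-vanish (suc k) f g h | eq =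
    cong₂ ℤ._+_ eq (⊛-vanish k (shift f) g (λ i j e → h (suc i) j (cong suc e)))

  -- A relation instead of the function `rev`: it involves no subtraction, and its symmetry lets a
  -- factor t be added on either side.
  record Reverse (d : ℕ) (f g : Series) : Set where
    field
      above  : ∀ k → d < k → f k ≡ + 0
      above′ : ∀ k → d < k → g k ≡ + 0
      mirror : ∀ i j → i +ℕ j ≡ d → f i ≡ g j
  open Reverse

  Reverse-unique : ∀ {d f f′ g g′} → Reverse d f g → Reverse d f′ g′ → f ≋ f′ → g ≋ g′
  Reverse-unique {d} r r′ eq k with ℕₚ._≤?_ k d
  ... | yes k≤d = trans (sym (mirror r _ k (ℕₚ.m∸n+n≡m k≤d))) (trans (eq _) (mirror r′ _ k (ℕₚ.m∸n+n≡m k≤d)))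
  ... | no k≰d  = trans (above′ r k (ℕₚ.≰⇒> k≰d)) (sym (above′ r′ k (ℕₚ.≰⇒> k≰d)))

  Reverse-cong : ∀ {d f f′ g g′} → f ≋ f′ → g ≋ g′ → Reverse d f g → Reverse d f′ g′
  Reverse-cong p q r = record
    { above  = λ k d<k → trans (sym (p k)) (above r k d<k)
    ; above′ = λ k d<k → trans (sym (q k)) (above′ r k d<k)
    ; mirror = λ i j e → trans (sym (p i)) (trans (mirror r i j e) (q j)) }

  rev-≤ : ∀ {d k} f → k ≤ d → rev d f k ≡ f (d ∸ k)
  rev-≤ {d} {k} f k≤d with k ≤ᵇ d in eq
  ... | true  = refl
  ... | false = ⊥-elim (subst T eq (ℕₚ.≤⇒≤ᵇ k≤d))

  rev-> : ∀ {d k} f → d < k → rev d f k ≡ + 0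
  rev-> {d} {k} f d<k with k ≤ᵇ d in eq
  ... | false = refl
  ... | true  = ⊥-elim (ℕₚ.<⇒≱ d<k (ℕₚ.≤ᵇ⇒≤ k d (subst T (sym eq) tt)))

  Reverse-rev : ∀ {d f} → (∀ k → d < k → f k ≡ + 0) → Reverse d f (rev d f)
  Reverse-rev {d} {f} h = record
    { above = h ; above′ = λ k → rev-> f
    ; mirror = λ { i j refl → trans (cong f (sym (ℕₚ.m+n∸n≡m i j))) (sym (rev-≤ f (ℕₚ.m≤n+m j i))) } }

  Reverse⇒rev : ∀ {d f g} → Reverse d f g → rev d f ≋ g
  Reverse⇒rev r = Reverse-unique (Reverse-rev (above r)) r (λ _ → refl)

  Reverse-const : ∀ c → Reverse 0 (const c) (const c)
  Reverse-const c = record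
    { above = λ { (suc k) _ → refl } ; above′ = λ { (suc k) _ → refl }
    ; mirror = λ { zero zero _ → refl } }

  Reverse-+ : ∀ {d f f′ g g′} → Reverse d f g → Reverse d f′ g′ → Reverse d (f ⊞ f′) (g ⊞ g′)
  Reverse-+ r r′ = record
    { above  = λ k d<k → cong₂ ℤ._+_ (above r k d<k) (above r′ k d<k)
    ; above′ = λ k d<k → cong₂ ℤ._+_ (above′ r k d<k) (above′ r′ k d<k)
    ; mirror = λ i j e → cong₂ ℤ._+_ (mirror r i j e) (mirror r′ i j e) }

  Reverse-scale : ∀ {d f g} c → Reverse d f g → Reverse d (λ i → c ℤ.* f i) (λ i → c ℤ.* g i)
  Reverse-scale c r = record
    { above  = λ k d<k → trans (cong (c ℤ.*_) (above r k d<k)) (ℤₚ.*-zeroʳ c)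
    ; above′ = λ k d<k → trans (cong (c ℤ.*_) (above′ r k d<k)) (ℤₚ.*-zeroʳ c)
    ; mirror = λ i j e → cong (c ℤ.*_) (mirror r i j e) }

  Reverse-upˡ : ∀ {d f g} → Reverse d f g → Reverse (suc d) (up f) g
  Reverse-upˡ {d} r = record
    { above = λ { (suc k) (s≤s d<k) → above r k d<k }
    ; above′ = λ k d<k → above′ r k (ℕₚ.<-trans ≤-refl d<k)
    ; mirror = λ { zero j refl → sym (above′ r j ≤-refl) ; (suc i) j e → mirror r i j (suc-injective e) } }

  Reverse-sym : ∀ {d f g} → Reverse d f g → Reverse d g f
  Reverse-sym r = record
    { above = above′ r ; above′ = above r
    ; mirror = λ i j e → sym (mirror r j i (trans (ℕₚ.+-comm j i) e)) }

  Reverse-upʳ : ∀ {d f g} → Reverse d f g → Reverse (suc d) f (up g)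
  Reverse-upʳ r = Reverse-sym (Reverse-upˡ (Reverse-sym r))

  up^ : ℕ → Series → Series
  up^ zero    f = f
  up^ (suc n) f = up (up^ n f)

  Reverse-up^ : ∀ n {d f g} → Reverse d f g → Reverse (n +ℕ d) f (up^ n g)
  Reverse-up^ zero    r = r
  Reverse-up^ (suc n) r = Reverse-upʳ (Reverse-up^ n r)

  up-⊛ : ∀ f g → up f ⊛ g ≋ up (f ⊛ g)
  up-⊛ f g zero    = refl
  up-⊛ f g (suc n) = ℤₚ.+-identityˡ _

  up^-⊛ : ∀ n f g → up^ n f ⊛ g ≋ up^ n (f ⊛ g)
  up^-⊛ zero    f g k = refl
  up^-⊛ (suc n) f g k = trans (up-⊛ (up^ n f) g k) (up-cong (up^-⊛ n f g) k)

  up^-cong : ∀ n {f g} → f ≋ g → up^ n f ≋ up^ n g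
  up^-cong zero    p = p
  up^-cong (suc n) p = up-cong (up^-cong n p)

  head+shift : ∀ f → f ≋ const (f 0) ⊞ up (shift f)
  head+shift f zero    = sym (ℤₚ.+-identityʳ _)
  head+shift f (suc n) = sym (ℤₚ.+-identityˡ _)

  -- Induction on the degree along x = x 0 + t (shift x): reversing x in degree a + 1 gives x 0
  -- times t^(a+1) plus the tail reversed in degree a.
  Reverse-* : ∀ a {b x x̄ y ȳ} → Reverse a x x̄ → Reverse b y ȳ → Reverse (a +ℕ b) (x ⊛ y) (x̄ ⊛ ȳ)
  Reverse-* zero {x = x} {x̄} {y} {ȳ} r r′ = Reverse-cong
    (λ k → sym (trans (⊛-cong {g = y} x≋ (λ _ → refl) k) (const-⊛ (x 0) y k)))
    (λ k → sym (trans (⊛-cong {g = ȳ} (λ i → sym (x̄≋ i)) (λ _ → refl) k) (const-⊛ (x 0) ȳ k)))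
    (Reverse-scale (x 0) r′)
    where
    x≋ : x ≋ const (x 0)
    x≋ zero    = refl
    x≋ (suc k) = above r (suc k) (s≤s z≤n)
    x̄≋ : const (x 0) ≋ x̄
    x̄≋ = Reverse-unique (Reverse-const (x 0)) r (λ i → sym (x≋ i))
  Reverse-* (suc a) {b} {x} {x̄} {y} {ȳ} r r′ = Reverse-cong
    (λ k → sym (⊛-headˡ x y k))
    (λ k → trans (cong (ℤ._+ (rev a (shift x) ⊛ ȳ) k) (trans (up^-cong (suc a) (λ i → sym (const-⊛ (x 0) ȳ i)) k)
                                        (sym (up^-⊛ (suc a) (const (x 0)) ȳ k))))
           (trans (sym (⊛-distribʳ ȳ _ _ k)) (⊛-cong {g = ȳ} x̄≋ (λ _ → refl) k)))
    (Reverse-+ (Reverse-up^ (suc a) (Reverse-scale (x 0) r′))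
               (Reverse-upˡ (Reverse-* a tail r′)))
    where
    tail : Reverse a (shift x) (rev a (shift x))
    tail = Reverse-rev (λ k a<k → above r (suc k) (s≤s a<k))
    x̄≋ : up^ (suc a) (const (x 0)) ⊞ rev a (shift x) ≋ x̄
    x̄≋ = Reverse-unique
      (Reverse-+ (subst (λ d → Reverse d (const (x 0)) (up^ (suc a) (const (x 0)))) (ℕₚ.+-identityʳ (suc a))
                   (Reverse-up^ (suc a) (Reverse-const (x 0))))
                 (Reverse-upˡ tail))
      r (λ k → sym (head+shift x k))

  -- The weak bound d/2. For m_k it holds with d = k, which is the strict bound (k + 1)/2 for a run
  -- of k + 1 intervals.
  HalfDegree : ℕ → Series → Set
  HalfDegree d f = ∀ k → d < 2 *ℕ k → f k ≡ + 0

  HalfDegree-* : ∀ {a b f g} → HalfDegree a f → HalfDegree b g → HalfDegree (a +ℕ b) (f ⊛ g)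
  HalfDegree-* {a} {b} {f} {g} hf hg k a+b<2k = ⊛-vanish k f g split
    where
    split : ∀ i j → i +ℕ j ≡ k → f i ≡ + 0 ⊎ g j ≡ + 0
    split i j refl with ℕₚ._<?_ a (2 *ℕ i) | ℕₚ._<?_ b (2 *ℕ j)
    ... | yes p | _     = inj₁ (hf i p)
    ... | no _  | yes q = inj₂ (hg j q)
    ... | no p  | no q  = ⊥-elim (ℕₚ.<⇒≱ a+b<2k (subst (_≤ a +ℕ b) (sym (ℕₚ.*-distribˡ-+ 2 i j))
                            (ℕₚ.+-mono-≤ (ℕₚ.≮⇒≥ p) (ℕₚ.≮⇒≥ q))))

  record HalfReverse (d : ℕ) (f g : Series) : Set where
    constructor _,_
    field
      reverse : Reverse d f g
      halfDegree : HalfDegree d f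
  open HalfReverse

  HalfReverse-degree : ∀ {d e f g} → d ≡ e → HalfReverse d f g → HalfReverse e f g
  HalfReverse-degree refl p = p

  HalfReverse-cong : ∀ {d f f′ g g′} → f ≋ f′ → g ≋ g′ → HalfReverse d f g → HalfReverse d f′ g′
  HalfReverse-cong p q (r , h) = Reverse-cong p q r , λ k d<k → trans (sym (p k)) (h k d<k)

  HalfReverse-1 : HalfReverse 0 (const (+ 1)) (const (+ 1))
  HalfReverse-1 = Reverse-const (+ 1) , λ { (suc k) _ → refl }

  HalfReverse-+ : ∀ {d f f′ g g′} → HalfReverse d f g → HalfReverse d f′ g′ → HalfReverse d (f ⊞ f′) (g ⊞ g′)
  HalfReverse-+ (r , h) (r′ , h′) = Reverse-+ r r′ , λ k d<k → cong₂ ℤ._+_ (h k d<k) (h′ k d<k)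

  HalfReverse-* : ∀ {a b f f′ g g′} → HalfReverse a f g → HalfReverse b f′ g′ → HalfReverse (a +ℕ b) (f ⊛ f′) (g ⊛ g′)
  HalfReverse-* {a} {b} (r , h) (r′ , h′) = Reverse-* a r r′ , HalfDegree-* {a} {b} h h′

  HalfReverse-tʳ : ∀ {d f g} → HalfReverse d f g → HalfReverse (suc d) f (t ⊛ g)
  HalfReverse-tʳ {g = g} (r , h) =
    Reverse-cong (λ _ → refl) (λ k → sym (t-⊛ g k)) (Reverse-upʳ r)
    , λ k d<k → h k (ℕₚ.<-trans ≤-refl d<k)

  -- A factor t on both sides costs two degrees, exactly those supplied by u² in the quadratic term.
  HalfReverse-t : ∀ {d f g} → HalfReverse d f g → HalfReverse (suc (suc d)) (t ⊛ f) (t ⊛ g)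
  HalfReverse-t {d} {f} {g} (r , h) =
    Reverse-cong (λ k → sym (t-⊛ f k)) (λ k → sym (t-⊛ g k)) (Reverse-upʳ (Reverse-upˡ r))
    , λ { zero () ; (suc k) d<k → trans (t-⊛ f (suc k))
            (h k (ℕₚ.≤-pred (ℕₚ.≤-pred (subst (suc (suc d) <_) (ℕₚ.*-suc 2 k) d<k)))) }

  -- The offset d lets the induction follow `⊛`, which shifts its first factor.
  HalfReverse-conv : ∀ n d {A A′ B B′} → (∀ i → i ≤ n → HalfReverse (d +ℕ i) (A i) (A′ i)) →
    (∀ i → i ≤ n → HalfReverse i (B i) (B′ i)) → HalfReverse (d +ℕ n) ((A B.⊛ B) n) ((A′ B.⊛ B′) n)
  HalfReverse-conv zero d p q = HalfReverse-degree (ℕₚ.+-identityʳ (d +ℕ 0)) (HalfReverse-* (p 0 z≤n) (q 0 z≤n))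
  HalfReverse-conv (suc n) d {A} {A′} p q = HalfReverse-+
    (HalfReverse-degree (cong (_+ℕ suc n) (ℕₚ.+-identityʳ d)) (HalfReverse-* (p 0 z≤n) (q (suc n) ≤-refl)))
    (HalfReverse-degree (sym (+-suc d n))
      (HalfReverse-conv n (suc d) (λ i i≤n → HalfReverse-degree (+-suc d i) (p (suc i) (s≤s i≤n)))
                            (λ i i≤n → q i (ℕₚ.m≤n⇒m≤1+n i≤n))))

  open Motzkin Poly.commutativeRing ℤ⟶Poly t public

  -- The recursions of the two sequences correspond term by term: the linear term gains t only after
  -- reversal, the quadratic one has t on both sides. The bound n is the measure of the recursion.
  motzkin-reverse : ∀ n i → i ≤ n → HalfReverse i (motzkin i) (reversed i)
  motzkin-reverse n zero _ = HalfReverse-1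
  motzkin-reverse (suc n) (suc i) (s≤s i≤n) = HalfReverse-cong
    (P.sym {motzkin (suc i)} (motzkin-suc i)) (P.sym {reversed (suc i)} (reversed-suc i))
    (HalfReverse-+ (HalfReverse-tʳ (motzkin-reverse n i i≤n)) (quad i i≤n))
    where
    quad : ∀ i → i ≤ n → HalfReverse (suc i) (t ⊛ B.up (motzkin B.⊛ motzkin) i) (t ⊛ B.up (reversed B.⊛ reversed) i)
    quad zero    _   = HalfReverse-cong {f = 𝟘} {g = 𝟘} (P.sym {t ⊛ 𝟘} (P.zeroʳ t)) (P.sym {t ⊛ 𝟘} (P.zeroʳ t))
      (record { above = λ _ _ → refl ; above′ = λ _ _ → refl ; mirror = λ _ _ _ → refl } , λ _ _ → refl)
    quad (suc i) i<n = HalfReverse-t (HalfReverse-conv i 0 below below)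
      where below = λ j j≤i → motzkin-reverse n j (≤-trans j≤i (≤-trans (ℕₚ.n≤1+n i) i<n))

  -- The conditions on the Kazhdan–Lusztig polynomial f of a matroid of rank d.
  Admissible : ℕ → Series → Set
  Admissible zero    f = f ≋ const (+ 1)
  Admissible (suc d) f = HalfDegree d f

  Admissible-* : ∀ a b {f g} → Admissible a f → Admissible b g → Admissible (a +ℕ b) (f ⊛ g)
  Admissible-* zero zero {f} {g} p q = P.trans {f ⊛ g} (⊛-cong p q) (⊛-identityˡ (const (+ 1)))
  Admissible-* zero (suc b) {f} {g} p q k b<k = trans (trans (⊛-cong {g = g} p (λ _ → refl) k) (⊛-identityˡ g k)) (q k b<k)
  Admissible-* (suc a) zero {f} {g} p q k a<k = trans
    (trans (⊛-cong {f} (λ _ → refl) q k) (P.*-identityʳ f k)) (p k (subst (_< 2 *ℕ k) (ℕₚ.+-identityʳ a) a<k))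
  Admissible-* (suc a) (suc b) p q k a<k = HalfDegree-* {a} {b} p q k (≤-trans (s≤s (ℕₚ.+-monoʳ-≤ a (ℕₚ.n≤1+n b))) a<k)

  fanPoly-admissible : ∀ k → Admissible k (fanPoly k)
  fanPoly-admissible zero    = λ _ → refl
  fanPoly-admissible (suc k) = halfDegree (motzkin-reverse k k ≤-refl)

  fanPoly-reverse : ∀ k → Reverse k (fanPoly k) (fanPolyRev k)
  fanPoly-reverse zero    = Reverse-const (+ 1)
  fanPoly-reverse (suc k) = reverse (HalfReverse-tʳ (motzkin-reverse k k ≤-refl))

-- The generating function and the square root.

module GeneratingFunction where

  open import Data.Nat using (ℕ; zero; suc; s≤s; _∸_)
  open import Data.Nat.Properties as ℕₚ using (≤-refl; ≤-trans; m≤n⇒m<n∨m≡n)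
  open import Data.Integer using (ℤ; +_)
  import Data.Integer as ℤ
  import Data.Integer.Properties as ℤₚ
  open import Data.List using (List; []; _∷_; map; upTo; applyUpTo)
  open import Data.List.Properties using (map-applyUpTo)
  open import Data.Product using (_,_)
  open import Data.Sum using (inj₁; inj₂)
  open import Function using (id; _∘_)
  open import Relation.Binary.PropositionalEquality as ≡ using (_≡_; cong; cong₂)
  open Reversal using (t; t-⊛; motzkin; motzkin-suc; motzkin-reverse; fanPoly; module HalfReverse)
  private module P = Poly
  open Bivariate
  open CommutativeRing Bivariate.commutativeRing
  open ℤ-Solver Bivariate.commutativeRing ℤ⟶Bivariate using (solve; _:=_; _:+_; _:*_; _:-_; :1) renaming (con to :con)
  open import Relation.Binary.Reasoning.Setoid setoid

  *ₚ≡⊛ : ∀ f g k → (f *ₚ g) k ≡ (f P.⊛ g) k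
  *ₚ≡⊛ f g k = ≡.trans (cong sumℤ (map-applyUpTo id (λ i → f i ℤ.* g (k ∸ i)) (suc k))) (unfold f g k)
    where
    unfold : ∀ f g k → sumℤ (applyUpTo (λ i → f i ℤ.* g (k ∸ i)) (suc k)) ≡ (f P.⊛ g) k
    unfold f g zero    = ℤₚ.+-identityʳ _
    unfold f g (suc k) = cong (λ z → f 0 ℤ.* g (suc k) ℤ.+ z) (unfold (f ∘ suc) g k)

  sumₚ-at : {A : Set} (xs : List A) (f : A → Coeffs) (k : ℕ) → sumₚ xs f k ≡ sumℤ (map (λ x → f x k) xs)
  sumₚ-at []       f k = ≡.refl
  sumₚ-at (x ∷ xs) f k = cong (λ z → f x k ℤ.+ z) (sumₚ-at xs f k)

  *ₛ≈⊛ : ∀ A B → A *ₛ B ≈ A ⊛ B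
  *ₛ≈⊛ A B n k = ≡.trans (sumₚ-at (upTo (suc n)) (λ i → A i *ₚ B (n ∸ i)) k)
    (≡.trans (cong sumℤ (map-applyUpTo id (λ i → (A i *ₚ B (n ∸ i)) k) (suc n))) (unfold A B n))
    where
    unfold : ∀ A B n → sumℤ (applyUpTo (λ i → (A i *ₚ B (n ∸ i)) k) (suc n)) ≡ (A ⊛ B) n k
    unfold A B zero    = ≡.trans (ℤₚ.+-identityʳ _) (*ₚ≡⊛ (A 0) (B 0) k)
    unfold A B (suc n) = cong₂ ℤ._+_ (*ₚ≡⊛ (A 0) (B (suc n)) k) (unfold (A ∘ suc) B n)

  -- `root` comes from the quadratic formula m = (1 - u - S) / (2 t u²), solved for S.
  T U 𝟚 𝟜 M root : Ser
  T = const t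
  U = up 1#
  𝟚 = const (P.const (+ 2))
  𝟜 = const (P.const (+ 4))
  M = motzkin
  root = 1# - U - 𝟚 * (T * (U * (U * M)))

  constₛ≈ : ∀ c → constₛ c ≈ const (P.const c)
  constₛ≈ c zero    zero    = ≡.refl
  constₛ≈ c zero    (suc k) = ≡.refl
  constₛ≈ c (suc n) k       = ≡.refl

  uₛ≈ : uₛ ≈ U
  uₛ≈ zero          k       = ≡.refl
  uₛ≈ (suc zero)    zero    = ≡.refl
  uₛ≈ (suc zero)    (suc k) = ≡.refl
  uₛ≈ (suc (suc n)) k       = ≡.refl

  tₛ≈ : tₛ ≈ T
  tₛ≈ zero    zero          = ≡.refl
  tₛ≈ zero    (suc zero)    = ≡.refl
  tₛ≈ zero    (suc (suc k)) = ≡.refl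
  tₛ≈ (suc n) k             = ≡.refl

  U-⊛ : ∀ f → U * f ≈ up f
  U-⊛ f zero    = CommutativeRing.zeroˡ P.commutativeRing (f 0)
  U-⊛ f (suc n) k = ≡.trans (cong₂ ℤ._+_ (CommutativeRing.zeroˡ P.commutativeRing (f (suc n)) k) (⊛-identityˡ f n k))
    (ℤₚ.+-identityˡ _)

  M-quadratic : M ≈ 1# + U * M + T * (U * (U * (M * M)))
  M-quadratic = trans {M} unfold (+-cong (+-congˡ {1#} (sym {U * M} (U-⊛ M)))
    (*-congˡ {T} (sym {U * (U * (M * M))} (trans {U * (U * (M * M))} (*-congˡ {U} (U-⊛ (M * M))) (U-⊛ _)))))
    where
    unfold : M ≈ 1# + up M + T * up (up (M * M))
    unfold zero k = ≡.sym (≡.trans (cong₂ ℤ._+_ (ℤₚ.+-identityʳ (P.const (+ 1) k))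
      (CommutativeRing.zeroʳ P.commutativeRing t k)) (ℤₚ.+-identityʳ (P.const (+ 1) k)))
    unfold (suc n) k = ≡.trans (motzkin-suc n k) (cong₂ ℤ._+_ (≡.sym (ℤₚ.+-identityˡ (motzkin n k)))
      (≡.sym (const-⊛ t (up (up (M * M))) (suc n) k)))

  discr≈ : discr ≈ (U - 1#) * (U - 1#) - 𝟜 * T * U * U
  discr≈ = +-cong
    (trans {(uₛ -ₛ 1ₛ) *ₛ (uₛ -ₛ 1ₛ)} (*ₛ≈⊛ _ _) (*-cong u-1 u-1))
    (-‿cong (mul (mul (mul (constₛ≈ (+ 4)) tₛ≈) uₛ≈) uₛ≈))
    where
    u-1 : uₛ -ₛ 1ₛ ≈ U - 1#
    u-1 = +-cong uₛ≈ (-‿cong (constₛ≈ (+ 1)))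
    mul : ∀ {A A′ B B′} → A ≈ A′ → B ≈ B′ → A *ₛ B ≈ A′ * B′
    mul {A} {B = B} p q = trans {A *ₛ B} (*ₛ≈⊛ A B) (*-cong p q)

  root² : root * root ≈ (U - 1#) * (U - 1#) - 𝟜 * T * U * U
  root² = begin
    root * root
      -- Here q is the right-hand side of the quadratic equation: in free variables the two sides
      -- differ by a multiple of q - m.
      ≈⟨ solve 3 (λ u τ m → let q = :1 :+ u :* m :+ τ :* (u :* (u :* (m :* m)))
                                r = :1 :- u :- :con (+ 2) :* (τ :* (u :* (u :* m))) in
           r :* r := (u :- :1) :* (u :- :1) :- :con (+ 4) :* τ :* u :* u
                     :+ :con (+ 4) :* τ :* u :* u :* (q :- m)) refl U T M ⟩
    (U - 1#) * (U - 1#) - 𝟜 * T * U * U + 𝟜 * T * U * U * (1# + U * M + T * (U * (U * (M * M))) - M)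
      ≈⟨ +-congˡ {(U - 1#) * (U - 1#) - 𝟜 * T * U * U} (*-congˡ {𝟜 * T * U * U} (+-congʳ {x = - M} (sym M-quadratic))) ⟩
    (U - 1#) * (U - 1#) - 𝟜 * T * U * U + 𝟜 * T * U * U * (M - M)
      ≈⟨ solve 3 (λ x y m → x :+ y :* (m :- m) := x) refl ((U - 1#) * (U - 1#) - 𝟜 * T * U * U) (𝟜 * T * U * U) M ⟩
    (U - 1#) * (U - 1#) - 𝟜 * T * U * U ∎

  root-quotient : U * M * (1# - U + root) ≈ 𝟚 * U
  root-quotient = begin
    U * M * (1# - U + root)
      ≈⟨ solve 3 (λ u τ m → let q = :1 :+ u :* m :+ τ :* (u :* (u :* (m :* m)))
                                r = :1 :- u :- :con (+ 2) :* (τ :* (u :* (u :* m))) in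
           u :* m :* (:1 :- u :+ r) := :con (+ 2) :* u :+ :con (+ 2) :* u :* (m :- q)) refl U T M ⟩
    𝟚 * U + 𝟚 * U * (M - (1# + U * M + T * (U * (U * (M * M)))))
      ≈⟨ +-congˡ {𝟚 * U} (*-congˡ {𝟚 * U} (+-congˡ {M} (-‿cong (sym M-quadratic)))) ⟩
    𝟚 * U + 𝟚 * U * (M - M)
      ≈⟨ solve 2 (λ x m → x :+ x :* (m :- m) := x) refl (𝟚 * U) M ⟩
    𝟚 * U ∎

  2-cancel : ∀ z → z ℤ.* + 2 ≡ + 0 → z ≡ + 0
  2-cancel z eq with ℤₚ.i*j≡0⇒i≡0∨j≡0 z eq
  ... | inj₁ z≡0 = z≡0

  -- The lowest coefficient of D that is not yet known to vanish appears in D * E multiplied by 2,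
  -- and 2 is no zero divisor.
  ⊛-cancel : ∀ D E → (∀ k → E 0 k ≡ P.const (+ 2) k) → D * E ≈ 0# → D ≈ 0#
  ⊛-cancel D E E₀ DE n = below (suc n) n ≤-refl
    where
    at : ∀ n → D ≋[ n ] 𝟘 → ∀ k → D n k ≡ + 0
    at n low k = 2-cancel (D n k) (≡.trans (ℤₚ.*-comm (D n k) (+ 2)) (≡.trans
      (≡.sym (P.const-⊛ (+ 2) (D n) k))
      (≡.trans (P.⊛-comm (P.const (+ 2)) (D n) k)
      (≡.trans (P.⊛-cong {D n} (λ _ → ≡.refl) (λ i → ≡.sym (E₀ i)) k)
      (≡.trans (≡.sym (≡.trans (⊛-headʳ D E n k) (≡.trans (cong (λ z → (D n P.⊛ E 0) k ℤ.+ z) (rest k)) (ℤₚ.+-identityʳ _))))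
      (DE n k))))))
      where
      rest : ∀ k → up (D ⊛ shift E) n k ≡ + 0
      rest k = ≡.trans (up-⊛-local n {g = shift E} low (λ _ _ _ → ≡.refl) k)
        (≡.trans (up-cong (zeroˡ (shift E)) n k) (up𝟘 n))
        where
        up𝟘 : ∀ n → up 𝟘 n k ≡ + 0
        up𝟘 zero    = ≡.refl
        up𝟘 (suc n) = ≡.refl
    below : ∀ n → D ≋[ n ] 𝟘
    below (suc n) i (s≤s i≤n) with m≤n⇒m<n∨m≡n i≤n
    ... | inj₁ i<n    = below n i i<n
    ... | inj₂ ≡.refl = at n (below n)

  root₀ : ∀ k → root 0 k ≡ P.const (+ 1) k
  root₀ k = ≡.trans (cong (λ z → P.const (+ 1) k ℤ.+ + 0 ℤ.+ ℤ.- z) vanish)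
    (≡.trans (ℤₚ.+-identityʳ _) (ℤₚ.+-identityʳ _))
    where
    vanish : (𝟚 * (T * (U * (U * M)))) 0 k ≡ + 0
    vanish = ≡.trans (*-congˡ {𝟚} (*-congˡ {T} (U-⊛ (U * M))) 0 k)
      (≡.trans (P.⊛-cong {P.const (+ 2)} (λ _ → ≡.refl) (CommutativeRing.zeroʳ P.commutativeRing t) k)
        (CommutativeRing.zeroʳ P.commutativeRing (P.const (+ 2)) k))

  -- (S - root)(S + root) = 0, and the normalisation of S gives S + root the constant term 2.
  sqrt-unique : ∀ S → IsSqrtDiscr S → S ≈ root
  sqrt-unique S (_ , S₀ , S²) = begin
    S                 ≈⟨ solve 2 (λ s r → s := (s :- r) :+ r) refl S root ⟩
    (S - root) + root ≈⟨ +-congʳ {root} (⊛-cancel (S - root) (S + root) const2 product) ⟩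
    0# + root         ≈⟨ +-identityˡ root ⟩
    root              ∎
    where
    δ₀≡ : ∀ k → δ₀ k ≡ P.const (+ 1) k
    δ₀≡ zero    = ≡.refl
    δ₀≡ (suc k) = ≡.refl
    const2 : ∀ k → (S + root) 0 k ≡ P.const (+ 2) k
    const2 k = ≡.trans (cong₂ ℤ._+_ (≡.trans (S₀ k) (δ₀≡ k)) (root₀ k)) (≡.sym (P.const-+ (+ 1) (+ 1) k))
    product : (S - root) * (S + root) ≈ 0#
    product = begin
      (S - root) * (S + root)  ≈⟨ solve 2 (λ s r → (s :- r) :* (s :+ r) := s :* s :- r :* r) refl S root ⟩
      S * S - root * root      ≈⟨ +-cong {S * S} {discr} (trans {S * S} (sym {S *ₛ S} (*ₛ≈⊛ S S)) S²)
                                   (-‿cong (trans {root * root} root² (sym {discr} discr≈))) ⟩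
      discr - discr            ≈⟨ -‿inverseʳ discr ⟩
      0#                       ∎

  fanRHS : ∀ S A → S ≈ root → A ≈ fanPoly → IsFanRHS S A
  fanRHS S A S≈ A≈ = begin
    (A -ₛ 1ₛ) *ₛ (1ₛ -ₛ uₛ +ₛ S)  ≈⟨ *ₛ≈⊛ (A -ₛ 1ₛ) (1ₛ -ₛ uₛ +ₛ S) ⟩
    (A -ₛ 1ₛ) * (1ₛ -ₛ uₛ +ₛ S)
      ≈⟨ *-cong {A -ₛ 1ₛ} {U * M} A-1 (+-cong (+-cong (constₛ≈ (+ 1)) (-‿cong uₛ≈)) S≈) ⟩
    U * M * (1# - U + root)       ≈⟨ root-quotient ⟩
    𝟚 * U                         ≈⟨ *-cong {constₛ (+ 2)} (constₛ≈ (+ 2)) uₛ≈ ⟨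
    constₛ (+ 2) * uₛ             ≈⟨ *ₛ≈⊛ (constₛ (+ 2)) uₛ ⟨
    constₛ (+ 2) *ₛ uₛ            ∎
    where
    M-1 : fanPoly - 1# ≈ up M
    M-1 zero    k = ℤₚ.+-inverseʳ (P.const (+ 1) k)
    M-1 (suc n) k = ℤₚ.+-identityʳ _
    A-1 : A -ₛ 1ₛ ≈ U * M
    A-1 = begin
      A -ₛ 1ₛ      ≈⟨ +-cong A≈ (-‿cong (constₛ≈ (+ 1))) ⟩
      fanPoly - 1# ≈⟨ M-1 ⟩
      up M         ≈⟨ U-⊛ M ⟨
      U * M        ∎

  -- The coefficients of `root` in explicit form, from which it is plain that they are polynomials
  -- in t.
  sqrt : Ser
  sqrt zero          = P.const (+ 1)
  sqrt (suc zero)    k = ℤ.- P.const (+ 1) k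
  sqrt (suc (suc n)) k = ℤ.- (+ 2 ℤ.* P.up (motzkin n) k)

  sqrt≈root : sqrt ≈ root
  sqrt≈root = trans {sqrt} (sym {sqrt₁} coeff) (+-congˡ {1# - U} (-‿cong (*-congˡ {𝟚} (*-congˡ {T}
      (sym {U * (U * M)} (trans {U * (U * M)} (*-congˡ {U} (U-⊛ M)) (U-⊛ (up M))))))))
    where
    sqrt₁ : Ser
    sqrt₁ = 1# - U - 𝟚 * (T * up (up M))
    inner : ∀ n k → (𝟚 * (T * up (up M))) n k ≡ + 2 ℤ.* P.up (up (up M) n) k
    inner n k = ≡.trans (const-⊛ (P.const (+ 2)) (T * up (up M)) n k)
      (≡.trans (P.const-⊛ (+ 2) _ k) (cong (+ 2 ℤ.*_)
        (≡.trans (const-⊛ t (up (up M)) n k) (t-⊛ _ k))))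
    up0 : ∀ k → P.up P.𝟘 k ≡ + 0
    up0 zero    = ≡.refl
    up0 (suc k) = ≡.refl
    coeff : sqrt₁ ≈ sqrt
    coeff zero k = ≡.trans (cong (λ z → P.const (+ 1) k ℤ.+ + 0 ℤ.+ ℤ.- z)
      (≡.trans (inner 0 k) (cong (+ 2 ℤ.*_) (up0 k))))
      (≡.trans (ℤₚ.+-identityʳ _) (ℤₚ.+-identityʳ _))
    coeff (suc zero) k = ≡.trans (cong (λ z → + 0 ℤ.+ ℤ.- P.const (+ 1) k ℤ.+ ℤ.- z)
      (≡.trans (inner 1 k) (cong (+ 2 ℤ.*_) (up0 k))))
      (≡.trans (ℤₚ.+-identityʳ _) (ℤₚ.+-identityˡ _))
    coeff (suc (suc n)) k = ≡.trans (cong (λ z → + 0 ℤ.+ + 0 ℤ.+ ℤ.- z) (inner (suc (suc n)) k)) (ℤₚ.+-identityˡ _)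

  sqrt-poly : IsPolySer sqrt
  sqrt-poly zero          = 1 , λ { (suc k) _ → ≡.refl }
  sqrt-poly (suc zero)    = 1 , λ { (suc k) _ → ≡.refl }
  sqrt-poly (suc (suc n)) = suc (suc n) , λ { (suc k) (s≤s n<k) → cong (λ z → ℤ.- (+ 2 ℤ.* z))
    (HalfReverse.halfDegree (motzkin-reverse n n ≤-refl) k (≤-trans n<k (ℕₚ.m≤m+n k _))) }

  sqrt-isSqrt : IsSqrtDiscr sqrt
  sqrt-isSqrt = sqrt-poly , (λ { zero → ≡.refl ; (suc k) → ≡.refl }) , (begin
    sqrt *ₛ sqrt   ≈⟨ *ₛ≈⊛ sqrt sqrt ⟩
    sqrt * sqrt    ≈⟨ *-cong {sqrt} sqrt≈root sqrt≈root ⟩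
    root * root    ≈⟨ root² ⟩
    (U - 1#) * (U - 1#) - 𝟜 * T * U * U ≈⟨ discr≈ ⟨
    discr          ∎)

-- Flats, contractions and uniqueness of Kazhdan-Lusztig polynomials.

module KazhdanLusztig where

  open import Algebra.Bundles using (CommutativeMonoid)
  open import Algebra.Properties.CommutativeSemigroup using (interchange)
  open import Data.Nat using (ℕ; zero; suc; _≤_; _<_; z≤n; s≤s; _∸_; _<ᵇ_; _≡ᵇ_) renaming (_+_ to _+ℕ_; _*_ to _*ℕ_)
  open import Data.Nat.Properties as ℕₚ using (≤-refl; ≤-trans)
  open import Data.Integer using (ℤ; +_)
  import Data.Integer as ℤ
  open import Data.Bool using (Bool; true; false; if_then_else_; not; _∧_; _∨_)
  open import Data.Bool.Properties using (T-≡)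
  open import Data.Bool.ListAction using (all)
  open import Data.Fin using (Fin; zero; suc)
  open import Data.Fin.Subset using (Subset; _⊆_; _∈_; _∉_; _∪_; _∩_; _─_; ⁅_⁆; ∣_∣; ⊥; inside; outside)
  open import Data.Fin.Subset.Properties
  open import Data.Vec using (lookup)
  import Data.Vec as Vec
  open import Data.Vec.Properties using ([]=⇒lookup; lookup⇒[]=)
  open import Data.List using (List; []; _∷_; tabulate; allFin)
  open import Data.Product using (_,_; proj₁; proj₂)
  open import Data.Sum using (inj₁; inj₂; [_,_]′)
  open import Data.Empty using (⊥-elim)
  open import Function using (id; _∘_; Equivalence)
  open import Relation.Nullary using (yes; no)
  open import Relation.Binary.PropositionalEquality
  open Reversal using (Admissible; ⊛-vanish; rev-≤)
  open GeneratingFunction using (*ₚ≡⊛)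
  private module P = Poly

  all-sound : ∀ {n} {A : Set} (p : A → Bool) (g : Fin n → A) → all p (tabulate g) ≡ true → ∀ i → p (g i) ≡ true
  all-sound p g h zero    with p (g zero) | h
  ... | true | _ = refl
  all-sound p g h (suc i) with p (g zero) | h
  ... | true | h′ = all-sound p (g ∘ suc) h′ i

  all-complete : ∀ {n} {A : Set} (p : A → Bool) (g : Fin n → A) → (∀ i → p (g i) ≡ true) → all p (tabulate g) ≡ true
  all-complete {zero}  p g h = refl
  all-complete {suc n} p g h rewrite h zero = all-complete p (g ∘ suc) (h ∘ suc)

  ∉⇒false : ∀ {n} {e : Fin n} {X} → e ∉ X → lookup X e ≡ false
  ∉⇒false {e = e} {X} e∉X with lookup X e in eq
  ... | false = refl
  ... | true  = ⊥-elim (e∉X (lookup⇒[]= e X eq))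

  false⇒∉ : ∀ {n} {e : Fin n} {X} → lookup X e ≡ false → e ∉ X
  false⇒∉ eq e∈X with trans (sym eq) ([]=⇒lookup e∈X)
  ... | ()

  ⊆ᵇ-sound : ∀ {n} {X Y : Subset n} → X ⊆ᵇ Y ≡ true → X ⊆ Y
  ⊆ᵇ-sound {X = X} {Y} h {e} e∈X = lookup⇒[]= e Y
    (subst (λ b → not b ∨ lookup Y e ≡ true) ([]=⇒lookup e∈X) (all-sound _ id h e))

  ⊆ᵇ-complete : ∀ {n} {X Y : Subset n} → X ⊆ Y → X ⊆ᵇ Y ≡ true
  ⊆ᵇ-complete {X = X} {Y} X⊆Y = all-complete _ id member
    where
    member : ∀ e → not (lookup X e) ∨ lookup Y e ≡ true
    member e with lookup X e in eq
    ... | false = refl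
    ... | true  = []=⇒lookup (X⊆Y (lookup⇒[]= e X eq))

  record Flat (M : MatroidData) (F : Subset (N M)) : Set where
    field
      ⊆E     : F ⊆ E M
      closed : ∀ e → e ∈ E M → e ∉ F → rk M F < rk M (F ∪ ⁅ e ⁆)
  open Flat

  <ᵇ-sound : ∀ {m n} → (m <ᵇ n) ≡ true → m < n
  <ᵇ-sound {m} {n} h = ℕₚ.<ᵇ⇒< m n (Equivalence.from T-≡ h)

  <ᵇ-complete : ∀ {m n} → m < n → (m <ᵇ n) ≡ true
  <ᵇ-complete h = Equivalence.to T-≡ (ℕₚ.<⇒<ᵇ h)

  isFlat-sound : ∀ M F → isFlat M F ≡ true → Flat M F
  isFlat-sound M F h with F ⊆ᵇ E M in eq | h
  ... | true | h′ = record { ⊆E = ⊆ᵇ-sound eq ; closed = λ e e∈E e∉F → <ᵇ-sound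
    (subst₂ (λ a b → (if a ∧ not b then rk M F <ᵇ rk M (F ∪ ⁅ e ⁆) else true) ≡ true)
      ([]=⇒lookup e∈E) (∉⇒false e∉F) (all-sound _ id h′ e)) }

  isFlat-complete : ∀ M F → Flat M F → isFlat M F ≡ true
  isFlat-complete M F fl rewrite ⊆ᵇ-complete {X = F} {E M} (⊆E fl) = all-complete _ id member
    where
    member : ∀ e → (if (e ∈ᵇ E M) ∧ not (e ∈ᵇ F) then rk M F <ᵇ rk M (F ∪ ⁅ e ⁆) else true) ≡ true
    member e with lookup (E M) e in eqE | lookup F e in eqF
    ... | false | _     = refl
    ... | true  | true  = refl
    ... | true  | false = <ᵇ-complete (closed fl e (lookup⇒[]= e _ eqE) (false⇒∉ eqF))

  ∪-⊆ : ∀ {n} {X Y Z : Subset n} → X ⊆ Z → Y ⊆ Z → X ∪ Y ⊆ Z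
  ∪-⊆ {X = X} {Y} X⊆Z Y⊆Z = [ X⊆Z , Y⊆Z ]′ ∘ x∈p∪q⁻ X Y

  ∈─⇒∉ : ∀ {n} {e : Fin n} (X Y : Subset n) → e ∈ X ─ Y → e ∉ Y
  ∈─⇒∉ (_ Vec.∷ X) (outside Vec.∷ Y) (Vec.there p) (Vec.there q) = ∈─⇒∉ X Y p q
  ∈─⇒∉ (_ Vec.∷ X) (inside Vec.∷ Y) (Vec.there p) (Vec.there q) = ∈─⇒∉ X Y p q

  ─∪-cancel : ∀ {n} {X F : Subset n} → F ⊆ X → (X ─ F) ∪ F ≡ X
  ─∪-cancel {X = Vec.[]}    {Vec.[]}    _ = refl
  ─∪-cancel {X = x Vec.∷ X} {outside Vec.∷ F} s = cong₂ Vec._∷_ (Data.Bool.Properties.∨-identityʳ x) (─∪-cancel (drop-∷-⊆ s))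
    where import Data.Bool.Properties
  ─∪-cancel {X = x Vec.∷ X} {inside Vec.∷ F} s with s Vec.here
  ... | Vec.here = cong (inside Vec.∷_) (─∪-cancel (drop-∷-⊆ s))

  infix 4 _≐_
  -- `P` is an arbitrary function of matroid data, so its values at an iterated contraction and at
  -- the contraction by the union are not equal a priori; the induction has to cover all data with
  -- the same ranks.
  data _≐_ : MatroidData → MatroidData → Set where
    same : ∀ {N} {E E′ : Subset N} {rk rk′} → E ≡ E′ → (∀ X → rk X ≡ rk′ X) → mkM N E rk ≐ mkM N E′ rk′

  con-≐ : ∀ {N} {E : Subset N} {rk rk′} → (∀ X → rk X ≡ rk′ X) → ∀ H → con (mkM N E rk) H ≐ con (mkM N E rk′) H
  con-≐ eq H = same refl (λ X → cong₂ _∸_ (eq (X ∪ H)) (eq H))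

  ≐-trans : ∀ {A B C} → A ≐ B → B ≐ C → A ≐ C
  ≐-trans (same refl p) (same refl q) = same refl (λ X → trans (p X) (q X))

  ≐-isMatroid : ∀ {A B} → A ≐ B → IsMatroid B → IsMatroid A
  ≐-isMatroid (same refl p) m = record
    { R1 = λ X s → subst (_≤ ∣ X ∣) (sym (p X)) (R1 X s)
    ; R2 = λ X Y s s′ → subst₂ _≤_ (sym (p X)) (sym (p Y)) (R2 X Y s s′)
    ; R3 = λ X Y s s′ → subst₂ _≤_ (sym (cong₂ _+ℕ_ (p (X ∪ Y)) (p (X ∩ Y)))) (sym (cong₂ _+ℕ_ (p X) (p Y))) (R3 X Y s s′) }
    where open IsMatroid m

  ≐-loopless : ∀ {A B} → A ≐ B → Loopless B → Loopless A
  ≐-loopless (same refl p) l e e∈E = trans (p ⁅ e ⁆) (l e e∈E)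

  ≐-rank : ∀ {A B} → A ≐ B → rank A ≡ rank B
  ≐-rank (same refl p) = p _

  sumₚ-cong : {A : Set} (xs : List A) (f g : A → Coeffs) (k : ℕ) → (∀ x → f x k ≡ g x k) → sumₚ xs f k ≡ sumₚ xs g k
  sumₚ-cong []       f g k h = refl
  sumₚ-cong (x ∷ xs) f g k h = cong₂ ℤ._+_ (h x) (sumₚ-cong xs f g k h)

  sumₚ-0 : {A : Set} (xs : List A) (f : A → Coeffs) (k : ℕ) → (∀ x → f x k ≡ + 0) → sumₚ xs f k ≡ + 0
  sumₚ-0 []       f k h = refl
  sumₚ-0 (x ∷ xs) f k h = cong₂ ℤ._+_ (h x) (sumₚ-0 xs f k h)

  χ-term : (M : MatroidData) → Subset (N M) → Coeffs
  χ-term M X = if X ⊆ᵇ E M then (λ k → if (rank M ∸ rk M X) ≡ᵇ k then sign ∣ X ∣ else + 0) else 0ₚ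

  KL-term : (M : MatroidData) → (Subset (N M) → Coeffs) → Subset (N M) → Coeffs
  KL-term M f H = if isFlat M H then χ (loc M H) *ₚ f H else 0ₚ

  all-cong : {A : Set} {p q : A → Bool} (xs : List A) → (∀ x → p x ≡ q x) → all p xs ≡ all q xs
  all-cong []       h = refl
  all-cong (x ∷ xs) h = cong₂ _∧_ (h x) (all-cong xs h)

  module _ {N : ℕ} {E : Subset N} {rk rk′ : Subset N → ℕ} (eq : ∀ X → rk X ≡ rk′ X) where

    isFlat-≐ : ∀ H → isFlat (mkM N E rk) H ≡ isFlat (mkM N E rk′) H
    isFlat-≐ H = cong (H ⊆ᵇ E ∧_) (all-cong (allFin N) (λ e →
      cong (if (e ∈ᵇ E) ∧ not (e ∈ᵇ H) then_else true) (cong₂ _<ᵇ_ (eq H) (eq (H ∪ ⁅ e ⁆)))))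

    χ-loc-≐ : ∀ H k → χ (loc (mkM N E rk) H) k ≡ χ (loc (mkM N E rk′) H) k
    χ-loc-≐ H k = sumₚ-cong (allSubsets N) (χ-term (loc (mkM N E rk) H)) (χ-term (loc (mkM N E rk′) H)) k term
      where
      term : ∀ X → χ-term (loc (mkM N E rk) H) X k ≡ χ-term (loc (mkM N E rk′) H) X k
      term X rewrite eq H | eq X = refl

  χ-degree : ∀ M k → rank M < k → χ M k ≡ + 0
  χ-degree M k r<k = sumₚ-0 (allSubsets (N M)) (χ-term M) k term
    where
    term : ∀ X → χ-term M X k ≡ + 0
    term X with X ⊆ᵇ E M
    ... | false = refl
    ... | true with (rank M ∸ rk M X) ≡ᵇ k in eq
    ...   | false = refl
    ...   | true  = ⊥-elim (ℕₚ.<⇒≢ (ℕₚ.≤-<-trans (ℕₚ.m∸n≤m (rank M) (rk M X)) r<k)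
                     (ℕₚ.≡ᵇ⇒≡ _ k (Equivalence.from T-≡ eq)))

  ∸-triangle : ∀ {a b} c → a ≤ b → (c ∸ a) ∸ (b ∸ a) ≡ c ∸ b
  ∸-triangle {a} {b} c a≤b = trans (ℕₚ.∸-+-assoc c a (b ∸ a)) (cong (c ∸_) (ℕₚ.m+[n∸m]≡n a≤b))

  module _ (M : MatroidData) (isM : IsMatroid M) (F : Subset (N M)) (fl : Flat M F) where
    open IsMatroid isM

    ─-⊆ : ∀ {X} → X ⊆ E M ─ F → X ⊆ E M
    ─-⊆ s x∈X = p─q⊆p (E M) F (s x∈X)

    con-⊆ : ∀ {X} → X ⊆ E M ─ F → X ∪ F ⊆ E M
    con-⊆ s = ∪-⊆ (─-⊆ s) (⊆E fl)

    rk-∪ : ∀ {X} → X ∪ F ⊆ E M → rk M F ≤ rk M (X ∪ F)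
    rk-∪ {X} s = R2 F (X ∪ F) (q⊆p∪q X F) s

    rk-∪∸ : ∀ {X} → X ∪ F ⊆ E M → rk M (X ∪ F) ≡ rk M (X ∪ F) ∸ rk M F +ℕ rk M F
    rk-∪∸ s = sym (ℕₚ.m∸n+n≡m (rk-∪ s))

    -- The axioms of M are applied to sets enlarged by `F`; each contains `F`, so the truncated
    -- differences are genuine.
    con-isMatroid : IsMatroid (con M F)
    con-isMatroid = record
      { R1 = λ X s → ℕₚ.m≤n+o⇒m∸n≤o _ (rk M F)
          (subst (rk M (X ∪ F) ≤_) (ℕₚ.+-comm ∣ X ∣ (rk M F))
          (≤-trans (ℕₚ.m≤m+n _ _) (≤-trans (R3 X F (─-⊆ s) (⊆E fl)) (ℕₚ.+-monoˡ-≤ (rk M F) (R1 X (─-⊆ s))))))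
      ; R2 = λ X Y X⊆Y s → ℕₚ.∸-monoˡ-≤ (rk M F) (R2 (X ∪ F) (Y ∪ F) (∪-⊆ (p⊆p∪q F ∘ X⊆Y) (q⊆p∪q Y F)) (con-⊆ s))
      ; R3 = submodular }
      where
      submodular : ∀ X Y → X ⊆ E M ─ F → Y ⊆ E M ─ F →
        (rk M ((X ∪ Y) ∪ F) ∸ rk M F) +ℕ (rk M ((X ∩ Y) ∪ F) ∸ rk M F) ≤ (rk M (X ∪ F) ∸ rk M F) +ℕ (rk M (Y ∪ F) ∸ rk M F)
      submodular X Y s s′ = ℕₚ.+-cancelʳ-≤ (rk M F +ℕ rk M F) _ _ (subst₂ _≤_
        (trans (cong₂ _+ℕ_ (rk-∪∸ (con-⊆ (∪-⊆ s s′))) (rk-∪∸ (con-⊆ (s ∘ p∩q⊆p X Y)))) (shuffle (rk M ((X ∪ Y) ∪ F) ∸ rk M F) _ (rk M ((X ∩ Y) ∪ F) ∸ rk M F) _))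
        (trans (cong₂ _+ℕ_ (rk-∪∸ (con-⊆ s)) (rk-∪∸ (con-⊆ s′))) (shuffle (rk M (X ∪ F) ∸ rk M F) _ (rk M (Y ∪ F) ∸ rk M F) _))
        (subst₂ (λ U I → rk M U +ℕ rk M I ≤ rk M (X ∪ F) +ℕ rk M (Y ∪ F)) union inter
          (R3 (X ∪ F) (Y ∪ F) (con-⊆ s) (con-⊆ s′))))
        where
        shuffle : ∀ a b c d → (a +ℕ b) +ℕ (c +ℕ d) ≡ (a +ℕ c) +ℕ (b +ℕ d)
        shuffle = interchange ℕₚ.+-commutativeSemigroup
        union : (X ∪ F) ∪ (Y ∪ F) ≡ (X ∪ Y) ∪ F
        union = trans (interchange ∪-csg X F Y F) (cong ((X ∪ Y) ∪_) (∪-idem F))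
          where ∪-csg = CommutativeMonoid.commutativeSemigroup (∪-commutativeMonoid (N M))
        inter : (X ∪ F) ∩ (Y ∪ F) ≡ (X ∩ Y) ∪ F
        inter = sym (∪-distribʳ-∩ F X Y)

    -- Closedness of `F` bounds the rank of an element from below, the size axiom from above.
    con-loopless : Loopless (con M F)
    con-loopless e e∈ = ℕₚ.≤-antisym
      (subst (rk M (⁅ e ⁆ ∪ F) ∸ rk M F ≤_) (∣⁅x⁆∣≡1 e) (IsMatroid.R1 con-isMatroid ⁅ e ⁆
        (λ {x} x∈ → subst (_∈ E M ─ F) (sym (x∈⁅y⁆⇒x≡y e x∈)) e∈)))
      (ℕₚ.m<n⇒0<n∸m (subst (λ X → rk M F < rk M X) (∪-comm F ⁅ e ⁆)
        (closed fl e (p─q⊆p (E M) F e∈) (∈─⇒∉ (E M) F e∈))))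

    rank-con : rank (con M F) ≡ rank M ∸ rk M F
    rank-con = cong (λ X → rk M X ∸ rk M F) (─∪-cancel (⊆E fl))

    module _ (H : Subset (N M)) (fl′ : Flat (con M F) H) where

      rk-≤-rank : rk M (H ∪ F) ≤ rank M
      rk-≤-rank = R2 (H ∪ F) (E M) (con-⊆ (⊆E fl′)) id

      ∪-flat : Flat M (H ∪ F)
      ∪-flat = record
        { ⊆E = con-⊆ (⊆E fl′)
        ; closed = λ e e∈E e∉ → subst (λ X → rk M (H ∪ F) < rk M X) (swap e) (∸-reflect-< (rk M F)
            (closed fl′ e (x∈p∧x∉q⇒x∈p─q e∈E (e∉ ∘ q⊆p∪q H F)) (e∉ ∘ p⊆p∪q F))) }
        where
        ∸-reflect-< : ∀ {a b} c → a ∸ c < b ∸ c → a < b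
        ∸-reflect-< c h = ℕₚ.≰⇒> (λ b≤a → ℕₚ.<⇒≱ h (ℕₚ.∸-monoˡ-≤ c b≤a))
        swap : ∀ e → (H ∪ ⁅ e ⁆) ∪ F ≡ (H ∪ F) ∪ ⁅ e ⁆
        swap e = trans (∪-assoc H ⁅ e ⁆ F) (trans (cong (H ∪_) (∪-comm ⁅ e ⁆ F)) (sym (∪-assoc H F ⁅ e ⁆)))

      rank-con-∪ : rank (con M F) ≡ rank (con M (H ∪ F)) +ℕ rk (con M F) H
      rank-con-∪ = begin
        rank (con M F) ≡⟨ rank-con ⟩
        rank M ∸ rk M F ≡⟨ cong (_∸ rk M F) (ℕₚ.m∸n+n≡m rk-≤-rank) ⟨
        (rank M ∸ rk M (H ∪ F)) +ℕ rk M (H ∪ F) ∸ rk M F ≡⟨ ℕₚ.+-∸-assoc (rank M ∸ rk M (H ∪ F)) (rk-∪ (⊆E ∪-flat)) ⟩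
        (rank M ∸ rk M (H ∪ F)) +ℕ (rk M (H ∪ F) ∸ rk M F)    ≡⟨ cong (_+ℕ (rk M (H ∪ F) ∸ rk M F)) (cong (λ X → rk M X ∸ rk M (H ∪ F)) (─∪-cancel (⊆E ∪-flat))) ⟨
        rank (con M (H ∪ F)) +ℕ (rk M (H ∪ F) ∸ rk M F) ∎
        where open ≡-Reasoning

      con-con : con (con M F) H ≐ con M (H ∪ F)
      con-con = same
        (trans (p─q─r≡p─q∪r (E M) F H) (cong (E M ─_) (∪-comm F H)))
        (λ X → trans (cong (λ Y → (rk M Y ∸ rk M F) ∸ (rk M (H ∪ F) ∸ rk M F)) (∪-assoc X H F))
                     (∸-triangle (rk M (X ∪ (H ∪ F))) (rk-∪ (⊆E ∪-flat))))

  module Uniqueness (P : MatroidData → Coeffs) (isKL : IsKL P)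
    (M : MatroidData) (isM : IsMatroid M) (f : Subset (N M) → Coeffs)
    (adm : ∀ F → Flat M F → Admissible (rank (con M F)) (f F))
    (kl-eq : ∀ F → Flat M F → ∀ k → rev (rank (con M F)) (f F) k ≡
      sumₚ (allSubsets (N M)) (KL-term (con M F) (λ H → f (H ∪ F))) k) where

    vanish : ∀ {d g} → Admissible d g → 0 < d → ∀ k → d ≤ 2 *ℕ k → g k ≡ + 0
    vanish {suc d} a _ = a

    -- In rank 0 the polynomial χ is constant, so the coefficient is a multiple of `g k`.
    degree0-product : ∀ L g k → rank L ≡ 0 → g k ≡ + 0 → (χ L *ₚ g) k ≡ + 0
    degree0-product L g k r≡0 gk = trans (*ₚ≡⊛ (χ L) g k) (⊛-vanish k (χ L) g λ
      { zero    j refl → inj₂ gk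
      ; (suc i) j _    → inj₁ (χ-degree L (suc i) (subst (_< suc i) (sym r≡0) (s≤s z≤n))) })

    -- Induction on the corank of F.  In the defining equation at degree above half
    -- the rank, the flats of positive rank are known by induction, and those of rank
    -- 0 drop out because χ is constant and P and f have small degree.  So M′ need
    -- not be con M F itself, only have the same rank function.
    P-con : ∀ d F → Flat M F → rank (con M F) ≤ d → ∀ M′ → M′ ≐ con M F → ∀ k → P M′ k ≡ f F k
    P-con d F fl r≤d M′ M′≐@(same {rk = rk′} refl eq) k with rank (con M F) in r≡ | adm F fl | r≤d
    ... | zero | adm₀ | _ = trans (proj₁ (isKL M′ isM′ ll′) (trans (≐-rank M′≐) r≡) k) (trans (δ₀≡ k) (sym (adm₀ k)))
      where
      isM′ = ≐-isMatroid M′≐ (con-isMatroid M isM F fl)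
      ll′  = ≐-loopless M′≐ (con-loopless M isM F fl)
      δ₀≡ : ∀ k → δ₀ k ≡ P.const (+ 1) k
      δ₀≡ zero    = refl
      δ₀≡ (suc k) = refl
    P-con (suc d) F fl _ M′ M′≐@(same {rk = rk′} refl eq) k | suc r | half | s≤s r≤d with suc r ℕₚ.≤? 2 *ℕ k
    ... | yes r<2k = trans (proj₁ (proj₂ (isKL M′ isM′ ll′)) (subst (0 <_) (sym rank′) (s≤s z≤n)) k
                       (subst (_≤ 2 *ℕ k) (sym rank′) r<2k)) (sym (half k r<2k))
      where
      isM′ = ≐-isMatroid M′≐ (con-isMatroid M isM F fl)
      ll′  = ≐-loopless M′≐ (con-loopless M isM F fl)
      rank′ = trans (≐-rank M′≐) r≡
    ... | no r≮2k = begin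
      P M′ k ≡⟨ cong (P M′) (sym (ℕₚ.m∸[m∸n]≡n k≤r)) ⟩
      P M′ (suc r ∸ j) ≡⟨ rev-≤ (P M′) j≤r ⟨
      rev (suc r) (P M′) j    ≡⟨ cong (λ s → rev s (P M′) j) (sym rank′) ⟩
      rev (rank M′) (P M′) j  ≡⟨ proj₂ (proj₂ (isKL M′ isM′ ll′)) j ⟩
      sumₚ (allSubsets (N M)) (KL-term M′ (λ H → P (con M′ H))) j
        ≡⟨ sumₚ-cong (allSubsets (N M)) (KL-term M′ (λ H → P (con M′ H))) (KL-term (con M F) (λ H → f (H ∪ F))) j term ⟩
      sumₚ (allSubsets (N M)) (KL-term (con M F) (λ H → f (H ∪ F))) j
        ≡⟨ kl-eq F fl j ⟨
      rev (rank (con M F)) (f F) j ≡⟨ cong (λ s → rev s (f F) j) r≡ ⟩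
      rev (suc r) (f F) j     ≡⟨ rev-≤ (f F) j≤r ⟩
      f F (suc r ∸ j) ≡⟨ cong (f F) (ℕₚ.m∸[m∸n]≡n k≤r) ⟩
      f F k ∎
      where
      open ≡-Reasoning
      isM′ = ≐-isMatroid M′≐ (con-isMatroid M isM F fl)
      ll′  = ≐-loopless M′≐ (con-loopless M isM F fl)
      rank′ = trans (≐-rank M′≐) r≡
      -- Reversal moves coefficient k, below half the rank, to coefficient j, above half the rank,
      -- where the degree bounds apply.
      j = suc r ∸ k
      2k≤r : 2 *ℕ k ≤ r
      2k≤r = ℕₚ.≤-pred (ℕₚ.≰⇒> r≮2k)
      k≤r : k ≤ suc r
      k≤r = ≤-trans (ℕₚ.m≤m+n k _) (ℕₚ.m≤n⇒m≤1+n 2k≤r)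
      j≤r : j ≤ suc r
      j≤r = ℕₚ.m∸n≤m (suc r) k
      r≤2j : suc r ≤ 2 *ℕ j
      r≤2j = subst (suc r ≤_) (sym (ℕₚ.*-distribˡ-∸ 2 (suc r) k))
        (ℕₚ.m+n≤o⇒m≤o∸n (suc r) (ℕₚ.+-monoʳ-≤ (suc r) (subst (2 *ℕ k ≤_) (sym (ℕₚ.+-identityʳ (suc r))) (ℕₚ.m≤n⇒m≤1+n 2k≤r))))
      flatTerm : ∀ H → Flat (con M F) H → (h : ℕ) → rk (con M F) H ≡ h →
        (χ (loc M′ H) *ₚ P (con M′ H)) j ≡ (χ (loc (con M F) H) *ₚ f (H ∪ F)) j
      flatTerm H flH zero rkH = trans
        (degree0-product (loc M′ H) (P (con M′ H)) j (trans (eq H) rkH)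
          (proj₁ (proj₂ (isKL (con M′ H) isMG llG)) (subst (0 <_) (sym rG′) (s≤s z≤n)) j (subst (_≤ 2 *ℕ j) (sym rG′) r≤2j)))
        (sym (degree0-product (loc (con M F) H) (f (H ∪ F)) j rkH
          (vanish (adm (H ∪ F) G) (subst (0 <_) (sym rG) (s≤s z≤n)) j (subst (_≤ 2 *ℕ j) (sym rG) r≤2j))))
        where
        G   = ∪-flat M isM F fl H flH
        ≐G  = ≐-trans (con-≐ {E = E M ─ F} eq H) (con-con M isM F fl H flH)
        isMG = ≐-isMatroid ≐G (con-isMatroid M isM (H ∪ F) G)
        llG  = ≐-loopless ≐G (con-loopless M isM (H ∪ F) G)
        rG : rank (con M (H ∪ F)) ≡ suc r
        rG = trans (sym (trans (cong (rank (con M (H ∪ F)) +ℕ_) rkH) (ℕₚ.+-identityʳ _)))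
               (trans (sym (rank-con-∪ M isM F fl H flH)) r≡)
        rG′ = trans (≐-rank ≐G) rG
      flatTerm H flH (suc h) rkH = begin
        (χ (loc M′ H) *ₚ P (con M′ H)) j ≡⟨ *ₚ≡⊛ (χ (loc M′ H)) (P (con M′ H)) j ⟩
        (χ (loc M′ H) P.⊛ P (con M′ H)) j
          ≡⟨ P.⊛-cong (χ-loc-≐ {E = E M ─ F} eq H) (P-con d (H ∪ F) G rG (con M′ H) ≐G) j ⟩
        (χ (loc (con M F) H) P.⊛ f (H ∪ F)) j ≡⟨ *ₚ≡⊛ (χ (loc (con M F) H)) (f (H ∪ F)) j ⟨
        (χ (loc (con M F) H) *ₚ f (H ∪ F)) j ∎
        where
        G   = ∪-flat M isM F fl H flH
        ≐G  = ≐-trans (con-≐ {E = E M ─ F} eq H) (con-con M isM F fl H flH)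
        rG : rank (con M (H ∪ F)) ≤ d
        rG = ≤-trans (subst (rank (con M (H ∪ F)) ≤_) (ℕₚ.suc-injective (begin
            suc (rank (con M (H ∪ F)) +ℕ h) ≡⟨ ℕₚ.+-suc _ h ⟨
            rank (con M (H ∪ F)) +ℕ suc h ≡⟨ cong (rank (con M (H ∪ F)) +ℕ_) rkH ⟨
            rank (con M (H ∪ F)) +ℕ rk (con M F) H     ≡⟨ rank-con-∪ M isM F fl H flH ⟨
            rank (con M F) ≡⟨ r≡ ⟩
            suc r ∎)) (ℕₚ.m≤m+n _ h)) r≤d
      term : ∀ H → KL-term M′ (λ H → P (con M′ H)) H j ≡ KL-term (con M F) (λ H → f (H ∪ F)) H j
      term H rewrite isFlat-≐ {E = E M ─ F} eq H with isFlat (con M F) H in flat?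
      ... | false = refl
      ... | true  = flatTerm H (isFlat-sound (con M F) H flat?) _ refl

    -- Closedness of the empty set supplies looplessness, once M is read as its own contraction at
    -- `⊥`.
    P-unique : Flat M ⊥ → ∀ k → P M k ≡ f ⊥ k
    P-unique fl = P-con _ ⊥ fl ≤-refl M (same (sym (p─⊥≡p (E M))) λ X →
      sym (cong₂ _∸_ (cong (rk M) (∪-identityʳ X)) (ℕₚ.n≤0⇒n≡0 (subst (rk M ⊥ ≤_) (∣⊥∣≡0 (N M)) (IsMatroid.R1 isM ⊥ (λ x → ⊥-elim (∉⊥ x)))))))

import Data.Bool.ListAction

-- Graph search and the intervals of a word.

module FanComponents where

  open import Data.Nat using (ℕ; zero; suc; _≤_; z≤n; s≤s; _+_)
  import Data.Nat.Properties as ℕₚ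
  open import Data.Bool using (Bool; true; false; not; _∧_; _∨_)
  open import Data.Bool.Properties using (T-≡)
  open import Data.Bool.ListAction using (any; all)
  open import Data.Fin using (Fin; zero; suc; toℕ; inject₁)
  open import Data.Fin.Properties using (toℕ-injective)
  open import Data.Fin.Subset using (Subset)
  open import Data.List using (List; []; _∷_; tabulate; allFin; length; filterᵇ)
  import Data.List as List
  open import Data.Vec using ([]; _∷_; lookup)
  open import Data.Vec.Properties using (lookup∘tabulate)
  open import Data.Product using (∃; _×_; _,_; proj₁; proj₂)
  open import Data.Sum using (inj₁; inj₂)
  open import Function using (id; _∘_; Equivalence)
  open import Relation.Binary.PropositionalEquality
  open FanWords
  open KazhdanLusztig using ()

  any-intro : ∀ {n} {A : Set} (p : A → Bool) (g : Fin n → A) i → p (g i) ≡ true → any p (tabulate g) ≡ true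
  any-intro p g zero    h rewrite h = refl
  any-intro p g (suc i) h with p (g zero)
  ... | true  = refl
  ... | false = any-intro p (g ∘ suc) i h

  any-elim : ∀ {n} {A : Set} (p : A → Bool) (g : Fin n → A) → any p (tabulate g) ≡ true → ∃ λ i → p (g i) ≡ true
  any-elim {suc n} p g h with p (g zero) in eq
  ... | true  = zero , eq
  ... | false with any-elim p (g ∘ suc) h
  ...   | i , q = suc i , q

  all-false : ∀ {n} {A : Set} (p : A → Bool) (g : Fin n → A) i → p (g i) ≡ false → all p (tabulate g) ≡ false
  all-false p g zero    h rewrite h = refl
  all-false p g (suc i) h with p (g zero)
  ... | false = refl
  ... | true  = all-false p (g ∘ suc) i h

  module _ (G : Graph) (X : Subset (length (edges G))) where

    src tgt : Fin (length (edges G)) → Fin (V G)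
    src e = proj₁ (List.lookup (edges G) e)
    tgt e = proj₂ (List.lookup (edges G) e)

    hit : Subset (V G) → Fin (V G) → Fin (length (edges G)) → Bool
    hit R w e = lookup X e ∧ ((lookup R (src e) ∧ (w == tgt e))
                            ∨ (lookup R (tgt e) ∧ (w == src e)))

    lookup-step : ∀ R w → lookup (step G X R) w ≡ lookup R w ∨ any (hit R w) (allFin (length (edges G)))
    lookup-step R w = lookup∘tabulate _ w

    ==-refl : ∀ {n} (a : Fin n) → (a == a) ≡ true
    ==-refl a = Equivalence.to T-≡ (ℕₚ.≡⇒≡ᵇ (toℕ a) (toℕ a) refl)

    ==-sound : ∀ {n} (a b : Fin n) → (a == b) ≡ true → a ≡ b
    ==-sound a b h = toℕ-injective (ℕₚ.≡ᵇ⇒≡ (toℕ a) (toℕ b) (Equivalence.from T-≡ h))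

    step-keep : ∀ R w → lookup R w ≡ true → lookup (step G X R) w ≡ true
    step-keep R w h rewrite lookup-step R w | h = refl

    step-edge : ∀ R e a b → lookup X e ≡ true → List.lookup (edges G) e ≡ (a , b) →
      (lookup R a ≡ true → lookup (step G X R) b ≡ true) × (lookup R b ≡ true → lookup (step G X R) a ≡ true)
    step-edge R e a b e∈X ab =
        (λ a∈R → reached b (lemma₁ a∈R))
      , (λ b∈R → reached a (lemma₂ b∈R))
      where
      reached : ∀ w → hit R w e ≡ true → lookup (step G X R) w ≡ true
      reached w h rewrite lookup-step R w | any-intro (hit R w) id e h with lookup R w
      ... | true  = refl
      ... | false = refl
      lemma₁ : lookup R a ≡ true → hit R b e ≡ true
      lemma₁ a∈R rewrite e∈X | ab | a∈R | ==-refl b = refl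
      lemma₂ : lookup R b ≡ true → hit R a e ≡ true
      lemma₂ b∈R rewrite e∈X | ab | b∈R | ==-refl a with lookup R a ∧ (a == b)
      ... | true  = refl
      ... | false = refl

    module _ (I : Fin (V G) → Bool)
      (closed : ∀ e → lookup X e ≡ true → I (src e) ≡ I (tgt e)) where

      -- Bounds the search from above: a vertex is shown to be unreachable by a set that no edge of
      -- `X` leaves.
      step-inside : ∀ R → (∀ w → lookup R w ≡ true → I w ≡ true) → ∀ w → lookup (step G X R) w ≡ true → I w ≡ true
      step-inside R R⊆I w h with trans (sym (lookup-step R w)) h
      ... | h′ with lookup R w in w∈R
      ...   | true  = R⊆I w w∈R
      ...   | false with any-elim (hit R w) id h′
      ...     | e , hit-e with lookup X e in e∈X
      ...       | true with lookup R (src e) in a∈R | w == tgt e in w≡b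
      ...         | true | true = trans (cong I (==-sound _ _ w≡b)) (trans (sym (closed e e∈X)) (R⊆I _ a∈R))
      ...         | true | false with lookup R (tgt e) in b∈R | w == src e in w≡a
      ...           | true | true = trans (cong I (==-sound _ _ w≡a)) (trans (closed e e∈X) (R⊆I _ b∈R))
      step-inside R R⊆I w h | h′ | false | e , hit-e | true | false | _
                  with lookup R (tgt e) in b∈R | w == src e in w≡a
      ...           | true | true = trans (cong I (==-sound _ _ w≡a)) (trans (closed e e∈X) (R⊆I _ b∈R))

      iter-inside : ∀ n R → (∀ w → lookup R w ≡ true → I w ≡ true) → ∀ w → lookup (iter n (step G X) R) w ≡ true → I w ≡ true
      iter-inside zero    R R⊆I = R⊆I
      iter-inside (suc n) R R⊆I = step-inside (iter n (step G X) R) (iter-inside n R R⊆I)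

    iter-keep : ∀ n {k} R w → k ≤ n → lookup (iter k (step G X) R) w ≡ true → lookup (iter n (step G X) R) w ≡ true
    iter-keep zero    R w z≤n h = h
    iter-keep (suc n) {k} R w k≤n h with ℕₚ.m≤n⇒m<n∨m≡n k≤n
    ... | inj₂ refl      = h
    ... | inj₁ (s≤s k≤n′) = step-keep (iter n (step G X) R) w (iter-keep n R w k≤n′ h)

  hasNoSpoke : ∀ {m} → Subset (suc m) → Subset m → Bool
  hasNoSpoke (x ∷ s)  (q ∷ p) = not x ∧ (not q ∨ hasNoSpoke s p)
  hasNoSpoke (x ∷ []) []      = not x

  -- Vertex i starts an interval without spokes; l tells whether the first
  -- vertex of the word is linked to a previous one.
  isRoot : ∀ {m} → Bool → Subset (suc m) → Subset m → Fin (suc m) → Bool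
  isRoot l (x ∷ s) (q ∷ p) (suc i) = isRoot q s p i
  isRoot l s       p       zero    = not l ∧ hasNoSpoke s p

  isRoot-zero : ∀ {m} (s : Subset (suc m)) p → isRoot false s p zero ≡ hasNoSpoke s p
  isRoot-zero (x ∷ [])    []      = refl
  isRoot-zero (x ∷ y ∷ s) (q ∷ p) = refl

  count : ∀ n → (Fin n → Bool) → ℕ
  count zero    f = 0
  count (suc n) f = β (f zero) + count n (f ∘ suc)

  count-cong : ∀ n {f g} → (∀ i → f i ≡ g i) → count n f ≡ count n g
  count-cong zero    h = refl
  count-cong (suc n) h = cong₂ _+_ (cong β (h zero)) (count-cong n (h ∘ suc))

  length-filter : ∀ {A : Set} n (f : A → Bool) (g : Fin n → A) → length (filterᵇ f (tabulate g)) ≡ count n (f ∘ g)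
  length-filter zero    f g = refl
  length-filter (suc n) f g with f (g zero)
  ... | true  = cong suc (length-filter n f (g ∘ suc))
  ... | false = length-filter n f (g ∘ suc)

  count-first : ∀ {m} (s : Subset (suc m)) p → β (hasNoSpoke s p) + count (suc m) (isRoot true s p) ≡ count (suc m) (isRoot false s p)
  count-first (x ∷ [])    []      = refl
  count-first (x ∷ y ∷ s) (q ∷ p) = refl

  -- `cork` counts a spokeless interval at its right end, `isRoot` at its left end. The first
  -- interval is kept apart because c decides whether it is joined from the left.
  cork≡count : ∀ {m} c (s : Subset (suc m)) p → cork c s p ≡ β (not c ∧ hasNoSpoke s p) + count (suc m) (isRoot true s p)
  cork≡count true  (x ∷ [])     []          = refl
  cork≡count false (true ∷ [])  []          = refl
  cork≡count false (false ∷ []) []          = refl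
  cork≡count true  (x ∷ s)      (true ∷ p)  = cork≡count true s p
  cork≡count true  (x ∷ s)      (false ∷ p) = trans (cork≡count false s p) (count-first s p)
  cork≡count false (true ∷ s)   (true ∷ p)  = cork≡count true s p
  cork≡count false (false ∷ s)  (true ∷ p)  = cork≡count false s p
  cork≡count false (true ∷ s)   (false ∷ p) = trans (cork≡count false s p) (count-first s p)
  cork≡count false (false ∷ s)  (false ∷ p) = cong suc (trans (cork≡count false s p) (count-first s p))

  -- A walk to 0 that follows path edges to the right and ends with a spoke, n being its number of
  -- edges. From the left end of an interval such walks reach every spoke of it.
  data Hits {m} (s : Subset (suc m)) (p : Subset m) : Fin (suc m) → ℕ → Set where
    here  : ∀ {i} → lookup s i ≡ true → Hits s p i 1
    there : ∀ {j n} → lookup p j ≡ true → Hits s p (suc j) n → Hits s p (inject₁ j) (suc n)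

  Hits-∷ : ∀ {m x q i n} {s : Subset (suc m)} {p} → Hits s p i n → Hits (x ∷ s) (q ∷ p) (suc i) n
  Hits-∷ (here h)    = here h
  Hits-∷ (there h r) = there h (Hits-∷ r)

  data NotRoot {m} (l : Bool) (s : Subset (suc m)) (p : Subset m) : Fin (suc m) → Set where
    linked   : l ≡ true → NotRoot l s p zero
    incoming : ∀ j → lookup p j ≡ true → NotRoot l s p (suc j)
    spoked   : ∀ {i} n → n ≤ suc m → Hits s p i n → NotRoot l s p i

  spoke-ahead : ∀ {m} (s : Subset (suc m)) p → hasNoSpoke s p ≡ false → ∃ λ n → n ≤ suc m × Hits s p zero n
  spoke-ahead (true ∷ [])  []         h = 1 , s≤s z≤n , here refl
  spoke-ahead (false ∷ []) []         ()
  spoke-ahead (true ∷ s)   (q ∷ p)    h = 1 , s≤s z≤n , here refl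
  spoke-ahead (false ∷ s)  (true ∷ p) h with spoke-ahead s p h
  ... | n , n≤ , r = suc n , s≤s n≤ , there {j = zero} refl (Hits-∷ r)

  notRoot : ∀ {m} l (s : Subset (suc m)) p i → isRoot l s p i ≡ false → NotRoot l s p i
  notRoot true  s p zero h = linked refl
  notRoot false s p zero h with spoke-ahead s p (trans (sym (isRoot-zero s p)) h)
  ... | n , n≤ , r = spoked n n≤ r
  notRoot l (x ∷ s) (q ∷ p) (suc i) h with notRoot q s p i h
  ... | linked q≡    = incoming zero q≡
  ... | incoming j e = incoming (suc j) e
  ... | spoked n n≤ r = spoked n (ℕₚ.m≤n⇒m≤1+n n≤) (Hits-∷ r)

  -- Vertex k lies in the interval of vertex i, not to the left of i.
  inInterval : ∀ {m} → Subset m → Fin (suc m) → Fin (suc m) → Bool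
  inInterval p       zero    zero    = true
  inInterval (q ∷ p) zero    (suc k) = q ∧ inInterval p zero k
  inInterval p       (suc i) zero    = false
  inInterval (q ∷ p) (suc i) (suc k) = inInterval p i k

  inInterval-refl : ∀ {m} (p : Subset m) i → inInterval p i i ≡ true
  inInterval-refl p       zero    = refl
  inInterval-refl (q ∷ p) (suc i) = inInterval-refl p i

  inInterval-≤ : ∀ {m} (p : Subset m) i k → inInterval p i k ≡ true → toℕ i ≤ toℕ k
  inInterval-≤ p       zero    k       h = z≤n
  inInterval-≤ (q ∷ p) (suc i) (suc k) h = s≤s (inInterval-≤ p i k h)

  root-no-spoke : ∀ {m} l (s : Subset (suc m)) p i → isRoot l s p i ≡ true → ∀ k → inInterval p i k ≡ true → lookup s k ≡ false
  root-no-spoke true  (_ ∷ [])         []         zero    () _ _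
  root-no-spoke true  (_ ∷ _ ∷ _)      (_ ∷ _)    zero    () _ _
  root-no-spoke false (true ∷ [])      []         zero    () _ _
  root-no-spoke false (true ∷ _ ∷ _)   (_ ∷ _)    zero    () _ _
  root-no-spoke false (false ∷ [])     []         zero    h zero    _ = refl
  root-no-spoke false (false ∷ x ∷ s)  (q ∷ p)    zero    h zero    _ = refl
  root-no-spoke false (false ∷ x ∷ s)  (true ∷ p) zero    h (suc k) e = root-no-spoke false (x ∷ s) p zero (trans (isRoot-zero (x ∷ s) p) h) k e
  root-no-spoke l     (x ∷ s)          (q ∷ p)    (suc i) h (suc k) e = root-no-spoke q s p i h k e

  interval-path : ∀ {m} (p : Subset m) j → lookup p j ≡ true → inInterval p zero (inject₁ j) ≡ inInterval p zero (suc j)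
  interval-path (true ∷ p) zero    _ = refl
  interval-path (q ∷ p)    (suc j) h = cong (q ∧_) (interval-path p j h)

  -- A path edge with only one end in the interval would have to enter the root from the left, and a
  -- root has no such edge.
  root-path : ∀ {m} l (s : Subset (suc m)) p i → isRoot l s p i ≡ true → ∀ j → lookup p j ≡ true →
    inInterval p i (inject₁ j) ≡ inInterval p i (suc j)
  root-path l (x ∷ s)     p            zero          h j       e = interval-path p j e
  root-path l (x ∷ y ∷ s) (true ∷ [])  (suc zero)    () zero   e
  root-path l (x ∷ y ∷ s) (true ∷ q ∷ p) (suc zero)  () zero   e
  root-path l (x ∷ s)     (q ∷ r ∷ p)  (suc (suc i)) h zero    e = refl
  root-path l (x ∷ s)     (q ∷ p)      (suc i)       h (suc j) e = root-path q s p i h j e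

-- Subsets of a concatenated list of edges.

module EdgeCoding where

  open import Data.Nat using (zero; suc; _+_)
  import Data.Nat.Properties as ℕₚ
  open import Data.Integer using (ℤ)
  import Data.Integer.Properties as ℤₚ
  open import Data.Bool using (Bool; true; false)
  open import Data.Fin using (Fin; zero; suc)
  open import Data.Fin.Subset using (Subset; ⁅_⁆; ∣_∣; ⊥)
  open import Data.List using (List; []; _∷_; map; tabulate; length; _++_)
  import Data.List as List
  open import Data.Vec using (Vec; []; _∷_; lookup; zipWith; replicate)
  open import Data.Product using (∃; _,_)
  open import Data.Sum using (_⊎_; inj₁; inj₂)
  open import Function using (_∘_)
  open import Relation.Binary.PropositionalEquality
  open FanWords using (β; count-∷)
  import Data.Integer as ℤ

  sum-allSubsets : ∀ n (f : Subset (suc n) → Coeffs) k → sumₚ (allSubsets (suc n)) f k ≡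
    sumₚ (allSubsets n) (λ X → f (true ∷ X)) k ℤ.+ sumₚ (allSubsets n) (λ X → f (false ∷ X)) k
  sum-allSubsets n f k = trans (sum-++ (map (true ∷_) (allSubsets n)) _)
    (cong₂ ℤ._+_ (sum-map (allSubsets n) (true ∷_)) (sum-map (allSubsets n) (false ∷_)))
    where
    sum-++ : ∀ xs ys → sumₚ (xs ++ ys) f k ≡ sumₚ xs f k ℤ.+ sumₚ ys f k
    sum-++ []       ys = sym (ℤₚ.+-identityˡ _)
    sum-++ (x ∷ xs) ys = trans (cong (λ z → f x k ℤ.+ z) (sum-++ xs ys)) (sym (ℤₚ.+-assoc (f x k) _ _))
    sum-map : {B : Set} (xs : List B) (g : B → Subset (suc n)) → sumₚ (map g xs) f k ≡ sumₚ xs (f ∘ g) k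
    sum-map []       g = refl
    sum-map (x ∷ xs) g = cong (λ z → f (g x) k ℤ.+ z) (sum-map xs g)

  module Prefix {A B : Set} (f : B → A) (ys : List A) where

    -- The length of the edge list equals the expected sum only up to a proof, so subsets and
    -- indices are translated by recursion. The enumeration `u` is arbitrary because the recursion
    -- turns it into `u ∘ suc`.
    front : ∀ {n} (u : Fin n → B) → Subset (length (map f (tabulate u) ++ ys)) → Subset n
    front {zero}  u X       = []
    front {suc n} u (x ∷ X) = x ∷ front (u ∘ suc) X

    back : ∀ {n} (u : Fin n → B) → Subset (length (map f (tabulate u) ++ ys)) → Subset (length ys)
    back {zero}  u X       = X
    back {suc n} u (x ∷ X) = back (u ∘ suc) X

    frontIx : ∀ {n} (u : Fin n → B) → Fin n → Fin (length (map f (tabulate u) ++ ys))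
    frontIx {suc n} u zero    = zero
    frontIx {suc n} u (suc i) = suc (frontIx (u ∘ suc) i)

    backIx : ∀ {n} (u : Fin n → B) → Fin (length ys) → Fin (length (map f (tabulate u) ++ ys))
    backIx {zero}  u i = i
    backIx {suc n} u i = suc (backIx (u ∘ suc) i)

    Ix-cover : ∀ {n} (u : Fin n → B) e → (∃ λ i → e ≡ frontIx u i) ⊎ (∃ λ i → e ≡ backIx u i)
    Ix-cover {zero}  u e       = inj₂ (e , refl)
    Ix-cover {suc n} u zero    = inj₁ (zero , refl)
    Ix-cover {suc n} u (suc e) with Ix-cover (u ∘ suc) e
    ... | inj₁ (i , refl) = inj₁ (suc i , refl)
    ... | inj₂ (i , refl) = inj₂ (i , refl)

    front-zipWith : ∀ {n} (u : Fin n → B) op X Y → front u (zipWith op X Y) ≡ zipWith op (front u X) (front u Y)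
    front-zipWith {zero}  u op X       Y       = refl
    front-zipWith {suc n} u op (x ∷ X) (y ∷ Y) = cong (op x y ∷_) (front-zipWith (u ∘ suc) op X Y)

    back-zipWith : ∀ {n} (u : Fin n → B) op X Y → back u (zipWith op X Y) ≡ zipWith op (back u X) (back u Y)
    back-zipWith {zero}  u op X       Y       = refl
    back-zipWith {suc n} u op (x ∷ X) (y ∷ Y) = back-zipWith (u ∘ suc) op X Y

    front-replicate : ∀ {n} (u : Fin n → B) b → front u (replicate _ b) ≡ replicate _ b
    front-replicate {zero}  u b = refl
    front-replicate {suc n} u b = cong (b ∷_) (front-replicate (u ∘ suc) b)

    back-replicate : ∀ {n} (u : Fin n → B) b → back u (replicate _ b) ≡ replicate _ b
    back-replicate {zero}  u b = refl
    back-replicate {suc n} u b = back-replicate (u ∘ suc) b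

    front-⁅frontIx⁆ : ∀ {n} (u : Fin n → B) i → front u ⁅ frontIx u i ⁆ ≡ ⁅ i ⁆
    front-⁅frontIx⁆ u zero    = cong (true ∷_) (front-replicate (u ∘ suc) false)
    front-⁅frontIx⁆ u (suc i) = cong (false ∷_) (front-⁅frontIx⁆ (u ∘ suc) i)

    back-⁅frontIx⁆ : ∀ {n} (u : Fin n → B) i → back u ⁅ frontIx u i ⁆ ≡ ⊥
    back-⁅frontIx⁆ u zero    = back-replicate (u ∘ suc) false
    back-⁅frontIx⁆ u (suc i) = back-⁅frontIx⁆ (u ∘ suc) i

    front-⁅backIx⁆ : ∀ {n} (u : Fin n → B) i → front u ⁅ backIx u i ⁆ ≡ ⊥
    front-⁅backIx⁆ {zero}  u i = refl
    front-⁅backIx⁆ {suc n} u i = cong (false ∷_) (front-⁅backIx⁆ (u ∘ suc) i)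

    back-⁅backIx⁆ : ∀ {n} (u : Fin n → B) i → back u ⁅ backIx u i ⁆ ≡ ⁅ i ⁆
    back-⁅backIx⁆ {zero}  u i = refl
    back-⁅backIx⁆ {suc n} u i = back-⁅backIx⁆ (u ∘ suc) i

    lookup-frontIx : ∀ {n} (u : Fin n → B) X i → lookup X (frontIx u i) ≡ lookup (front u X) i
    lookup-frontIx u (x ∷ X) zero    = refl
    lookup-frontIx u (x ∷ X) (suc i) = lookup-frontIx (u ∘ suc) X i

    lookup-backIx : ∀ {n} (u : Fin n → B) X i → lookup X (backIx u i) ≡ lookup (back u X) i
    lookup-backIx {zero}  u X       i = refl
    lookup-backIx {suc n} u (x ∷ X) i = lookup-backIx (u ∘ suc) X i

    edge-frontIx : ∀ {n} (u : Fin n → B) i → List.lookup (map f (tabulate u) ++ ys) (frontIx u i) ≡ f (u i)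
    edge-frontIx u zero    = refl
    edge-frontIx u (suc i) = edge-frontIx (u ∘ suc) i

    edge-backIx : ∀ {n} (u : Fin n → B) i → List.lookup (map f (tabulate u) ++ ys) (backIx u i) ≡ List.lookup ys i
    edge-backIx {zero}  u i = refl
    edge-backIx {suc n} u i = edge-backIx (u ∘ suc) i

    size-split : ∀ {n} (u : Fin n → B) X → ∣ X ∣ ≡ ∣ front u X ∣ + ∣ back u X ∣
    size-split {zero}  u X       = refl
    size-split {suc n} u (x ∷ X) = begin
      ∣ x ∷ X ∣                                   ≡⟨ count-∷ x X ⟩
      β x + ∣ X ∣                                 ≡⟨ cong (β x +_) (size-split (u ∘ suc) X) ⟩
      β x + (∣ front (u ∘ suc) X ∣ + ∣ back (u ∘ suc) X ∣)   ≡⟨ ℕₚ.+-assoc (β x) _ _ ⟨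
      β x + ∣ front (u ∘ suc) X ∣ + ∣ back (u ∘ suc) X ∣     ≡⟨ cong (_+ ∣ back (u ∘ suc) X ∣) (count-∷ x (front (u ∘ suc) X)) ⟨
      ∣ x ∷ front (u ∘ suc) X ∣ + ∣ back (u ∘ suc) X ∣       ∎
      where open ≡-Reasoning

    sum-split : ∀ {n} (u : Fin n → B) (h : Subset n → Subset (length ys) → Coeffs) k →
      sumₚ (allSubsets (length (map f (tabulate u) ++ ys))) (λ X → h (front u X) (back u X)) k
      ≡ sumₚ (allSubsets n) (λ s → sumₚ (allSubsets (length ys)) (h s)) k
    sum-split {zero}  u h k = sym (ℤₚ.+-identityʳ _)
    sum-split {suc n} u h k = begin
      _ ≡⟨ sum-allSubsets _ (λ X → h (front u X) (back u X)) k ⟩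
      _ ≡⟨ cong₂ ℤ._+_ (sum-split (u ∘ suc) (λ s → h (true ∷ s)) k) (sum-split (u ∘ suc) (λ s → h (false ∷ s)) k) ⟩
      _ ≡⟨ sum-allSubsets n (λ s → sumₚ (allSubsets (length ys)) (h s)) k ⟨
      _ ∎
      where open ≡-Reasoning

  module Whole {A B : Set} (f : B → A) where

    whole : ∀ {n} (u : Fin n → B) → Subset (length (map f (tabulate u))) → Subset n
    whole {zero}  u X       = []
    whole {suc n} u (x ∷ X) = x ∷ whole (u ∘ suc) X

    wholeIx : ∀ {n} (u : Fin n → B) → Fin n → Fin (length (map f (tabulate u)))
    wholeIx {suc n} u zero    = zero
    wholeIx {suc n} u (suc i) = suc (wholeIx (u ∘ suc) i)

    wholeIx-cover : ∀ {n} (u : Fin n → B) e → ∃ λ i → e ≡ wholeIx u i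
    wholeIx-cover {suc n} u zero    = zero , refl
    wholeIx-cover {suc n} u (suc e) with wholeIx-cover (u ∘ suc) e
    ... | i , refl = suc i , refl

    whole-zipWith : ∀ {n} (u : Fin n → B) op X Y → whole u (zipWith op X Y) ≡ zipWith op (whole u X) (whole u Y)
    whole-zipWith {zero}  u op X       Y       = refl
    whole-zipWith {suc n} u op (x ∷ X) (y ∷ Y) = cong (op x y ∷_) (whole-zipWith (u ∘ suc) op X Y)

    whole-replicate : ∀ {n} (u : Fin n → B) b → whole u (replicate _ b) ≡ replicate _ b
    whole-replicate {zero}  u b = refl
    whole-replicate {suc n} u b = cong (b ∷_) (whole-replicate (u ∘ suc) b)

    whole-⁅wholeIx⁆ : ∀ {n} (u : Fin n → B) i → whole u ⁅ wholeIx u i ⁆ ≡ ⁅ i ⁆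
    whole-⁅wholeIx⁆ u zero    = cong (true ∷_) (whole-replicate (u ∘ suc) false)
    whole-⁅wholeIx⁆ u (suc i) = cong (false ∷_) (whole-⁅wholeIx⁆ (u ∘ suc) i)

    lookup-wholeIx : ∀ {n} (u : Fin n → B) X i → lookup X (wholeIx u i) ≡ lookup (whole u X) i
    lookup-wholeIx u (x ∷ X) zero    = refl
    lookup-wholeIx u (x ∷ X) (suc i) = lookup-wholeIx (u ∘ suc) X i

    edge-wholeIx : ∀ {n} (u : Fin n → B) i → List.lookup (map f (tabulate u)) (wholeIx u i) ≡ f (u i)
    edge-wholeIx u zero    = refl
    edge-wholeIx u (suc i) = edge-wholeIx (u ∘ suc) i

    size-whole : ∀ {n} (u : Fin n → B) X → ∣ X ∣ ≡ ∣ whole u X ∣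
    size-whole {zero}  u []      = refl
    size-whole {suc n} u (x ∷ X) = trans (count-∷ x X) (trans (cong (β x +_) (size-whole (u ∘ suc) X)) (sym (count-∷ x (whole (u ∘ suc) X))))

    sum-whole : ∀ {n} (u : Fin n → B) (h : Subset n → Coeffs) k →
      sumₚ (allSubsets (length (map f (tabulate u)))) (λ X → h (whole u X)) k ≡ sumₚ (allSubsets n) h k
    sum-whole {zero}  u h k = refl
    sum-whole {suc n} u h k = trans (sum-allSubsets _ (λ X → h (whole u X)) k)
      (trans (cong₂ ℤ._+_ (sum-whole (u ∘ suc) (λ s → h (true ∷ s)) k) (sum-whole (u ∘ suc) (λ s → h (false ∷ s)) k))
             (sym (sum-allSubsets n h k)))

-- Connected components of subgraphs of the fan.

module FanGraph (m : ℕ) where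

  open import Data.Nat using (zero; suc; _≤_; _<_; z≤n; s≤s; _+_; _<ᵇ_)
  import Data.Nat.Properties as ℕₚ
  open import Data.Bool using (Bool; true; false; not; _∧_)
  open import Data.Bool.ListAction using (all)
  open import Data.Fin using (Fin; zero; suc; toℕ; inject₁)
  open import Data.Fin.Properties using (toℕ-inject₁)
  open import Data.Fin.Subset using (Subset; ⁅_⁆; ∣_∣; ⊥)
  open import Data.Fin.Subset.Properties using (x∈⁅x⁆; x∈⁅y⁆⇒x≡y)
  open import Data.List using (map; allFin; length)
  import Data.List as List
  open import Data.Vec using (Vec; lookup; zipWith; replicate)
  open import Data.Vec.Properties using ([]=⇒lookup; lookup⇒[]=)
  open import Data.Product using (∃; _×_; _,_; proj₁; proj₂)
  open import Data.Sum using (_⊎_; inj₁; inj₂)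
  open import Data.Empty using (⊥-elim)
  open import Function using (id; _∘_)
  open import Relation.Binary.PropositionalEquality
  open FanWords
  open FanComponents
  open EdgeCoding
  open KazhdanLusztig using (all-complete; <ᵇ-sound; <ᵇ-complete; sumₚ-cong)

  Vertex : Set
  Vertex = Fin (suc (suc m))

  spokeEdge : Fin (suc m) → Vertex × Vertex
  spokeEdge i = zero , suc i

  pathEdge : Fin m → Vertex × Vertex
  pathEdge j = suc (inject₁ j) , suc (suc j)

  G : Graph
  G = fan (suc m)

  pathEdges = map pathEdge (allFin m)

  open Prefix spokeEdge pathEdges
  open Whole pathEdge

  EdgeSet : Set
  EdgeSet = Subset (length (edges G))

  spokes : EdgeSet → Subset (suc m)
  spokes = front id

  paths : EdgeSet → Subset m
  paths X = whole id (back id X)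

  spokeIx : Fin (suc m) → Fin (length (edges G))
  spokeIx = frontIx id

  pathIx : Fin m → Fin (length (edges G))
  pathIx j = backIx id (wholeIx id j)

  edge-cover : ∀ e → (∃ λ i → e ≡ spokeIx i) ⊎ (∃ λ j → e ≡ pathIx j)
  edge-cover e with Ix-cover id e
  ... | inj₁ p = inj₁ p
  ... | inj₂ (e′ , refl) with wholeIx-cover id e′
  ...   | j , refl = inj₂ (j , refl)

  spokes-zipWith : ∀ op X Y → spokes (zipWith op X Y) ≡ zipWith op (spokes X) (spokes Y)
  spokes-zipWith = front-zipWith id

  paths-zipWith : ∀ op X Y → paths (zipWith op X Y) ≡ zipWith op (paths X) (paths Y)
  paths-zipWith op X Y = trans (cong (whole id) (back-zipWith id op X Y)) (whole-zipWith id op _ _)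

  spokes-replicate : ∀ b → spokes (replicate _ b) ≡ replicate _ b
  spokes-replicate = front-replicate id

  paths-replicate : ∀ b → paths (replicate _ b) ≡ replicate _ b
  paths-replicate b = trans (cong (whole id) (back-replicate id b)) (whole-replicate id b)

  spokes-⁅spokeIx⁆ : ∀ i → spokes ⁅ spokeIx i ⁆ ≡ ⁅ i ⁆
  spokes-⁅spokeIx⁆ = front-⁅frontIx⁆ id

  paths-⁅spokeIx⁆ : ∀ i → paths ⁅ spokeIx i ⁆ ≡ ⊥
  paths-⁅spokeIx⁆ i = trans (cong (whole id) (back-⁅frontIx⁆ id i)) (whole-replicate id false)

  spokes-⁅pathIx⁆ : ∀ j → spokes ⁅ pathIx j ⁆ ≡ ⊥
  spokes-⁅pathIx⁆ j = front-⁅backIx⁆ id _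

  paths-⁅pathIx⁆ : ∀ j → paths ⁅ pathIx j ⁆ ≡ ⁅ j ⁆
  paths-⁅pathIx⁆ j = trans (cong (whole id) (back-⁅backIx⁆ id _)) (whole-⁅wholeIx⁆ id j)

  lookup-spokeIx : ∀ X i → lookup X (spokeIx i) ≡ lookup (spokes X) i
  lookup-spokeIx = lookup-frontIx id

  lookup-pathIx : ∀ X j → lookup X (pathIx j) ≡ lookup (paths X) j
  lookup-pathIx X j = trans (lookup-backIx id X _) (lookup-wholeIx id _ j)

  edge-spokeIx : ∀ i → List.lookup (edges G) (spokeIx i) ≡ spokeEdge i
  edge-spokeIx = edge-frontIx id

  edge-pathIx : ∀ j → List.lookup (edges G) (pathIx j) ≡ pathEdge j
  edge-pathIx j = trans (edge-backIx id _) (edge-wholeIx id j)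

  size-edges : ∀ X → ∣ X ∣ ≡ ∣ spokes X ∣ + ∣ paths X ∣
  size-edges X = trans (size-split id X) (cong (∣ spokes X ∣ +_) (size-whole id _))

  sum-edges : ∀ (h : Subset (suc m) → Subset m → Coeffs) k → sumₚ (allSubsets (length (edges G))) (λ X → h (spokes X) (paths X)) k
    ≡ sumₚ (allSubsets (suc m)) (λ s → sumₚ (allSubsets m) (h s)) k
  sum-edges h k = trans (sum-split id (λ s r → h s (whole id r)) k)
    (sumₚ-cong (allSubsets (suc m)) (λ s → sumₚ (allSubsets (length pathEdges)) (λ r → h s (whole id r))) (λ s → sumₚ (allSubsets m) (h s)) k (λ s → sum-whole id (h s) k))

  least : (Vertex → Bool) → Vertex → Bool
  least r v = all (λ w → not ((toℕ w <ᵇ toℕ v) ∧ r w)) (allFin (suc (suc m)))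

  least-false : ∀ r v w → toℕ w < toℕ v → r w ≡ true → least r v ≡ false
  least-false r v w w<v w∈ = all-false (λ w → not ((toℕ w <ᵇ toℕ v) ∧ r w)) id w (cong₂ (λ a b → not (a ∧ b)) (<ᵇ-complete w<v) w∈)

  least-true : ∀ r v → (∀ w → r w ≡ true → toℕ v ≤ toℕ w) → least r v ≡ true
  least-true r v h = all-complete (λ w → not ((toℕ w <ᵇ toℕ v) ∧ r w)) id λ w → outside w (toℕ w <ᵇ toℕ v) (r w) refl refl
    where
    outside : ∀ w a b → (toℕ w <ᵇ toℕ v) ≡ a → r w ≡ b → not (a ∧ b) ≡ true
    outside w false b     _   _  = refl
    outside w true  false _   _  = refl
    outside w true  true  w<v w∈ = ⊥-elim (ℕₚ.<⇒≱ (<ᵇ-sound w<v) (h w w∈))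

  module _ (X : EdgeSet) where

    search : ℕ → Vertex → Subset (suc (suc m))
    search n v = iter n (step G X) ⁅ v ⁆

    found : Vertex → Vertex → Bool
    found v = lookup (search (suc (suc m)) v)

    minimal : Vertex → Bool
    minimal v = least (found v) v

    spoke-step : ∀ R i → lookup (spokes X) i ≡ true → lookup R (suc i) ≡ true → lookup (step G X R) zero ≡ true
    spoke-step R i h = proj₂ (step-edge G X R (spokeIx i) zero (suc i) (trans (lookup-spokeIx X i) h) (edge-spokeIx i))

    path-step : ∀ R j → lookup (paths X) j ≡ true →
      (lookup R (suc (inject₁ j)) ≡ true → lookup (step G X R) (suc (suc j)) ≡ true) ×
      (lookup R (suc (suc j)) ≡ true → lookup (step G X R) (suc (inject₁ j)) ≡ true)
    path-step R j h = step-edge G X R (pathIx j) (suc (inject₁ j)) (suc (suc j)) (trans (lookup-pathIx X j) h) (edge-pathIx j)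

    hits-search : ∀ {i n} → Hits (spokes X) (paths X) i n → ∀ k v → lookup (search k v) (suc i) ≡ true → lookup (search (n + k) v) zero ≡ true
    hits-search (here {i} h) k v r = spoke-step (search k v) i h r
    hits-search (there {j} {n} h rest) k v r = subst (λ l → lookup (search l v) zero ≡ true) (ℕₚ.+-suc n k)
      (hits-search rest (suc k) v (proj₁ (path-step (search k v) j h) r))

    start : ∀ v → lookup (search 0 v) v ≡ true
    start v = []=⇒lookup (x∈⁅x⁆ v)

    search-keep : ∀ {k} v w → k ≤ suc (suc m) → lookup (search k v) w ≡ true → lookup (search (suc (suc m)) v) w ≡ true
    search-keep v w = iter-keep G X (suc (suc m)) ⁅ v ⁆ w

    minimal-notRoot : ∀ i → NotRoot false (spokes X) (paths X) i → minimal (suc i) ≡ false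
    minimal-notRoot _ (incoming j h) = least-false (found (suc (suc j))) (suc (suc j)) (suc (inject₁ j))
      (s≤s (subst (_< suc (toℕ j)) (sym (toℕ-inject₁ j)) ℕₚ.≤-refl))
      (search-keep {1} (suc (suc j)) (suc (inject₁ j)) (s≤s z≤n) (proj₂ (path-step (search 0 (suc (suc j))) j h) (start (suc (suc j)))))
    minimal-notRoot i (spoked n n≤ r) = least-false (found (suc i)) (suc i) zero (s≤s z≤n)
      (search-keep {n + 0} (suc i) zero (ℕₚ.≤-trans (ℕₚ.≤-reflexive (ℕₚ.+-identityʳ n)) (ℕₚ.m≤n⇒m≤1+n n≤))
        (hits-search r 0 (suc i) (start (suc i))))

    module _ (i : Fin (suc m)) (root : isRoot false (spokes X) (paths X) i ≡ true) where

      -- The invariant that confines the search from a root to its interval, away from 0 and from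
      -- all smaller vertices.
      I : Vertex → Bool
      I zero    = false
      I (suc k) = inInterval (paths X) i k

      I-spoke : ∀ k → lookup (spokes X) k ≡ true → inInterval (paths X) i k ≡ false
      I-spoke k h with inInterval (paths X) i k in e
      ... | false = refl
      ... | true with trans (sym h) (root-no-spoke false (spokes X) (paths X) i root k e)
      ...   | ()

      I-closed : ∀ e → lookup X e ≡ true → I (proj₁ (List.lookup (edges G) e)) ≡ I (proj₂ (List.lookup (edges G) e))
      I-closed e e∈X with edge-cover e
      ... | inj₁ (k , refl) rewrite edge-spokeIx k = sym (I-spoke k (trans (sym (lookup-spokeIx X k)) e∈X))
      ... | inj₂ (j , refl) rewrite edge-pathIx j = root-path false (spokes X) (paths X) i root j (trans (sym (lookup-pathIx X j)) e∈X)

      I-initial : ∀ w → lookup ⁅ suc i ⁆ w ≡ true → I w ≡ true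
      I-initial w h with x∈⁅y⁆⇒x≡y (suc i) (lookup⇒[]= w ⁅ suc i ⁆ h)
      ... | refl = inInterval-refl (paths X) i

      I-≥ : ∀ w → I w ≡ true → toℕ (suc i) ≤ toℕ w
      I-≥ (suc k) h = s≤s (inInterval-≤ (paths X) i k h)

      minimal-root : minimal (suc i) ≡ true
      minimal-root = least-true (found (suc i)) (suc i) λ w w∈ → I-≥ w (iter-inside G X I I-closed (suc (suc m)) ⁅ suc i ⁆ I-initial w w∈)

    minimal-suc : ∀ i b → isRoot false (spokes X) (paths X) i ≡ b → minimal (suc i) ≡ b
    minimal-suc i false h = minimal-notRoot i (notRoot false (spokes X) (paths X) i h)
    minimal-suc i true  h = minimal-root i h

    -- The additional component is that of 0, with 0 as least vertex; every other one is a spokeless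
    -- interval, counted at its left end.
    components≡ : components G X ≡ suc (cork false (spokes X) (paths X))
    components≡ = begin
      components G X ≡⟨ length-filter (suc (suc m)) minimal id ⟩
      β (minimal zero) + count (suc m) (minimal ∘ suc)
        ≡⟨ cong₂ _+_ (cong β (least-true (found zero) zero (λ _ _ → z≤n))) (count-cong (suc m) (λ i → minimal-suc i _ refl)) ⟩
      suc (count (suc m) (isRoot false (spokes X) (paths X))) ≡⟨ cong suc (count-first (spokes X) (paths X)) ⟨
      suc (β (hasNoSpoke (spokes X) (paths X)) + count (suc m) (isRoot true (spokes X) (paths X))) ≡⟨ cong suc (cork≡count false (spokes X) (paths X)) ⟨
      suc (cork false (spokes X) (paths X)) ∎
      where open ≡-Reasoning

-- Reversal and degree of the guess at a flat.

module FanRecursion where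

  open import Data.Nat using (zero; suc; _≡ᵇ_) renaming (_+_ to _+ℕ_)
  import Data.Nat.Properties as ℕₚ
  open import Data.Integer using (ℤ; +_)
  import Data.Integer as ℤ
  import Data.Integer.Properties as ℤₚ
  open import Algebra.Properties.CommutativeSemigroup ℤₚ.+-commutativeSemigroup using (interchange)
  open import Data.Bool using (Bool; true; false; not; _∧_; _∨_; if_then_else_)
  open import Data.Fin using (Fin; zero; suc)
  open import Data.Fin.Subset using (Subset; _∪_; ⊥)
  open import Data.List using (List; []; _∷_)
  open import Data.Vec using ([]; _∷_; lookup)
  open import Relation.Binary.PropositionalEquality
  open FanWords
  open Reversal
  open EdgeCoding using (sum-allSubsets)
  open Transfer Poly.commutativeRing ℤ⟶Poly t public
  open CharacteristicSum Poly.commutativeRing ℤ⟶Poly t public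
  open KazhdanLusztig using (sumₚ-cong)
  open Poly

  sum-words : ∀ m (h : Subset (suc m) → Subset m → Coeffs) k →
    sumₚ (allSubsets (suc m)) (λ s → sumₚ (allSubsets m) (h s)) k ≡ ∑ m h k
  sum-words zero h k = cong₂ ℤ._+_ (ℤₚ.+-identityʳ (h (true ∷ []) [] k))
    (trans (ℤₚ.+-identityʳ _) (ℤₚ.+-identityʳ (h (false ∷ []) [] k)))
  sum-words (suc m) h k = trans (sum-allSubsets (suc m) (λ s → sumₚ (allSubsets (suc m)) (h s)) k)
    (cong₂ ℤ._+_ (half true) (half false))
    where
    sum-⊞ : {A : Set} (xs : List A) (f g : A → Coeffs) → sumₚ xs (λ x → f x ⊞ g x) k ≡ sumₚ xs f k ℤ.+ sumₚ xs g k
    sum-⊞ []       f g = refl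
    sum-⊞ (x ∷ xs) f g = trans (cong (λ z → f x k ℤ.+ g x k ℤ.+ z) (sum-⊞ xs f g)) (interchange (f x k) (g x k) _ _)
    half : ∀ x → sumₚ (allSubsets (suc m)) (λ s → sumₚ (allSubsets (suc m)) (h (x ∷ s))) k ≡
      ∑ m (λ s p → h (x ∷ s) (true ∷ p)) k ℤ.+ ∑ m (λ s p → h (x ∷ s) (false ∷ p)) k
    half x = begin
      sumₚ (allSubsets (suc m)) (λ s → sumₚ (allSubsets (suc m)) (h (x ∷ s))) k
        ≡⟨ sumₚ-cong (allSubsets (suc m)) (λ s → sumₚ (allSubsets (suc m)) (h (x ∷ s))) (λ s → A s ⊞ B s) k (λ s → sum-allSubsets m (h (x ∷ s)) k) ⟩
      sumₚ (allSubsets (suc m)) (λ s → A s ⊞ B s) k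
        ≡⟨ sum-⊞ (allSubsets (suc m)) A B ⟩
      sumₚ (allSubsets (suc m)) A k ℤ.+ sumₚ (allSubsets (suc m)) B k
        ≡⟨ cong₂ ℤ._+_ (sum-words m (λ s p → h (x ∷ s) (true ∷ p)) k) (sum-words m (λ s p → h (x ∷ s) (false ∷ p)) k) ⟩
      _ ∎
      where
      open ≡-Reasoning
      A B : Subset (suc m) → Coeffs
      A s = sumₚ (allSubsets m) (λ p → h (x ∷ s) (true ∷ p))
      B s = sumₚ (allSubsets m) (λ p → h (x ∷ s) (false ∷ p))

  sgn≋ : ∀ n → sgn n ≋ const (sign n)
  sgn≋ zero    k = refl
  sgn≋ (suc n) k = trans (cong ℤ.-_ (sgn≋ n k)) (sym (const-neg (sign n) k))

  pow-coeff : ∀ e k → pow e k ≡ (if e ≡ᵇ k then + 1 else + 0)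
  pow-coeff zero    zero    = refl
  pow-coeff zero    (suc k) = refl
  pow-coeff (suc e) zero    = t-⊛ (pow e) zero
  pow-coeff (suc e) (suc k) = trans (t-⊛ (pow e) (suc k)) (pow-coeff e k)

  sgn-pow : ∀ n e k → (if e ≡ᵇ k then sign n else + 0) ≡ (sgn n ⊛ pow e) k
  sgn-pow n e k = sym (begin
    (sgn n ⊛ pow e) k                          ≡⟨ ⊛-cong {g = pow e} (sgn≋ n) (λ _ → refl) k ⟩
    (const (sign n) ⊛ pow e) k                 ≡⟨ const-⊛ (sign n) (pow e) k ⟩
    sign n ℤ.* pow e k                         ≡⟨ cong (sign n ℤ.*_) (pow-coeff e k) ⟩
    sign n ℤ.* (if e ≡ᵇ k then + 1 else + 0)   ≡⟨ pull (e ≡ᵇ k) ⟩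
    (if e ≡ᵇ k then sign n else + 0)           ∎)
    where
    open ≡-Reasoning
    pull : ∀ b → sign n ℤ.* (if b then + 1 else + 0) ≡ (if b then sign n else + 0)
    pull true  = ℤₚ.*-identityʳ (sign n)
    pull false = ℤₚ.*-zeroʳ (sign n)

  laterDegree : ∀ {m} → Subset (suc m) → Subset m → ℕ
  laterDegree (true ∷ s)  (q ∷ p) = firstRun s p +ℕ laterDegree s p
  laterDegree (false ∷ s) (q ∷ p) = laterDegree s p
  laterDegree (x ∷ [])    []      = 0

  -- In a flat the spokeless intervals are those of the runs, so the degrees in which the factors
  -- are reversed add up to the corank.
  cork-runs : ∀ {m} (s : Subset (suc m)) p → flatᵇ s p ≡ true → cork false s p ≡ firstRun s p +ℕ laterDegree s p
  cork-runs (true ∷ [])         []          h = refl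
  cork-runs (false ∷ [])        []          h = refl
  cork-runs (false ∷ false ∷ s) (true ∷ p)  h = cork-runs (false ∷ s) p h
  cork-runs (false ∷ y ∷ s)     (false ∷ p) h = cong suc (cork-runs (y ∷ s) p h)
  cork-runs (true ∷ true ∷ s)   (true ∷ p)  h = trans (cork-joined (true ∷ s) p refl) (cork-runs (true ∷ s) p h)
  cork-runs (true ∷ false ∷ s)  (false ∷ p) h = cork-runs (false ∷ s) p h

  laterRuns-reverse : ∀ {m} (s : Subset (suc m)) p → Reverse (laterDegree s p) (laterRuns fanPoly s p) (laterRuns fanPolyRev s p)
  laterRuns-reverse (true ∷ s)   (q ∷ p) = Reverse-* (firstRun s p) (fanPoly-reverse (firstRun s p)) (laterRuns-reverse s p)
  laterRuns-reverse (false ∷ s)  (q ∷ p) = laterRuns-reverse s p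
  laterRuns-reverse (true ∷ [])  []      = Reverse-const (+ 1)
  laterRuns-reverse (false ∷ []) []      = Reverse-const (+ 1)

  laterRuns-admissible : ∀ {m} (s : Subset (suc m)) p → Admissible (laterDegree s p) (laterRuns fanPoly s p)
  laterRuns-admissible (true ∷ s)   (q ∷ p) = Admissible-* (firstRun s p) (laterDegree s p) (fanPoly-admissible (firstRun s p)) (laterRuns-admissible s p)
  laterRuns-admissible (false ∷ s)  (q ∷ p) = laterRuns-admissible s p
  laterRuns-admissible (true ∷ [])  []      = λ _ → refl
  laterRuns-admissible (false ∷ []) []      = λ _ → refl

  Admissible-cong : ∀ d {f g} → f ≋ g → Admissible d f → Admissible d g
  Admissible-cong zero    p a k   = trans (sym (p k)) (a k)
  Admissible-cong (suc d) p a k h = trans (sym (p k)) (a k h)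

  -- The Kazhdan-Lusztig recursion in terms of words: both sides are products over the runs, and
  -- they reverse factor by factor.
  fanProduct-reverse : ∀ {m} (s : Subset (suc m)) p → flatᵇ s p ≡ true → Reverse (cork false s p) (fanProduct 0 s p) (flatSum free false 0 s p)
  fanProduct-reverse s p h rewrite cork-runs s p h = Reverse-cong
    (λ k → sym (fanProduct≈ 0 s p k)) (λ k → sym (flatSum-total s p h k))
    (Reverse-* (firstRun s p) (fanPoly-reverse (firstRun s p)) (laterRuns-reverse s p))

  fanProduct-admissible : ∀ {m} (s : Subset (suc m)) p → flatᵇ s p ≡ true → Admissible (cork false s p) (fanProduct 0 s p)
  fanProduct-admissible s p h rewrite cork-runs s p h = Admissible-cong (firstRun s p +ℕ laterDegree s p)
    (λ k → sym (fanProduct≈ 0 s p k))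
    (Admissible-* (firstRun s p) (laterDegree s p) (fanPoly-admissible (firstRun s p)) (laterRuns-admissible s p))

  fanProduct-⊥ : ∀ m j → fanProduct {m} j ⊥ ⊥ ≡ fanPoly (j +ℕ suc m)
  fanProduct-⊥ zero    j = cong fanPoly (ℕₚ.+-comm 1 j)
  fanProduct-⊥ (suc m) j = trans (fanProduct-⊥ m (suc j)) (cong fanPoly (sym (ℕₚ.+-suc j (suc m))))

  flatᵇ-⊥ : ∀ m → flatᵇ {m} ⊥ ⊥ ≡ true
  flatᵇ-⊥ zero    = refl
  flatᵇ-⊥ (suc m) = flatᵇ-⊥ m

  disjointᵇ : ∀ {n} → Subset n → Subset n → Bool
  disjointᵇ []      []      = true
  disjointᵇ (x ∷ X) (y ∷ Y) = not (x ∧ y) ∧ disjointᵇ X Y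

  disjointᵇ-complete : ∀ {n} (X Y : Subset n) → (∀ i → lookup X i ≡ true → lookup Y i ≡ false) → disjointᵇ X Y ≡ true
  disjointᵇ-complete []          []      h = refl
  disjointᵇ-complete (false ∷ X) (y ∷ Y) h = disjointᵇ-complete X Y (λ i → h (suc i))
  disjointᵇ-complete (true ∷ X)  (y ∷ Y) h rewrite h zero refl = disjointᵇ-complete X Y (λ i → h (suc i))

  disjointᵇ-sound : ∀ {n} (X Y : Subset n) → disjointᵇ X Y ≡ true → ∀ i → lookup X i ≡ true → lookup Y i ≡ false
  disjointᵇ-sound (true ∷ X) (false ∷ Y) h zero    _ = refl
  disjointᵇ-sound (x ∷ X)    (y ∷ Y)     h (suc i) e = disjointᵇ-sound X Y (∧-trueʳ (not (x ∧ y)) h) i e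

  subᵇ-complete : ∀ {n} (X Y : Subset n) → (∀ i → lookup X i ≡ true → lookup Y i ≡ true) → subᵇ X Y ≡ true
  subᵇ-complete []          []      h = refl
  subᵇ-complete (false ∷ X) (y ∷ Y) h = subᵇ-complete X Y (λ i → h (suc i))
  subᵇ-complete (true ∷ X)  (y ∷ Y) h rewrite h zero refl = subᵇ-complete X Y (λ i → h (suc i))

  subᵇ-sound : ∀ {n} (X Y : Subset n) → subᵇ X Y ≡ true → ∀ i → lookup X i ≡ true → lookup Y i ≡ true
  subᵇ-sound (true ∷ X) (true ∷ Y) h zero    _ = refl
  subᵇ-sound (x ∷ X)    (y ∷ Y)    h (suc i) e = subᵇ-sound X Y (∧-trueʳ (x ⇒ y) h) i e

  valid≡ : ∀ {m} σ (fs : Subset (suc m)) fp hs hp →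
    valid σ fs fp hs hp ≡ (disjointᵇ hs fs ∧ disjointᵇ hp fp) ∧ admits σ (hs ∪ fs) (hp ∪ fp)
  valid≡ σ (f ∷ []) [] (h ∷ []) [] with not (h ∧ f)
  ... | true  = refl
  ... | false = refl
  valid≡ σ (f ∷ fs) (a ∷ fp) (h ∷ hs) (b ∷ hp) = trans
    (cong (λ z → (not (h ∧ f) ∧ not (b ∧ a)) ∧ (allows σ (h ∨ f) ∧ z)) (valid≡ (next (h ∨ f) (b ∨ a)) fs fp hs hp))
    (shuffle (not (h ∧ f)) (not (b ∧ a)) (allows σ (h ∨ f)) (disjointᵇ hs fs) (disjointᵇ hp fp) _)
    where
    shuffle : ∀ A B C D D′ E → (A ∧ B) ∧ (C ∧ ((D ∧ D′) ∧ E)) ≡ ((A ∧ D) ∧ (B ∧ D′)) ∧ (C ∧ E)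
    shuffle false _     _     _     _     _ = refl
    shuffle true  false _     true  _     _ = refl
    shuffle true  false _     false _     _ = refl
    shuffle true  true  true  D     D′    E = refl
    shuffle true  true  false true  true  E = refl
    shuffle true  true  false true  false E = refl
    shuffle true  true  false false _     E = refl

-- The cycle matroid of the fan and its Kazhdan-Lusztig polynomial.

module FanMatroid (m : ℕ) where

  open import Data.Nat using (suc; _∸_; _≤_; _<_; _≡ᵇ_) renaming (_+_ to _+ℕ_)
  import Data.Nat.Properties as ℕₚ
  open import Data.Integer using (+_)
  open import Data.Bool using (Bool; true; false; _∧_; _∨_; if_then_else_)
  open import Data.Fin using (Fin)
  open import Data.Fin.Subset using (Subset; _⊆_; _∉_; _∪_; _∩_; ⁅_⁆; ∣_∣; ⊤; ⊥)
  open import Data.Fin.Subset.Properties using (⊆-antisym; q⊆p∪q; p⊆p∪q; ∪-identityʳ; ∈⊤; ⊆⊤; ∪-assoc; ∪-comm; x∈p∧x∉q⇒x∈p─q; x∈p∪q⁻)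
  open import Data.Vec using (lookup)
  open import Data.Vec.Properties using ([]=⇒lookup; lookup⇒[]=)
  open import Data.List using (length)
  open import Data.Product using (_,_)
  open import Data.Sum using (inj₁; inj₂; [_,_]′)
  open import Data.Empty using (⊥-elim)
  open import Data.Unit using (tt)
  open import Function using (id; _∘_)
  open import Relation.Binary.PropositionalEquality
  open FanWords
  open Reversal using (Reverse⇒rev)
  open FanGraph m
  open FanRecursion
  open GeneratingFunction using (*ₚ≡⊛)
  open KazhdanLusztig
  private module P = Poly

  ∧-trueˡ : ∀ {a b} → a ∧ b ≡ true → a ≡ true
  ∧-trueˡ {true} _ = refl

  iff : ∀ {a b} → (a ≡ true → b ≡ true) → (b ≡ true → a ≡ true) → a ≡ b
  iff {true}  {b}     f g = sym (f refl)
  iff {false} {false} f g = refl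
  iff {false} {true}  f g = g refl

  edgeSets = allSubsets (length (edges G))

  corank : EdgeSet → ℕ
  corank X = cork false (spokes X) (paths X)

  corank-≤ : ∀ X → corank X ≤ suc m
  corank-≤ X = cork-≤ false (spokes X) (paths X)

  corank-∪ : ∀ X Y → corank (X ∪ Y) ≡ cork false (spokes X ∪ spokes Y) (paths X ∪ paths Y)
  corank-∪ X Y = cong₂ (cork false) (spokes-zipWith _∨_ X Y) (paths-zipWith _∨_ X Y)

  corank-antitone : ∀ X Y → X ⊆ Y → corank Y ≤ corank X
  corank-antitone X Y X⊆Y = subst (λ Z → corank Z ≤ corank X) (⊆-antisym (∪-⊆ X⊆Y id) (q⊆p∪q X Y))
    (subst (_≤ corank X) (sym (corank-∪ X Y)) (cork-antitone false false (spokes X) (spokes Y) (paths X) (paths Y) tt))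

  -- The rank function is prescribed by its values only, since `P` is finally evaluated at the rank
  -- function of `cycleMatroid` itself.
  module Rank (rkᴳ : EdgeSet → ℕ) (rk≡ : ∀ X → rkᴳ X ≡ suc m ∸ corank X) where

    M = mkM (length (edges G)) ⊤ rkᴳ

    rk-mono : ∀ X Y → X ⊆ Y → rk M X ≤ rk M Y
    rk-mono X Y X⊆Y = subst₂ _≤_ (sym (rk≡ X)) (sym (rk≡ Y)) (ℕₚ.∸-monoʳ-≤ (suc m) (corank-antitone X Y X⊆Y))

    ∸-supermodular : ∀ {n a b c d} → a ≤ n → b ≤ n → c ≤ n → d ≤ n → c +ℕ d ≤ a +ℕ b → (n ∸ a) +ℕ (n ∸ b) ≤ (n ∸ c) +ℕ (n ∸ d)
    ∸-supermodular {n} {a} {b} {c} {d} a≤ b≤ c≤ d≤ h = ℕₚ.+-cancelʳ-≤ (a +ℕ b) _ _ (begin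
      (n ∸ a) +ℕ (n ∸ b) +ℕ (a +ℕ b)   ≡⟨ interchange (n ∸ a) (n ∸ b) a b ⟩
      ((n ∸ a) +ℕ a) +ℕ ((n ∸ b) +ℕ b) ≡⟨ cong₂ _+ℕ_ (ℕₚ.m∸n+n≡m a≤) (ℕₚ.m∸n+n≡m b≤) ⟩
      n +ℕ n ≡⟨ cong₂ _+ℕ_ (ℕₚ.m∸n+n≡m c≤) (ℕₚ.m∸n+n≡m d≤) ⟨
      ((n ∸ c) +ℕ c) +ℕ ((n ∸ d) +ℕ d) ≡⟨ interchange (n ∸ c) c (n ∸ d) d ⟩
      (n ∸ c) +ℕ (n ∸ d) +ℕ (c +ℕ d)   ≤⟨ ℕₚ.+-monoʳ-≤ ((n ∸ c) +ℕ (n ∸ d)) h ⟩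
      (n ∸ c) +ℕ (n ∸ d) +ℕ (a +ℕ b)   ∎)
      where
      open ℕₚ.≤-Reasoning
      open import Algebra.Properties.CommutativeSemigroup ℕₚ.+-commutativeSemigroup using (interchange)

    isMatroid : IsMatroid M
    isMatroid = record
      { R1 = λ X _ → subst (_≤ ∣ X ∣) (sym (rk≡ X)) (ℕₚ.m≤n+o⇒m∸n≤o (suc m) (corank X)
          (subst (λ z → suc m ≤ corank X +ℕ z) (sym (size-edges X)) (cork+size false (spokes X) (paths X))))
      ; R2 = λ X Y X⊆Y _ → rk-mono X Y X⊆Y
      ; R3 = λ X Y _ _ → subst₂ _≤_ (sym (cong₂ _+ℕ_ (rk≡ (X ∪ Y)) (rk≡ (X ∩ Y)))) (sym (cong₂ _+ℕ_ (rk≡ X) (rk≡ Y)))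
          (∸-supermodular (corank-≤ (X ∪ Y)) (corank-≤ (X ∩ Y)) (corank-≤ X) (corank-≤ Y)
            (subst₂ (λ u i → corank X +ℕ corank Y ≤ u +ℕ i) (sym (corank-∪ X Y))
              (sym (cong₂ (cork false) (spokes-zipWith _∧_ X Y) (paths-zipWith _∧_ X Y)))
              (subst (corank X +ℕ corank Y ≤_) (ℕₚ.+-identityʳ _)
                (cork-supermodular false false false false (spokes X) (spokes Y) (paths X) (paths Y) tt)))) }

    corank-add-spoke : ∀ F i → corank (F ∪ ⁅ spokeIx i ⁆) ≡ cork false (spokes F ∪ ⁅ i ⁆) (paths F)
    corank-add-spoke F i = trans (corank-∪ F ⁅ spokeIx i ⁆) (cong₂ (cork false)
      (cong (spokes F ∪_) (spokes-⁅spokeIx⁆ i))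
      (trans (cong (paths F ∪_) (paths-⁅spokeIx⁆ i)) (∪-identityʳ (paths F))))

    corank-add-path : ∀ F j → corank (F ∪ ⁅ pathIx j ⁆) ≡ cork false (spokes F) (paths F ∪ ⁅ j ⁆)
    corank-add-path F j = trans (corank-∪ F ⁅ pathIx j ⁆) (cong₂ (cork false)
      (trans (cong (spokes F ∪_) (spokes-⁅pathIx⁆ j)) (∪-identityʳ (spokes F)))
      (cong (paths F ∪_) (paths-⁅pathIx⁆ j)))

    flatᵇ⇒Flat : ∀ F → flatᵇ (spokes F) (paths F) ≡ true → Flat M F
    flatᵇ⇒Flat F h = record { ⊆E = ⊆⊤ ; closed = λ e _ e∉F → grows e e∉F (edge-cover e) }
      where
      rk-< : ∀ Y → corank Y < corank F → rk M F < rk M Y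
      rk-< Y lt = subst₂ _<_ (sym (rk≡ F)) (sym (rk≡ Y)) (ℕₚ.∸-monoʳ-< lt (corank-≤ F))
      grows : ∀ e → e ∉ F → _ → rk M F < rk M (F ∪ ⁅ e ⁆)
      grows e e∉F (inj₁ (i , refl)) = rk-< _ (subst (_< corank F) (sym (corank-add-spoke F i))
        (closed-spoke false (spokes F) (paths F) h (λ ()) i (trans (sym (lookup-spokeIx F i)) (∉⇒false e∉F))))
      grows e e∉F (inj₂ (j , refl)) = rk-< _ (subst (_< corank F) (sym (corank-add-path F j))
        (closed-path false (spokes F) (paths F) h (λ ()) j (trans (sym (lookup-pathIx F j)) (∉⇒false e∉F))))

    Flat⇒flatᵇ : ∀ F → Flat M F → flatᵇ (spokes F) (paths F) ≡ true
    Flat⇒flatᵇ F fl = decide _ refl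
      where
      no-growth : ∀ e → lookup F e ≡ false → corank (F ∪ ⁅ e ⁆) ≢ corank F
      no-growth e e∉F eq = ℕₚ.<-irrefl (trans (rk≡ F) (trans (cong (suc m ∸_) (sym eq)) (sym (rk≡ (F ∪ ⁅ e ⁆)))))
        (Flat.closed fl e ∈⊤ (false⇒∉ e∉F))
      decide : ∀ b → flatᵇ (spokes F) (paths F) ≡ b → flatᵇ (spokes F) (paths F) ≡ true
      decide true  h = h
      decide false h with not-closed false (spokes F) (paths F) h
      ... | inj₁ (i , i∉ , eq) = ⊥-elim (no-growth (spokeIx i) (trans (lookup-spokeIx F i) i∉) (trans (corank-add-spoke F i) eq))
      ... | inj₂ (j , j∉ , eq) = ⊥-elim (no-growth (pathIx j) (trans (lookup-pathIx F j) j∉) (trans (corank-add-path F j) eq))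

    by-edges : (Q : Fin (length (edges G)) → Set) → (∀ i → Q (spokeIx i)) → (∀ j → Q (pathIx j)) → ∀ e → Q e
    by-edges Q s p e with edge-cover e
    ... | inj₁ (i , refl) = s i
    ... | inj₂ (j , refl) = p j

    ⊆ᵇ≡subᵇ : ∀ X H → X ⊆ᵇ H ≡ subᵇ (spokes X) (spokes H) ∧ subᵇ (paths X) (paths H)
    ⊆ᵇ≡subᵇ X H = iff
      (λ h → let X⊆H = ⊆ᵇ-sound {X = X} {H} h
                 at = λ e e∈X → []=⇒lookup (X⊆H (lookup⇒[]= e X e∈X)) in
        cong₂ _∧_
          (subᵇ-complete (spokes X) (spokes H) (λ i e → trans (sym (lookup-spokeIx H i)) (at (spokeIx i) (trans (lookup-spokeIx X i) e))))
          (subᵇ-complete (paths X) (paths H) (λ j e → trans (sym (lookup-pathIx H j)) (at (pathIx j) (trans (lookup-pathIx X j) e)))))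
      (λ h → ⊆ᵇ-complete {X = X} {H} (λ {e} e∈X → lookup⇒[]= e H (by-edges (λ e → lookup X e ≡ true → lookup H e ≡ true)
          (λ i e∈ → trans (lookup-spokeIx H i) (subᵇ-sound (spokes X) (spokes H) (∧-trueˡ h) i (trans (sym (lookup-spokeIx X i)) e∈)))
          (λ j e∈ → trans (lookup-pathIx H j) (subᵇ-sound (paths X) (paths H) (∧-trueʳ _ h) j (trans (sym (lookup-pathIx X j)) e∈)))
          e ([]=⇒lookup e∈X))))

    validᵇ : EdgeSet → EdgeSet → Bool
    validᵇ F H = valid free (spokes F) (paths F) (spokes H) (paths H)

    validᵇ≡ : ∀ F H → validᵇ F H ≡
      (disjointᵇ (spokes H) (spokes F) ∧ disjointᵇ (paths H) (paths F)) ∧ flatᵇ (spokes (H ∪ F)) (paths (H ∪ F))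
    validᵇ≡ F H = trans (valid≡ free (spokes F) (paths F) (spokes H) (paths H)) (cong ((disjointᵇ (spokes H) (spokes F) ∧ disjointᵇ (paths H) (paths F)) ∧_)
      (trans (sym (flatᵇ≡admits (spokes H ∪ spokes F) (paths H ∪ paths F)))
        (sym (cong₂ flatᵇ (spokes-zipWith _∨_ H F) (paths-zipWith _∨_ H F)))))

    -- Adding an element raises the rank of `H` in the contraction exactly when it raises that of
    -- `H ∪ F` in M.
    isFlat≡valid : ∀ F → Flat M F → ∀ H → isFlat (con M F) H ≡ validᵇ F H
    isFlat≡valid F fl H = iff forwards backwards
      where
      forwards : isFlat (con M F) H ≡ true → validᵇ F H ≡ true
      forwards h = trans (validᵇ≡ F H) (cong₂ _∧_ (cong₂ _∧_
          (disjointᵇ-complete (spokes H) (spokes F) (λ i e → trans (sym (lookup-spokeIx F i)) (apart (spokeIx i) (trans (lookup-spokeIx H i) e))))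
          (disjointᵇ-complete (paths H) (paths F) (λ j e → trans (sym (lookup-pathIx F j)) (apart (pathIx j) (trans (lookup-pathIx H j) e)))))
          (Flat⇒flatᵇ (H ∪ F) (∪-flat M isMatroid F fl H flH)))
        where
        flH = isFlat-sound (con M F) H h
        apart : ∀ e → lookup H e ≡ true → lookup F e ≡ false
        apart e e∈H = ∉⇒false (∈─⇒∉ ⊤ F (Flat.⊆E flH (lookup⇒[]= e H e∈H)))
      backwards : validᵇ F H ≡ true → isFlat (con M F) H ≡ true
      backwards h = isFlat-complete (con M F) H (record
        { ⊆E = λ {e} e∈H → x∈p∧x∉q⇒x∈p─q ∈⊤ (false⇒∉ (apart e ([]=⇒lookup e∈H)))
        ; closed = λ e e∈ e∉H → ℕₚ.∸-monoˡ-< (subst (λ Y → rkᴳ (H ∪ F) < rkᴳ Y) (swap e)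
            (Flat.closed flat∪ e ∈⊤ ([ e∉H , ∈─⇒∉ ⊤ F e∈ ]′ ∘ x∈p∪q⁻ H F)))
            (rk-mono F (H ∪ F) (q⊆p∪q H F)) })
        where
        parts : (disjointᵇ (spokes H) (spokes F) ∧ disjointᵇ (paths H) (paths F)) ∧ flatᵇ (spokes (H ∪ F)) (paths (H ∪ F)) ≡ true
        parts = trans (sym (validᵇ≡ F H)) h
        flat∪ : Flat M (H ∪ F)
        flat∪ = flatᵇ⇒Flat (H ∪ F) (∧-trueʳ _ parts)
        apart : ∀ e → lookup H e ≡ true → lookup F e ≡ false
        apart = by-edges (λ e → lookup H e ≡ true → lookup F e ≡ false)
          (λ i e∈ → trans (lookup-spokeIx F i) (disjointᵇ-sound (spokes H) (spokes F) (∧-trueˡ (∧-trueˡ parts)) i (trans (sym (lookup-spokeIx H i)) e∈)))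
          (λ j e∈ → trans (lookup-pathIx F j) (disjointᵇ-sound (paths H) (paths F) (∧-trueʳ (disjointᵇ (spokes H) (spokes F)) (∧-trueˡ parts)) j (trans (sym (lookup-pathIx H j)) e∈)))
        swap : ∀ e → (H ∪ F) ∪ ⁅ e ⁆ ≡ (H ∪ ⁅ e ⁆) ∪ F
        swap e = trans (∪-assoc H F ⁅ e ⁆) (trans (cong (H ∪_) (∪-comm F ⁅ e ⁆)) (sym (∪-assoc H ⁅ e ⁆ F)))

    rank-con≡ : ∀ F → Flat M F → rank (con M F) ≡ corank F
    rank-con≡ F fl = begin
      rank (con M F) ≡⟨ rank-con M isMatroid F fl ⟩
      rkᴳ ⊤ ∸ rkᴳ F ≡⟨ cong₂ _∸_ (rk≡ ⊤) (rk≡ F) ⟩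
      (suc m ∸ corank ⊤) ∸ (suc m ∸ corank F) ≡⟨ cong (λ z → (suc m ∸ z) ∸ (suc m ∸ corank F)) corank-⊤ ⟩
      suc m ∸ (suc m ∸ corank F) ≡⟨ ℕₚ.m∸[m∸n]≡n (corank-≤ F) ⟩
      corank F ∎
      where
      open ≡-Reasoning
      corank-⊤ : corank ⊤ ≡ 0
      corank-⊤ = trans (cong₂ (cork false) (spokes-replicate true) (paths-replicate true)) (cork-⊤ m false)

    -- The rank of `F` cancels, and a difference of ranks is the difference of the coranks in the
    -- opposite order.
    exponent : ∀ F H X → X ⊆ H → rk (con M F) H ∸ rk (con M F) X ≡ corank (X ∪ F) ∸ corank (H ∪ F)
    exponent F H X X⊆H = begin
      (rkᴳ (H ∪ F) ∸ rkᴳ F) ∸ (rkᴳ (X ∪ F) ∸ rkᴳ F) ≡⟨ ∸-triangle (rkᴳ (H ∪ F)) (rk-mono F (X ∪ F) (q⊆p∪q X F)) ⟩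
      rkᴳ (H ∪ F) ∸ rkᴳ (X ∪ F) ≡⟨ cong₂ _∸_ (rk≡ (H ∪ F)) (rk≡ (X ∪ F)) ⟩
      (n ∸ a) ∸ (n ∸ b) ≡⟨ cong (λ z → (z ∸ a) ∸ (n ∸ b)) (ℕₚ.m∸n+n≡m (corank-≤ (X ∪ F))) ⟨
      ((n ∸ b) +ℕ b ∸ a) ∸ (n ∸ b) ≡⟨ cong (_∸ (n ∸ b)) (ℕₚ.+-∸-assoc (n ∸ b) a≤b) ⟩
      ((n ∸ b) +ℕ (b ∸ a)) ∸ (n ∸ b) ≡⟨ ℕₚ.m+n∸m≡n (n ∸ b) (b ∸ a) ⟩
      b ∸ a ∎
      where
      open ≡-Reasoning
      n = suc m
      a = corank (H ∪ F)
      b = corank (X ∪ F)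
      a≤b : a ≤ b
      a≤b = corank-antitone (X ∪ F) (H ∪ F) (∪-⊆ (p⊆p∪q F ∘ X⊆H) (q⊆p∪q H F))

    charSumᴳ : EdgeSet → EdgeSet → Coeffs
    charSumᴳ F H = charSum false false (spokes F) (paths F) (spokes H) (paths H)

    χ-term≡ : ∀ F H X k → χ-term (loc (con M F) H) X k ≡ charTerm false false (spokes F) (paths F) (spokes H) (paths H) (spokes X) (paths X) k
    χ-term≡ F H X k = trans (by-subset (X ⊆ᵇ H) refl) (cong (λ b → (if b then sgn (∣ spokes X ∣ +ℕ ∣ paths X ∣) P.⊛ pow e else 0ₚ) k) (⊆ᵇ≡subᵇ X H))
      where
      e = cork false (spokes X ∪ spokes F) (paths X ∪ paths F) ∸ cork false (spokes H ∪ spokes F) (paths H ∪ paths F)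
      by-subset : ∀ b → X ⊆ᵇ H ≡ b →
        (if b then (λ k → if (rk (con M F) H ∸ rk (con M F) X) ≡ᵇ k then sign ∣ X ∣ else + 0) else 0ₚ) k ≡
        (if b then sgn (∣ spokes X ∣ +ℕ ∣ paths X ∣) P.⊛ pow e else 0ₚ) k
      by-subset false _ = refl
      by-subset true  h = trans
        (cong₂ (λ d n → if d ≡ᵇ k then sign n else + 0)
          (trans (exponent F H X (⊆ᵇ-sound {X = X} {H} h)) (cong₂ _∸_ (corank-∪ X F) (corank-∪ H F))) (size-edges X))
        (sgn-pow (∣ spokes X ∣ +ℕ ∣ paths X ∣) e k)

    χ≡charSum : ∀ F H k → χ (loc (con M F) H) k ≡ charSumᴳ F H k
    χ≡charSum F H k = begin
      χ (loc (con M F) H) k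
        ≡⟨ sumₚ-cong edgeSets (χ-term (loc (con M F) H)) (λ X → T (spokes X) (paths X)) k (λ X → χ-term≡ F H X k) ⟩
      sumₚ edgeSets (λ X → T (spokes X) (paths X)) k
        ≡⟨ sum-edges T k ⟩
      sumₚ (allSubsets (suc m)) (λ s → sumₚ (allSubsets m) (T s)) k
        ≡⟨ sum-words m T k ⟩
      ∑ m T k
        ≡⟨ charSum≈∑ false false (spokes F) (paths F) (spokes H) (paths H) tt k ⟨
      charSumᴳ F H k ∎
      where
      open ≡-Reasoning
      T = charTerm false false (spokes F) (paths F) (spokes H) (paths H)

    klPoly : EdgeSet → Coeffs
    klPoly F = fanProduct 0 (spokes F) (paths F)

    KL-term≡ : ∀ F → Flat M F → ∀ H k → KL-term (con M F) (λ H → klPoly (H ∪ F)) H k ≡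
      term free false 0 (spokes F) (paths F) (spokes H) (paths H) k
    KL-term≡ F fl H k = trans (cong (λ b → (if b then χ (loc (con M F) H) *ₚ klPoly (H ∪ F) else 0ₚ) k) (isFlat≡valid F fl H))
      (by-valid (validᵇ F H))
      where
      product : (χ (loc (con M F) H) *ₚ klPoly (H ∪ F)) k ≡ (charSumᴳ F H P.⊛ fanProduct 0 (spokes H ∪ spokes F) (paths H ∪ paths F)) k
      product = trans (*ₚ≡⊛ (χ (loc (con M F) H)) (klPoly (H ∪ F)) k)
        (P.⊛-cong (χ≡charSum F H) (λ i → cong₂ (λ s p → fanProduct 0 s p i) (spokes-zipWith _∨_ H F) (paths-zipWith _∨_ H F)) k)
      by-valid : ∀ b → (if b then χ (loc (con M F) H) *ₚ klPoly (H ∪ F) else 0ₚ) k ≡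
        (if b then charSumᴳ F H P.⊛ fanProduct 0 (spokes H ∪ spokes F) (paths H ∪ paths F) else P.𝟘) k
      by-valid true  = product
      by-valid false = refl

    recursion : ∀ F → Flat M F → ∀ k → rev (rank (con M F)) (klPoly F) k ≡
      sumₚ edgeSets (KL-term (con M F) (λ H → klPoly (H ∪ F))) k
    recursion F fl k = begin
      rev (rank (con M F)) (klPoly F) k
        ≡⟨ cong (λ d → rev d (klPoly F) k) (rank-con≡ F fl) ⟩
      rev (corank F) (klPoly F) k
        ≡⟨ Reverse⇒rev (fanProduct-reverse (spokes F) (paths F) (Flat⇒flatᵇ F fl)) k ⟩
      ∑ m Z k
        ≡⟨ sum-words m Z k ⟨
      sumₚ (allSubsets (suc m)) (λ s → sumₚ (allSubsets m) (Z s)) k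
        ≡⟨ sum-edges Z k ⟨
      sumₚ edgeSets (λ H → Z (spokes H) (paths H)) k
        ≡⟨ sumₚ-cong edgeSets (KL-term (con M F) (λ H → klPoly (H ∪ F))) (λ H → Z (spokes H) (paths H)) k (λ H → KL-term≡ F fl H k) ⟨
      sumₚ edgeSets (KL-term (con M F) (λ H → klPoly (H ∪ F))) k ∎
      where
      open ≡-Reasoning
      Z = term free false 0 (spokes F) (paths F)

    -- At the empty flat each vertex is an interval of its own and all form a single run, so the
    -- guess consists of one factor.
    KL-fan : ∀ P → IsKL P → ∀ k → P M k ≡ Reversal.fanPoly (suc m) k
    KL-fan P isKL k = trans
      (Uniqueness.P-unique P isKL M isMatroid klPoly
        (λ F fl → subst (λ d → Reversal.Admissible d (klPoly F)) (sym (rank-con≡ F fl)) (fanProduct-admissible (spokes F) (paths F) (Flat⇒flatᵇ F fl)))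
        recursion
        (flatᵇ⇒Flat ⊥ (trans (cong₂ flatᵇ (spokes-replicate false) (paths-replicate false)) (flatᵇ-⊥ m)))
        k)
      (trans (cong₂ (λ s p → fanProduct 0 s p k) (spokes-replicate false) (paths-replicate false)) (cong (λ f → f k) (fanProduct-⊥ m 0)))

-- The formula for the generating function of the fans.

module Conclusion (P : MatroidData → Coeffs) (isKL : IsKL P) where

  open import Data.Nat using (zero; suc; _∸_; z≤n)
  open import Data.Vec using ([])
  open import Data.Product using (_,_; proj₁)
  open import Relation.Binary.PropositionalEquality
  open Reversal using (fanPoly)

  fanGF≡ : ∀ n k → fanGF P n k ≡ fanPoly n k
  -- The single vertex carries no edges, so its matroid has rank 0.
  fanGF≡ zero k = trans (proj₁ (isKL (cycleMatroid (fan 0)) trivial (λ ())) refl k) (one k)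
    where
    trivial : IsMatroid (cycleMatroid (fan 0))
    trivial = record
      { R1 = λ { [] _ → z≤n } ; R2 = λ { [] [] _ _ → z≤n } ; R3 = λ { [] [] _ _ → z≤n } }
    one : ∀ k → δ₀ k ≡ fanPoly 0 k
    one zero    = refl
    one (suc k) = refl
  fanGF≡ (suc m) k = FanMatroid.Rank.KL-fan m (rk (cycleMatroid (fan (suc m))))
    (λ X → cong (suc (suc m) ∸_) (FanGraph.components≡ m X)) P isKL k

theorem4p1 : (P : MatroidData → Coeffs) → IsKL P →
    Σ Ser (λ S → IsSqrtDiscr S × IsFanRHS S (fanGF P))
    × ((S : Ser) → IsSqrtDiscr S → IsFanRHS S (fanGF P))
theorem4p1 P isKL =
    (sqrt , sqrt-isSqrt , fanRHS sqrt (fanGF P) sqrt≈root fanGF≡)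
  , (λ S isSqrt → fanRHS S (fanGF P) (sqrt-unique S isSqrt) fanGF≡)
  where
  open import Data.Product using (_,_)
  open GeneratingFunction
  open Conclusion P isKL
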